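{- Let $k\geqslant2$. The $\overline{\mathbb{F}_q}$-vector space $H^0(\mathbb{P}^1_{\mathbb{F}_q},\Omega^k((k-1)D))$ has dimension $N=k(q-1)-q$, and is spanned by Kurihara differentials.
   Context: $q$ is an odd prime power. $D=\sum_{x\in\mathbb{P}^1(\mathbb{F}_q)}(x)$, and $H^0(\mathbb{P}^1_{\mathbb{F}_q},\Omega^k((k-1)D))$ denotes the $\overline{\mathbb{F}_q}$-vector space of rational $k$-forms $g(z)(\mathrm{d}z)^k$, $g\in\overline{\mathbb{F}_q}(z)$, on the projective line that have poles of order at most $k-1$ at the points of $\mathbb{P}^1(\mathbb{F}_q)$ and are regular elsewhere. For distinct $\alpha,\beta\in\mathbb{P}^1(\mathbb{F}_q)$, $s(z;\alpha,\beta)=\left(\frac1{z-\beta}-\frac1{z-\alpha}\right)\mathrm{d}z$, with $\frac1{z-\infty}=0$. A Kurihara differential is a $k$-form $\prod_{i=1}^rs(z;\alpha_i,\beta_i)^{k_i}$ with $r\geqslant2$, $k_i\geqslant1$, $\sum_{i=1}^rk_i=k$, $\alpha_i,\beta_i\in\mathbb{P}^1(\mathbb{F}_q)$, $\alpha_i\neq\beta_i$, and $\bigcap_{i=1}^r\{\alpha_i,\beta_i\}=\emptyset$. -}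

module Defs where

open import Level using (Level; _⊔_; suc)
open import Algebra.Apartness.Bundles using (HeytingCommutativeRing; HeytingField)
import Algebra.Apartness.Properties.HeytingCommutativeRing as HeytingProperties
open import Algebra.Bundles using (CommutativeRing; Monoid)
import Algebra.Definitions as AlgebraDefinitions
import Algebra.Definitions.RawMonoid as RawMonoidDefinitions
open import Algebra.Module.Bundles using (Module)
open import Algebra.Module.Bundles.Raw using (RawModule)
open import Algebra.Module.Morphism.Structures using (IsModuleMonomorphism)
import Algebra.Module.Morphism.ModuleMonomorphism as ModuleMonomorphism
open import Algebra.Module.Structures using (IsLeftModule)
open import Algebra.Module.Structures.Biased using (IsModuleFromLeft)
open import Algebra.Morphism.Structures using (IsRingHomomorphism)
import Algebra.Properties.Ring as RingProperties
import Algebra.Properties.Semiring.Exp as SemiringExp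
import Algebra.Solver.Ring.NaturalCoefficients.Default as SemiringSolver
open import Data.Fin.Base using (Fin)
open import Data.List.Base using (List; []; _∷_; map)
import Data.Maybe.Base as Maybe
open import Data.Nat.Base as ℕ using (ℕ; zero; s≤s; z≤n)
open import Data.Nat.Divisibility using (_∣_)
open import Data.Nat.Primality using (Prime)
import Data.Nat.Properties as ℕₚ
open import Data.Product.Base using (Σ; ∃₂; ∃-syntax; _×_; _,_; proj₁; proj₂)
open import Data.Sum.Base using (_⊎_)
open import Data.Vec.Functional using (Vector)
open import Function.Base using (_on_; flip)
open import Function.Bundles using (Inverse)
open import Relation.Binary.Bundles using (Setoid)
open import Relation.Binary.Construct.Add.Point.Equality using (_≈∙_)
open import Relation.Binary.Definitions using (Decidable)
open import Relation.Binary.PropositionalEquality.Core as ≡ using (_≡_)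
import Relation.Binary.PropositionalEquality.Properties as ≡ₚ
import Relation.Binary.Reasoning.Setoid as SetoidReasoning
open import Relation.Nullary.Construct.Add.Point using (Pointed; ∙; [_])
open import Relation.Nullary.Decidable.Core using (yes; no)
open import Relation.Nullary.Negation.Core using (¬_; contradiction)
open import Relation.Nullary.Recomputable using (¬-recompute)
open import Relation.Unary using (Pred)

-- Decidability of the (tight) apartness makes this a discrete field:
-- _≈_ is decidable and every x ≉ 0 is invertible.  Note that 1# # 0# is
-- a consequence of the library's axioms.

record DiscreteField c ℓ₁ ℓ₂ : Set (suc (c ⊔ ℓ₁ ⊔ ℓ₂)) where
  field
    heytingField : HeytingField c ℓ₁ ℓ₂

  open HeytingField heytingField public
    using (Carrier; _≈_; _#_; _+_; _*_; -_; 0#; 1#; tight; heytingCommutativeRing)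

  field
    _#?_ : Decidable _#_

  commutativeRing : CommutativeRing c ℓ₁
  commutativeRing =
    HeytingCommutativeRing.commutativeRing heytingCommutativeRing

  open CommutativeRing commutativeRing public
    using (ring; rawRing; setoid; refl; sym; trans)

  private module H = HeytingProperties heytingCommutativeRing

  _≟_ : Decidable _≈_
  x ≟ y with x #? y
  ... | yes x#y = no λ x≈y → proj₂ (tight x y) x≈y x#y
  ... | no ¬x#y = yes (proj₁ (tight x y) ¬x#y)

  ≉⇒# : ∀ {x y} → ¬ x ≈ y → x # y
  ≉⇒# {x} {y} x≉y with x #? y
  ... | yes x#y = x#y
  ... | no ¬x#y = contradiction (proj₁ (tight x y) ¬x#y) x≉y

  #⇒≉ : ∀ {x y} → x # y → ¬ x ≈ y
  #⇒≉ {x} {y} x#y x≈y = proj₂ (tight x y) x≈y x#y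

  1≉0 : ¬ 1# ≈ 0#
  1≉0 = #⇒≉ H.1#0

  x*y≉0 : ∀ {x y} → ¬ x ≈ 0# → ¬ y ≈ 0# → ¬ x * y ≈ 0#
  x*y≉0 x≉0 y≉0 = #⇒≉ (H.x#0y#0→xy#0 (≉⇒# x≉0) (≉⇒# y≉0))

OddPrimePower : ℕ → Set
OddPrimePower q =
  ∃₂ λ p n → Prime p × 1 ℕ.≤ n × q ≡ p ℕ.^ n × ¬ 2 ∣ q

HasCardinality : ∀ {c ℓ} → Setoid c ℓ → ℕ → Set (c ⊔ ℓ)
HasCardinality S n = Inverse (≡ₚ.setoid (Fin n)) S

module Polynomial {c ℓ} (R : CommutativeRing c ℓ) where

  open CommutativeRing R
  open RingProperties ring using (-0#≈0#)
  open SetoidReasoning setoid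

  -- Coefficients in order of increasing degree; trailing zeros are
  -- allowed and are invisible to _≈ₚ_.

  Poly : Set c
  Poly = List Carrier

  coeff : Poly → ℕ → Carrier
  coeff []      _         = 0#
  coeff (a ∷ p) zero      = a
  coeff (a ∷ p) (ℕ.suc n) = coeff p n

  infix 4 _≈ₚ_
  record _≈ₚ_ (p q : Poly) : Set ℓ where
    constructor mk≈
    field coeff-≈ : ∀ n → coeff p n ≈ coeff q n
  open _≈ₚ_ public

  infixl 6 _+ₚ_
  infixl 7 _*ₚ_
  infixr 7 _·_
  infix  8 -ₚ_

  _+ₚ_ : Poly → Poly → Poly
  []      +ₚ q       = q
  (a ∷ p) +ₚ []      = a ∷ p
  (a ∷ p) +ₚ (b ∷ q) = a + b ∷ p +ₚ q

  _·_ : Carrier → Poly → Poly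
  a · p = map (a *_) p

  -ₚ_ : Poly → Poly
  -ₚ p = map (-_) p

  _*ₚ_ : Poly → Poly → Poly
  []      *ₚ q = []
  (a ∷ p) *ₚ q = (a · q) +ₚ (0# ∷ p *ₚ q)

  0ₚ 1ₚ X : Poly
  0ₚ = []
  1ₚ = 1# ∷ []
  X  = 0# ∷ 1# ∷ []

  eval : Poly → Carrier → Carrier
  eval []      x = 0#
  eval (a ∷ p) x = a + x * eval p x

  -- The zero polynomial satisfies Degree≤ n for every n.

  Degree≤ : Poly → ℕ → Set ℓ
  Degree≤ p n = ∀ i → n ℕ.< i → coeff p i ≈ 0#

  HasDegree : Poly → ℕ → Set ℓ
  HasDegree p n = ¬ coeff p n ≈ 0# × Degree≤ p n

  ≈ₚ-refl : ∀ {p} → p ≈ₚ p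
  ≈ₚ-refl = mk≈ λ _ → refl

  ≈ₚ-sym : ∀ {p q} → p ≈ₚ q → q ≈ₚ p
  ≈ₚ-sym (mk≈ e) = mk≈ λ n → sym (e n)

  ≈ₚ-trans : ∀ {p q r} → p ≈ₚ q → q ≈ₚ r → p ≈ₚ r
  ≈ₚ-trans (mk≈ e) (mk≈ f) = mk≈ λ n → trans (e n) (f n)

  polySetoid : Setoid c ℓ
  polySetoid = record
    { Carrier = Poly ; _≈_ = _≈ₚ_
    ; isEquivalence = record
      { refl = ≈ₚ-refl ; sym = ≈ₚ-sym ; trans = ≈ₚ-trans }
    }

  private module P = SetoidReasoning polySetoid

  coeff-+ : ∀ p q n → coeff (p +ₚ q) n ≈ coeff p n + coeff q n
  coeff-+ []      q       n         = sym (+-identityˡ _)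
  coeff-+ (a ∷ p) []      n         = sym (+-identityʳ _)
  coeff-+ (a ∷ p) (b ∷ q) zero      = refl
  coeff-+ (a ∷ p) (b ∷ q) (ℕ.suc n) = coeff-+ p q n

  coeff-· : ∀ a p n → coeff (a · p) n ≈ a * coeff p n
  coeff-· a []      n         = sym (zeroʳ a)
  coeff-· a (b ∷ p) zero      = refl
  coeff-· a (b ∷ p) (ℕ.suc n) = coeff-· a p n

  coeff-neg : ∀ p n → coeff (-ₚ p) n ≈ - coeff p n
  coeff-neg []      n         = sym -0#≈0#
  coeff-neg (b ∷ p) zero      = refl
  coeff-neg (b ∷ p) (ℕ.suc n) = coeff-neg p n

  ∷-cong : ∀ {a b p q} → a ≈ b → p ≈ₚ q → a ∷ p ≈ₚ b ∷ q
  ∷-cong a≈b p≈q = mk≈ λ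
    { zero → a≈b ; (ℕ.suc n) → coeff-≈ p≈q n }

  tail-cong : ∀ {a b p q} → a ∷ p ≈ₚ b ∷ q → p ≈ₚ q
  tail-cong e = mk≈ λ n → coeff-≈ e (ℕ.suc n)

  0∷-zero : ∀ {p} → p ≈ₚ [] → 0# ∷ p ≈ₚ []
  0∷-zero e = mk≈ λ { zero → refl ; (ℕ.suc n) → coeff-≈ e n }

  ∷-zero⁻¹ : ∀ {a p} → a ∷ p ≈ₚ [] → p ≈ₚ []
  ∷-zero⁻¹ e = mk≈ λ n → coeff-≈ e (ℕ.suc n)

  +ₚ-cong : ∀ {p p′ q q′} → p ≈ₚ p′ → q ≈ₚ q′ → p +ₚ q ≈ₚ p′ +ₚ q′
  +ₚ-cong {p} {p′} {q} {q′} e f = mk≈ λ n → begin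
    coeff (p +ₚ q) n         ≈⟨ coeff-+ p q n ⟩
    coeff p n + coeff q n    ≈⟨ +-cong (coeff-≈ e n) (coeff-≈ f n) ⟩
    coeff p′ n + coeff q′ n  ≈⟨ coeff-+ p′ q′ n ⟨
    coeff (p′ +ₚ q′) n       ∎

  +ₚ-assoc : ∀ p q r → (p +ₚ q) +ₚ r ≈ₚ p +ₚ (q +ₚ r)
  +ₚ-assoc p q r = mk≈ λ n → begin
    coeff ((p +ₚ q) +ₚ r) n                ≈⟨ coeff-+ (p +ₚ q) r n ⟩
    coeff (p +ₚ q) n + coeff r n           ≈⟨ +-congʳ (coeff-+ p q n) ⟩
    coeff p n + coeff q n + coeff r n      ≈⟨ +-assoc _ _ _ ⟩
    coeff p n + (coeff q n + coeff r n)    ≈⟨ +-congˡ (coeff-+ q r n) ⟨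
    coeff p n + coeff (q +ₚ r) n           ≈⟨ coeff-+ p (q +ₚ r) n ⟨
    coeff (p +ₚ (q +ₚ r)) n                ∎

  +ₚ-comm : ∀ p q → p +ₚ q ≈ₚ q +ₚ p
  +ₚ-comm p q = mk≈ λ n →
    trans (coeff-+ p q n) (trans (+-comm _ _) (sym (coeff-+ q p n)))

  +ₚ-identityʳ : ∀ p → p +ₚ [] ≈ₚ p
  +ₚ-identityʳ p = +ₚ-comm p []

  -ₚ-cong : ∀ {p q} → p ≈ₚ q → -ₚ p ≈ₚ -ₚ q
  -ₚ-cong {p} {q} e = mk≈ λ n →
    trans (coeff-neg p n) (trans (-‿cong (coeff-≈ e n)) (sym (coeff-neg q n)))

  -ₚ-inverseʳ : ∀ p → p +ₚ (-ₚ p) ≈ₚ []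
  -ₚ-inverseʳ p = mk≈ λ n → trans (coeff-+ p (-ₚ p) n)
    (trans (+-congˡ (coeff-neg p n)) (-‿inverseʳ _))

  ·-cong : ∀ {a b p q} → a ≈ b → p ≈ₚ q → a · p ≈ₚ b · q
  ·-cong {a} {b} {p} {q} e f = mk≈ λ n →
    trans (coeff-· a p n) (trans (*-cong e (coeff-≈ f n)) (sym (coeff-· b q n)))

  ·-zeroˡ : ∀ p → 0# · p ≈ₚ []
  ·-zeroˡ p = mk≈ λ n → trans (coeff-· 0# p n) (zeroˡ _)

  ·-identityˡ : ∀ p → 1# · p ≈ₚ p
  ·-identityˡ p = mk≈ λ n → trans (coeff-· 1# p n) (*-identityˡ _)

  ·-assoc : ∀ a b p → (a * b) · p ≈ₚ a · (b · p)
  ·-assoc a b p = mk≈ λ n → begin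
    coeff ((a * b) · p) n  ≈⟨ coeff-· (a * b) p n ⟩
    a * b * coeff p n      ≈⟨ *-assoc _ _ _ ⟩
    a * (b * coeff p n)    ≈⟨ *-congˡ (coeff-· b p n) ⟨
    a * coeff (b · p) n    ≈⟨ coeff-· a (b · p) n ⟨
    coeff (a · (b · p)) n  ∎

  ·-distribˡ : ∀ a p q → a · (p +ₚ q) ≈ₚ (a · p) +ₚ (a · q)
  ·-distribˡ a p q = mk≈ λ n → begin
    coeff (a · (p +ₚ q)) n               ≈⟨ coeff-· a (p +ₚ q) n ⟩
    a * coeff (p +ₚ q) n                 ≈⟨ *-congˡ (coeff-+ p q n) ⟩
    a * (coeff p n + coeff q n)          ≈⟨ distribˡ _ _ _ ⟩
    a * coeff p n + a * coeff q n        ≈⟨ +-cong (coeff-· a p n) (coeff-· a q n) ⟨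
    coeff (a · p) n + coeff (a · q) n    ≈⟨ coeff-+ (a · p) (a · q) n ⟨
    coeff ((a · p) +ₚ (a · q)) n         ∎

  ·-distribʳ : ∀ a b p → (a + b) · p ≈ₚ (a · p) +ₚ (b · p)
  ·-distribʳ a b p = mk≈ λ n → begin
    coeff ((a + b) · p) n                ≈⟨ coeff-· (a + b) p n ⟩
    (a + b) * coeff p n                  ≈⟨ distribʳ _ _ _ ⟩
    a * coeff p n + b * coeff p n        ≈⟨ +-cong (coeff-· a p n) (coeff-· b p n) ⟨
    coeff (a · p) n + coeff (b · p) n    ≈⟨ coeff-+ (a · p) (b · p) n ⟨
    coeff ((a · p) +ₚ (b · p)) n         ∎

  0∷-+ : ∀ p q → 0# ∷ (p +ₚ q) ≈ₚ (0# ∷ p) +ₚ (0# ∷ q)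
  0∷-+ p q = ∷-cong (sym (+-identityˡ 0#)) ≈ₚ-refl

  0∷-· : ∀ a p → 0# ∷ (a · p) ≈ₚ a · (0# ∷ p)
  0∷-· a p = ∷-cong (sym (zeroʳ a)) ≈ₚ-refl

  +ₚ-interchange : ∀ p q r s →
    (p +ₚ q) +ₚ (r +ₚ s) ≈ₚ (p +ₚ r) +ₚ (q +ₚ s)
  +ₚ-interchange p q r s = P.begin
    (p +ₚ q) +ₚ (r +ₚ s)  P.≈⟨ +ₚ-assoc p q (r +ₚ s) ⟩
    p +ₚ (q +ₚ (r +ₚ s))  P.≈⟨ +ₚ-cong (≈ₚ-refl {p}) (+ₚ-assoc q r s) ⟨
    p +ₚ ((q +ₚ r) +ₚ s)  P.≈⟨ +ₚ-cong (≈ₚ-refl {p}) (+ₚ-cong (+ₚ-comm q r) (≈ₚ-refl {s})) ⟩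
    p +ₚ ((r +ₚ q) +ₚ s)  P.≈⟨ +ₚ-cong (≈ₚ-refl {p}) (+ₚ-assoc r q s) ⟩
    p +ₚ (r +ₚ (q +ₚ s))  P.≈⟨ +ₚ-assoc p r (q +ₚ s) ⟨
    (p +ₚ r) +ₚ (q +ₚ s)  P.∎

  0∷-* : ∀ p q → (0# ∷ p) *ₚ q ≈ₚ 0# ∷ (p *ₚ q)
  0∷-* p q = +ₚ-cong (·-zeroˡ q) ≈ₚ-refl

  *ₚ-congʳ : ∀ p {q q′} → q ≈ₚ q′ → p *ₚ q ≈ₚ p *ₚ q′
  *ₚ-congʳ []      e = ≈ₚ-refl
  *ₚ-congʳ (a ∷ p) e = +ₚ-cong (·-cong refl e) (∷-cong refl (*ₚ-congʳ p e))

  *ₚ-zeroʳ : ∀ p → p *ₚ [] ≈ₚ []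
  *ₚ-zeroʳ []      = ≈ₚ-refl
  *ₚ-zeroʳ (a ∷ p) = 0∷-zero (*ₚ-zeroʳ p)

  *ₚ-distribʳ : ∀ r p q → (p +ₚ q) *ₚ r ≈ₚ (p *ₚ r) +ₚ (q *ₚ r)
  *ₚ-distribʳ r []      q       = ≈ₚ-refl
  *ₚ-distribʳ r (a ∷ p) []      = ≈ₚ-sym (+ₚ-identityʳ _)
  *ₚ-distribʳ r (a ∷ p) (b ∷ q) = P.begin
    ((a + b) · r) +ₚ (0# ∷ (p +ₚ q) *ₚ r)
      P.≈⟨ +ₚ-cong (·-distribʳ a b r) (∷-cong refl (*ₚ-distribʳ r p q)) ⟩
    ((a · r) +ₚ (b · r)) +ₚ (0# ∷ ((p *ₚ r) +ₚ (q *ₚ r)))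
      P.≈⟨ +ₚ-cong ≈ₚ-refl (0∷-+ (p *ₚ r) (q *ₚ r)) ⟩
    ((a · r) +ₚ (b · r)) +ₚ ((0# ∷ p *ₚ r) +ₚ (0# ∷ q *ₚ r))
      P.≈⟨ +ₚ-interchange (a · r) (b · r) _ _ ⟩
    ((a ∷ p) *ₚ r) +ₚ ((b ∷ q) *ₚ r) P.∎

  ·-*-assoc : ∀ a p q → (a · p) *ₚ q ≈ₚ a · (p *ₚ q)
  ·-*-assoc a []      q = ≈ₚ-refl
  ·-*-assoc a (b ∷ p) q = P.begin
    ((a * b) · q) +ₚ (0# ∷ (a · p) *ₚ q)
      P.≈⟨ +ₚ-cong (·-assoc a b q) (∷-cong refl (·-*-assoc a p q)) ⟩
    (a · (b · q)) +ₚ (0# ∷ a · (p *ₚ q))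
      P.≈⟨ +ₚ-cong ≈ₚ-refl (0∷-· a (p *ₚ q)) ⟩
    (a · (b · q)) +ₚ (a · (0# ∷ p *ₚ q))
      P.≈⟨ ·-distribˡ a (b · q) (0# ∷ p *ₚ q) ⟨
    a · ((b ∷ p) *ₚ q) P.∎

  *ₚ-assoc : ∀ p q r → (p *ₚ q) *ₚ r ≈ₚ p *ₚ (q *ₚ r)
  *ₚ-assoc []      q r = ≈ₚ-refl
  *ₚ-assoc (a ∷ p) q r = P.begin
    ((a · q) +ₚ (0# ∷ p *ₚ q)) *ₚ r
      P.≈⟨ *ₚ-distribʳ r (a · q) (0# ∷ p *ₚ q) ⟩
    ((a · q) *ₚ r) +ₚ ((0# ∷ p *ₚ q) *ₚ r)
      P.≈⟨ +ₚ-cong (·-*-assoc a q r) (0∷-* (p *ₚ q) r) ⟩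
    (a · (q *ₚ r)) +ₚ (0# ∷ (p *ₚ q) *ₚ r)
      P.≈⟨ +ₚ-cong ≈ₚ-refl (∷-cong refl (*ₚ-assoc p q r)) ⟩
    (a ∷ p) *ₚ (q *ₚ r) P.∎

  *ₚ-∷ : ∀ p b q → p *ₚ (b ∷ q) ≈ₚ (b · p) +ₚ (0# ∷ p *ₚ q)
  *ₚ-∷ []      b q = ≈ₚ-sym (0∷-zero ≈ₚ-refl)
  *ₚ-∷ (a ∷ p) b q = ∷-cong (+-congʳ (*-comm a b)) (P.begin
    (a · q) +ₚ (p *ₚ (b ∷ q))
      P.≈⟨ +ₚ-cong ≈ₚ-refl (*ₚ-∷ p b q) ⟩
    (a · q) +ₚ ((b · p) +ₚ (0# ∷ p *ₚ q))
      P.≈⟨ +ₚ-assoc (a · q) (b · p) _ ⟨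
    ((a · q) +ₚ (b · p)) +ₚ (0# ∷ p *ₚ q)
      P.≈⟨ +ₚ-cong (+ₚ-comm (a · q) (b · p)) ≈ₚ-refl ⟩
    ((b · p) +ₚ (a · q)) +ₚ (0# ∷ p *ₚ q)
      P.≈⟨ +ₚ-assoc (b · p) (a · q) _ ⟩
    (b · p) +ₚ ((a ∷ p) *ₚ q) P.∎)

  *ₚ-comm : ∀ p q → p *ₚ q ≈ₚ q *ₚ p
  *ₚ-comm []      q = ≈ₚ-sym (*ₚ-zeroʳ q)
  *ₚ-comm (a ∷ p) q = P.begin
    (a · q) +ₚ (0# ∷ p *ₚ q)  P.≈⟨ +ₚ-cong ≈ₚ-refl (∷-cong refl (*ₚ-comm p q)) ⟩
    (a · q) +ₚ (0# ∷ q *ₚ p)  P.≈⟨ *ₚ-∷ q a p ⟨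
    q *ₚ (a ∷ p)              P.∎

  *ₚ-cong : ∀ {p p′ q q′} → p ≈ₚ p′ → q ≈ₚ q′ → p *ₚ q ≈ₚ p′ *ₚ q′
  *ₚ-cong {p} {p′} {q} {q′} e f = P.begin
    p *ₚ q    P.≈⟨ *ₚ-congʳ p f ⟩
    p *ₚ q′   P.≈⟨ *ₚ-comm p q′ ⟩
    q′ *ₚ p   P.≈⟨ *ₚ-congʳ q′ e ⟩
    q′ *ₚ p′  P.≈⟨ *ₚ-comm q′ p′ ⟩
    p′ *ₚ q′  P.∎

  *ₚ-identityˡ : ∀ p → 1ₚ *ₚ p ≈ₚ p
  *ₚ-identityˡ p = P.begin
    (1# · p) +ₚ (0# ∷ [])  P.≈⟨ +ₚ-cong (·-identityˡ p) (0∷-zero ≈ₚ-refl) ⟩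
    p +ₚ []                P.≈⟨ +ₚ-identityʳ p ⟩
    p                      P.∎

  polyRing : CommutativeRing c ℓ
  polyRing = record
    { Carrier = Poly ; _≈_ = _≈ₚ_ ; _+_ = _+ₚ_ ; _*_ = _*ₚ_
    ; -_ = -ₚ_ ; 0# = 0ₚ ; 1# = 1ₚ
    ; isCommutativeRing = record
      { isRing = record
        { +-isAbelianGroup = record
          { isGroup = record
            { isMonoid = record
              { isSemigroup = record
                { isMagma = record
                  { isEquivalence = Setoid.isEquivalence polySetoid
                  ; ∙-cong = +ₚ-cong }
                ; assoc = +ₚ-assoc }
              ; identity = (λ _ → ≈ₚ-refl) , +ₚ-identityʳ }
            ; inverse = (λ p → ≈ₚ-trans (+ₚ-comm (-ₚ p) p) (-ₚ-inverseʳ p))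
                      , -ₚ-inverseʳ
            ; ⁻¹-cong = -ₚ-cong }
          ; comm = +ₚ-comm }
        ; *-cong = *ₚ-cong
        ; *-assoc = *ₚ-assoc
        ; *-identity = *ₚ-identityˡ
                     , λ p → ≈ₚ-trans (*ₚ-comm p 1ₚ) (*ₚ-identityˡ p)
        ; distrib = (λ r p q → ≈ₚ-trans (*ₚ-comm r (p +ₚ q))
                      (≈ₚ-trans (*ₚ-distribʳ r p q)
                        (+ₚ-cong (*ₚ-comm p r) (*ₚ-comm q r))))
                  , *ₚ-distribʳ }
      ; *-comm = *ₚ-comm }
    }

  eval-zero : ∀ {p} → p ≈ₚ [] → ∀ x → eval p x ≈ 0#
  eval-zero {[]}    e x = refl
  eval-zero {a ∷ p} e x = begin
    a + x * eval p x  ≈⟨ +-cong (coeff-≈ e 0) (*-congˡ (eval-zero (∷-zero⁻¹ e) x)) ⟩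
    0# + x * 0#       ≈⟨ +-identityˡ _ ⟩
    x * 0#            ≈⟨ zeroʳ x ⟩
    0#                ∎

  eval-cong : ∀ {p q} → p ≈ₚ q → ∀ x → eval p x ≈ eval q x
  eval-cong {[]}    {q}     e x = sym (eval-zero (≈ₚ-sym e) x)
  eval-cong {a ∷ p} {[]}    e x = eval-zero e x
  eval-cong {a ∷ p} {b ∷ q} e x =
    +-cong (coeff-≈ e 0) (*-congˡ (eval-cong (tail-cong e) x))

  private
    module S = SemiringSolver commutativeSemiring

  eval-+ : ∀ p q x → eval (p +ₚ q) x ≈ eval p x + eval q x
  eval-+ []      q       x = sym (+-identityˡ _)
  eval-+ (a ∷ p) []      x = sym (+-identityʳ _)
  eval-+ (a ∷ p) (b ∷ q) x = begin
    a + b + x * eval (p +ₚ q) x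
      ≈⟨ +-congˡ (*-congˡ (eval-+ p q x)) ⟩
    a + b + x * (eval p x + eval q x)
      ≈⟨ S.solve 5 (λ a b x u v → a S.:+ b S.:+ x S.:* (u S.:+ v) S.:=
           (a S.:+ x S.:* u) S.:+ (b S.:+ x S.:* v)) refl a b x _ _ ⟩
    (a + x * eval p x) + (b + x * eval q x) ∎

  eval-· : ∀ a p x → eval (a · p) x ≈ a * eval p x
  eval-· a []      x = sym (zeroʳ a)
  eval-· a (b ∷ p) x = begin
    a * b + x * eval (a · p) x    ≈⟨ +-congˡ (*-congˡ (eval-· a p x)) ⟩
    a * b + x * (a * eval p x)    ≈⟨ S.solve 4 (λ a b x u →
                                       a S.:* b S.:+ x S.:* (a S.:* u) S.:=
                                       a S.:* (b S.:+ x S.:* u)) refl a b x _ ⟩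
    a * (b + x * eval p x)        ∎

  eval-* : ∀ p q x → eval (p *ₚ q) x ≈ eval p x * eval q x
  eval-* []      q x = sym (zeroˡ _)
  eval-* (a ∷ p) q x = begin
    eval ((a · q) +ₚ (0# ∷ p *ₚ q)) x
      ≈⟨ eval-+ (a · q) (0# ∷ p *ₚ q) x ⟩
    eval (a · q) x + (0# + x * eval (p *ₚ q) x)
      ≈⟨ +-cong (eval-· a q x) (trans (+-identityˡ _) (*-congˡ (eval-* p q x))) ⟩
    a * eval q x + x * (eval p x * eval q x)
      ≈⟨ S.solve 4 (λ a x u v → a S.:* v S.:+ x S.:* (u S.:* v) S.:=
           (a S.:+ x S.:* u) S.:* v) refl a x _ _ ⟩
    (a + x * eval p x) * eval q x ∎

  eval-1 : ∀ x → eval 1ₚ x ≈ 1#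
  eval-1 x = trans (+-congˡ (zeroʳ x)) (+-identityʳ 1#)

  degree≤-mono : ∀ p {m n} → m ℕ.≤ n → Degree≤ p m → Degree≤ p n
  degree≤-mono p m≤n d i n<i = d i (ℕₚ.≤-<-trans m≤n n<i)

  degree≤-+ : ∀ p q {n} → Degree≤ p n → Degree≤ q n → Degree≤ (p +ₚ q) n
  degree≤-+ p q d e i n<i = trans (coeff-+ p q i)
    (trans (+-cong (d i n<i) (e i n<i)) (+-identityˡ 0#))

  *ₚ-zeroˡ : ∀ {p} → p ≈ₚ [] → ∀ q → p *ₚ q ≈ₚ []
  *ₚ-zeroˡ e q = *ₚ-cong e (≈ₚ-refl {q})

  top-coeff-* : ∀ p q m n → Degree≤ p m → Degree≤ q n →
    Degree≤ (p *ₚ q) (m ℕ.+ n) ×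
    coeff (p *ₚ q) (m ℕ.+ n) ≈ coeff p m * coeff q n
  top-coeff-* []      q m         n d e = (λ _ _ → refl) , sym (zeroˡ _)
  top-coeff-* (a ∷ p) q zero      n d e =
    (λ i n<i → trans (low i) (trans (*-congˡ (e i n<i)) (zeroʳ a))) , low n
    where
    p≈0 : p ≈ₚ []
    p≈0 = mk≈ λ i → d (ℕ.suc i) (s≤s z≤n)
    low : ∀ i → coeff ((a ∷ p) *ₚ q) i ≈ a * coeff q i
    low i = begin
      coeff ((a · q) +ₚ (0# ∷ p *ₚ q)) i
        ≈⟨ coeff-+ (a · q) (0# ∷ p *ₚ q) i ⟩
      coeff (a · q) i + coeff (0# ∷ p *ₚ q) i
        ≈⟨ +-cong (coeff-· a q i) (coeff-≈ (0∷-zero (*ₚ-zeroˡ p≈0 q)) i) ⟩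
      a * coeff q i + 0#
        ≈⟨ +-identityʳ _ ⟩
      a * coeff q i ∎
  top-coeff-* (a ∷ p) q (ℕ.suc m) n d e = high , trans (step (m ℕ.+ n) (s≤s (ℕₚ.m≤n+m n m))) (proj₂ ih)
    where
    ih : Degree≤ (p *ₚ q) (m ℕ.+ n) ×
         coeff (p *ₚ q) (m ℕ.+ n) ≈ coeff p m * coeff q n
    ih = top-coeff-* p q m n (λ i m<i → d (ℕ.suc i) (s≤s m<i)) e
    step : ∀ i → n ℕ.< ℕ.suc i →
           coeff ((a ∷ p) *ₚ q) (ℕ.suc i) ≈ coeff (p *ₚ q) i
    step i n<i = begin
      coeff ((a · q) +ₚ (0# ∷ p *ₚ q)) (ℕ.suc i)
        ≈⟨ coeff-+ (a · q) (0# ∷ p *ₚ q) (ℕ.suc i) ⟩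
      coeff (a · q) (ℕ.suc i) + coeff (p *ₚ q) i
        ≈⟨ +-congʳ (trans (coeff-· a q (ℕ.suc i))
             (trans (*-congˡ (e (ℕ.suc i) n<i)) (zeroʳ a))) ⟩
      0# + coeff (p *ₚ q) i
        ≈⟨ +-identityˡ _ ⟩
      coeff (p *ₚ q) i ∎
    high : Degree≤ ((a ∷ p) *ₚ q) (ℕ.suc m ℕ.+ n)
    high (ℕ.suc i) (s≤s m+n<i) = trans
      (step i (s≤s (ℕₚ.≤-trans (ℕₚ.m≤n+m n m) (ℕₚ.<⇒≤ m+n<i))))
      (proj₁ ih i m+n<i)

module _ {c ℓ₁ ℓ₂} (K : DiscreteField c ℓ₁ ℓ₂) where

  open DiscreteField K
  open Polynomial commutativeRing
  open CommutativeRing commutativeRing using (+-identityʳ)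
  private module PR = CommutativeRing polyRing

  noZeroDivisors : ∀ p q → ¬ p ≈ₚ [] → p *ₚ q ≈ₚ [] → q ≈ₚ []
  noZeroDivisors []      q p≉0 e = contradiction ≈ₚ-refl p≉0
  noZeroDivisors (a ∷ p) q p≉0 e with a ≟ 0#
  ... | yes a≈0 = noZeroDivisors p q (λ p≈0 → p≉0 (a∷p≈0 p≈0)) (∷-zero⁻¹ e′)
    where
    a∷p≈0 : p ≈ₚ [] → a ∷ p ≈ₚ []
    a∷p≈0 p≈0 = ≈ₚ-trans (∷-cong a≈0 p≈0) (0∷-zero ≈ₚ-refl)
    e′ : 0# ∷ (p *ₚ q) ≈ₚ []
    e′ = ≈ₚ-trans (≈ₚ-sym (0∷-* p q))
      (≈ₚ-trans (*ₚ-cong (∷-cong (sym a≈0) (≈ₚ-refl {p})) (≈ₚ-refl {q})) e)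
  ... | no a≉0 = go q e
    where
    go : ∀ q → (a ∷ p) *ₚ q ≈ₚ [] → q ≈ₚ []
    go []      e = ≈ₚ-refl
    go (b ∷ q) e = ≈ₚ-trans (∷-cong b≈0 (go q (∷-zero⁻¹ e′))) (0∷-zero ≈ₚ-refl)
      where
      ab≈0 : a * b ≈ 0#
      ab≈0 = trans (sym (+-identityʳ _)) (coeff-≈ e 0)
      b≈0 : b ≈ 0#
      b≈0 with b ≟ 0#
      ... | yes z = z
      ... | no  b≉0 = contradiction ab≈0 (x*y≉0 a≉0 b≉0)
      e′ : 0# ∷ ((a ∷ p) *ₚ q) ≈ₚ []
      e′ = ≈ₚ-trans (≈ₚ-sym
             (≈ₚ-trans (*ₚ-comm (a ∷ p) (0# ∷ q))
             (≈ₚ-trans (0∷-* q (a ∷ p)) (∷-cong refl (*ₚ-comm q (a ∷ p))))))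
             (≈ₚ-trans (*ₚ-congʳ (a ∷ p) (∷-cong (sym b≈0) ≈ₚ-refl)) e)

  polyCancel : AlgebraDefinitions.AlmostLeftCancellative _≈ₚ_ 0ₚ _*ₚ_
  polyCancel p q r p≉0 e = RP.x∙y⁻¹≈ε⇒x≈y q r
    (noZeroDivisors p (q +ₚ (-ₚ r)) p≉0
      (≈ₚ-trans (PR.distribˡ p q (-ₚ r))
        (≈ₚ-trans (+ₚ-cong e (≈ₚ-sym (RP.-‿distribʳ-* p r))) (-ₚ-inverseʳ (p *ₚ r)))))
    where module RP = RingProperties PR.ring

  1ₚ≉0ₚ : ¬ 1ₚ ≈ₚ 0ₚ
  1ₚ≉0ₚ e = 1≉0 (coeff-≈ e 0)

module Fractions
  {c ℓ} (R : CommutativeRing c ℓ)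
  (cancel : AlgebraDefinitions.AlmostLeftCancellative (CommutativeRing._≈_ R)
              (CommutativeRing.0# R) (CommutativeRing._*_ R))
  (1≉0 : ¬ CommutativeRing._≈_ R (CommutativeRing.1# R) (CommutativeRing.0# R))
  where

  open CommutativeRing R
  open RingProperties ring using (-‿distribˡ-*)
  open SetoidReasoning setoid
  private module S = SemiringSolver commutativeSemiring

  record Fraction : Set (c ⊔ ℓ) where
    constructor frac
    field
      num      : Carrier
      den      : Carrier
      .nonzero : ¬ den ≈ 0#
  open Fraction public

  den≉0 : ∀ g → ¬ den g ≈ 0#
  den≉0 (frac _ _ b≉0) = ¬-recompute b≉0

  infix 4 _≈ᶠ_
  record _≈ᶠ_ (g h : Fraction) : Set ℓ where
    constructor mk≈ᶠ
    field cross : num g * den h ≈ num h * den g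
  open _≈ᶠ_ public

  *-≉0 : ∀ {x y} → ¬ x ≈ 0# → ¬ y ≈ 0# → ¬ x * y ≈ 0#
  *-≉0 {x} {y} x≉0 y≉0 e = y≉0 (cancel x y 0# x≉0 (trans e (sym (zeroʳ x))))

  infixl 6 _+ᶠ_
  infixl 7 _*ᶠ_
  infix  8 -ᶠ_

  _+ᶠ_ : Fraction → Fraction → Fraction
  frac a b b≉0 +ᶠ frac c d d≉0 = frac (a * d + c * b) (b * d) (*-≉0 b≉0 d≉0)

  _*ᶠ_ : Fraction → Fraction → Fraction
  frac a b b≉0 *ᶠ frac c d d≉0 = frac (a * c) (b * d) (*-≉0 b≉0 d≉0)

  -ᶠ_ : Fraction → Fraction
  -ᶠ frac a b b≉0 = frac (- a) b b≉0

  embed : Carrier → Fraction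
  embed a = frac a 1# 1≉0

  ≈ᶠ-refl : ∀ {g} → g ≈ᶠ g
  ≈ᶠ-refl = mk≈ᶠ refl

  ≈ᶠ-sym : ∀ {g h} → g ≈ᶠ h → h ≈ᶠ g
  ≈ᶠ-sym (mk≈ᶠ e) = mk≈ᶠ (sym e)

  ≈ᶠ-trans : ∀ {g h k} → g ≈ᶠ h → h ≈ᶠ k → g ≈ᶠ k
  ≈ᶠ-trans {frac a b _} {frac a′ b′ b′≉0} {frac a″ b″ _} (mk≈ᶠ e) (mk≈ᶠ f) =
    mk≈ᶠ (cancel b′ _ _ (¬-recompute b′≉0) (begin
      b′ * (a * b″)   ≈⟨ S.solve 3 (λ x y z → x S.:* (y S.:* z) S.:= (y S.:* x) S.:* z) refl b′ a b″ ⟩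
      (a * b′) * b″   ≈⟨ *-congʳ e ⟩
      (a′ * b) * b″   ≈⟨ S.solve 3 (λ x y z → (x S.:* y) S.:* z S.:= (x S.:* z) S.:* y) refl a′ b b″ ⟩
      (a′ * b″) * b   ≈⟨ *-congʳ f ⟩
      (a″ * b′) * b   ≈⟨ S.solve 3 (λ x y z → (x S.:* y) S.:* z S.:= y S.:* (x S.:* z)) refl a″ b′ b ⟩
      b′ * (a″ * b)   ∎))

  +ᶠ-cong : ∀ {g g′ h h′} → g ≈ᶠ g′ → h ≈ᶠ h′ → g +ᶠ h ≈ᶠ g′ +ᶠ h′
  +ᶠ-cong {frac a b _} {frac a′ b′ _} {frac c d _} {frac c′ d′ _} (mk≈ᶠ e) (mk≈ᶠ f) =
    mk≈ᶠ (begin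
      (a * d + c * b) * (b′ * d′)
        ≈⟨ S.solve 6 (λ a b c d b′ d′ →
             (a S.:* d S.:+ c S.:* b) S.:* (b′ S.:* d′) S.:=
             (a S.:* b′) S.:* (d S.:* d′) S.:+ (c S.:* d′) S.:* (b S.:* b′))
             refl a b c d b′ d′ ⟩
      (a * b′) * (d * d′) + (c * d′) * (b * b′)
        ≈⟨ +-cong (*-congʳ e) (*-congʳ f) ⟩
      (a′ * b) * (d * d′) + (c′ * d) * (b * b′)
        ≈⟨ S.solve 6 (λ a′ b c′ d b′ d′ →
             (a′ S.:* b) S.:* (d S.:* d′) S.:+ (c′ S.:* d) S.:* (b S.:* b′) S.:=
             (a′ S.:* d′ S.:+ c′ S.:* b′) S.:* (b S.:* d))
             refl a′ b c′ d b′ d′ ⟩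
      (a′ * d′ + c′ * b′) * (b * d) ∎)

  *ᶠ-cong : ∀ {g g′ h h′} → g ≈ᶠ g′ → h ≈ᶠ h′ → g *ᶠ h ≈ᶠ g′ *ᶠ h′
  *ᶠ-cong {frac a b _} {frac a′ b′ _} {frac c d _} {frac c′ d′ _} (mk≈ᶠ e) (mk≈ᶠ f) =
    mk≈ᶠ (begin
      (a * c) * (b′ * d′)    ≈⟨ swap a c b′ d′ ⟩
      (a * b′) * (c * d′)    ≈⟨ *-cong e f ⟩
      (a′ * b) * (c′ * d)    ≈⟨ swap a′ b c′ d ⟩
      (a′ * c′) * (b * d)    ∎)
    where
    swap : ∀ w x y z → (w * x) * (y * z) ≈ (w * y) * (x * z)
    swap = S.solve 4 (λ w x y z →
      (w S.:* x) S.:* (y S.:* z) S.:= (w S.:* y) S.:* (x S.:* z)) refl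

  -ᶠ-cong : ∀ {g h} → g ≈ᶠ h → -ᶠ g ≈ᶠ -ᶠ h
  -ᶠ-cong {frac a b _} {frac c d _} (mk≈ᶠ e) = mk≈ᶠ (begin
    - a * d    ≈⟨ -‿distribˡ-* a d ⟨
    - (a * d)  ≈⟨ -‿cong e ⟩
    - (c * b)  ≈⟨ -‿distribˡ-* c b ⟩
    - c * b    ∎)

  +ᶠ-comm : ∀ g h → g +ᶠ h ≈ᶠ h +ᶠ g
  +ᶠ-comm (frac a b _) (frac c d _) = mk≈ᶠ (S.solve 4 (λ a b c d →
    (a S.:* d S.:+ c S.:* b) S.:* (d S.:* b) S.:=
    (c S.:* b S.:+ a S.:* d) S.:* (b S.:* d)) refl a b c d)

  *ᶠ-comm : ∀ g h → g *ᶠ h ≈ᶠ h *ᶠ g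
  *ᶠ-comm (frac a b _) (frac c d _) = mk≈ᶠ (S.solve 4 (λ a b c d →
    (a S.:* c) S.:* (d S.:* b) S.:= (c S.:* a) S.:* (b S.:* d)) refl a b c d)

  +ᶠ-assoc : ∀ g h k → (g +ᶠ h) +ᶠ k ≈ᶠ g +ᶠ (h +ᶠ k)
  +ᶠ-assoc (frac a b _) (frac c d _) (frac e f _) = mk≈ᶠ (S.solve 6 (λ a b c d e f →
    ((a S.:* d S.:+ c S.:* b) S.:* f S.:+ e S.:* (b S.:* d)) S.:* (b S.:* (d S.:* f)) S.:=
    (a S.:* (d S.:* f) S.:+ (c S.:* f S.:+ e S.:* d) S.:* b) S.:* ((b S.:* d) S.:* f))
    refl a b c d e f)

  *ᶠ-assoc : ∀ g h k → (g *ᶠ h) *ᶠ k ≈ᶠ g *ᶠ (h *ᶠ k)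
  *ᶠ-assoc (frac a b _) (frac c d _) (frac e f _) = mk≈ᶠ (S.solve 6 (λ a b c d e f →
    ((a S.:* c) S.:* e) S.:* (b S.:* (d S.:* f)) S.:=
    (a S.:* (c S.:* e)) S.:* ((b S.:* d) S.:* f))
    refl a b c d e f)

  +ᶠ-identityˡ : ∀ g → embed 0# +ᶠ g ≈ᶠ g
  +ᶠ-identityˡ (frac a b _) = mk≈ᶠ (S.solve 2 (λ a b →
    (S.con 0 S.:* b S.:+ a S.:* S.con 1) S.:* b S.:= a S.:* (S.con 1 S.:* b)) refl a b)

  *ᶠ-identityˡ : ∀ g → embed 1# *ᶠ g ≈ᶠ g
  *ᶠ-identityˡ (frac a b _) = mk≈ᶠ (S.solve 2 (λ a b →
    (S.con 1 S.:* a) S.:* b S.:= a S.:* (S.con 1 S.:* b)) refl a b)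

  -ᶠ-inverseˡ : ∀ g → -ᶠ g +ᶠ g ≈ᶠ embed 0#
  -ᶠ-inverseˡ (frac a b _) = mk≈ᶠ (begin
    (- a * b + a * b) * 1#   ≈⟨ *-congʳ (+-congʳ (-‿distribˡ-* a b)) ⟨
    (- (a * b) + a * b) * 1# ≈⟨ *-congʳ (-‿inverseˡ (a * b)) ⟩
    0# * 1#                  ≈⟨ zeroˡ 1# ⟩
    0#                       ≈⟨ zeroˡ (b * b) ⟨
    0# * (b * b)             ∎)

  *ᶠ-distribˡ : ∀ g h k → g *ᶠ (h +ᶠ k) ≈ᶠ (g *ᶠ h) +ᶠ (g *ᶠ k)
  *ᶠ-distribˡ (frac a b _) (frac c d _) (frac e f _) = mk≈ᶠ (S.solve 6 (λ a b c d e f →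
    (a S.:* (c S.:* f S.:+ e S.:* d)) S.:* ((b S.:* d) S.:* (b S.:* f)) S.:=
    ((a S.:* c) S.:* (b S.:* f) S.:+ (a S.:* e) S.:* (b S.:* d)) S.:* (b S.:* (d S.:* f)))
    refl a b c d e f)

  fractionRing : CommutativeRing (c ⊔ ℓ) ℓ
  fractionRing = record
    { Carrier = Fraction ; _≈_ = _≈ᶠ_ ; _+_ = _+ᶠ_ ; _*_ = _*ᶠ_
    ; -_ = -ᶠ_ ; 0# = embed 0# ; 1# = embed 1#
    ; isCommutativeRing = record
      { isRing = record
        { +-isAbelianGroup = record
          { isGroup = record
            { isMonoid = record
              { isSemigroup = record
                { isMagma = record
                  { isEquivalence = record
                    { refl = ≈ᶠ-refl ; sym = ≈ᶠ-sym ; trans = ≈ᶠ-trans }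
                  ; ∙-cong = +ᶠ-cong }
                ; assoc = +ᶠ-assoc }
              ; identity = +ᶠ-identityˡ
                         , λ g → ≈ᶠ-trans (+ᶠ-comm g (embed 0#)) (+ᶠ-identityˡ g) }
            ; inverse = -ᶠ-inverseˡ
                      , λ g → ≈ᶠ-trans (+ᶠ-comm g (-ᶠ g)) (-ᶠ-inverseˡ g)
            ; ⁻¹-cong = -ᶠ-cong }
          ; comm = +ᶠ-comm }
        ; *-cong = *ᶠ-cong
        ; *-assoc = *ᶠ-assoc
        ; *-identity = *ᶠ-identityˡ
                     , λ g → ≈ᶠ-trans (*ᶠ-comm g (embed 1#)) (*ᶠ-identityˡ g)
        ; distrib = *ᶠ-distribˡ
                  , λ g h k → ≈ᶠ-trans (*ᶠ-comm (h +ᶠ k) g)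
                      (≈ᶠ-trans (*ᶠ-distribˡ g h k)
                        (+ᶠ-cong (*ᶠ-comm g h) (*ᶠ-comm g k))) }
      ; *-comm = *ᶠ-comm }
    }

  embed-+ : ∀ a b → embed (a + b) ≈ᶠ embed a +ᶠ embed b
  embed-+ a b = mk≈ᶠ (S.solve 2 (λ a b →
    (a S.:+ b) S.:* (S.con 1 S.:* S.con 1) S.:=
    (a S.:* S.con 1 S.:+ b S.:* S.con 1) S.:* S.con 1) refl a b)

  embed-* : ∀ a b → embed (a * b) ≈ᶠ embed a *ᶠ embed b
  embed-* a b = mk≈ᶠ (S.solve 2 (λ a b →
    (a S.:* b) S.:* (S.con 1 S.:* S.con 1) S.:= (a S.:* b) S.:* S.con 1) refl a b)

  embed-cong : ∀ {a b} → a ≈ b → embed a ≈ᶠ embed b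
  embed-cong e = mk≈ᶠ (*-congʳ e)

module _ {r ℓr m ℓm} {R : CommutativeRing r ℓr} (M : Module R m ℓm) where

  open CommutativeRing R using (Carrier; _≈_; 0#)
  open Module M

  linearCombination : ∀ {n} → Vector Carrier n → Vector Carrierᴹ n → Carrierᴹ
  linearCombination a v =
    RawMonoidDefinitions.sum +ᴹ-rawMonoid (λ i → a i *ₗ v i)

  Span : ∀ {p} → Pred Carrierᴹ p → Pred Carrierᴹ (r ⊔ m ⊔ ℓm ⊔ p)
  Span P x = ∃[ n ] Σ (Vector Carrier n) λ a → Σ (Vector Carrierᴹ n) λ v →
    (∀ i → P (v i)) × x ≈ᴹ linearCombination a v

  record IsBasis {n} (v : Vector Carrierᴹ n) : Set (r ⊔ ℓr ⊔ m ⊔ ℓm) where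
    field
      independent : ∀ a → linearCombination a v ≈ᴹ 0ᴹ → ∀ i → a i ≈ 0#
      spanning    : ∀ x → ∃[ a ] x ≈ᴹ linearCombination a v

  HasDimension : ℕ → Set (r ⊔ ℓr ⊔ m ⊔ ℓm)
  HasDimension n = Σ (Vector Carrierᴹ n) IsBasis

  record IsSubmodule {p} (P : Pred Carrierᴹ p) : Set (r ⊔ m ⊔ p) where
    field
      0-closed   : P 0ᴹ
      +-closed   : ∀ x y → P x → P y → P (x +ᴹ y)
      *-closed   : ∀ a x → P x → P (a *ₗ x)
      neg-closed : ∀ x → P x → P (-ᴹ x)

  submodule : ∀ {p} {P : Pred Carrierᴹ p} → IsSubmodule P → Module R (m ⊔ p) ℓm
  submodule {p} {P} isSub = record
    { isModule = ModuleMonomorphism.isModule {M = raw} {N = rawM} {⟦_⟧ = proj₁} mono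
        (CommutativeRing.isCommutativeRing R) isModule′
    }
    where
    open IsSubmodule isSub
    rawM : RawModule Carrier m ℓm
    rawM = record
      { Carrierᴹ = Carrierᴹ ; _≈ᴹ_ = _≈ᴹ_ ; _+ᴹ_ = _+ᴹ_
      ; _*ₗ_ = _*ₗ_ ; _*ᵣ_ = flip _*ₗ_ ; 0ᴹ = 0ᴹ ; -ᴹ_ = -ᴹ_ }
    isModule′ = IsModuleFromLeft.isModule {commutativeRing = R}
      (record { isLeftModule = isLeftModule })
    raw : RawModule Carrier (m ⊔ p) ℓm
    raw = record
      { Carrierᴹ = Σ Carrierᴹ P
      ; _≈ᴹ_ = _≈ᴹ_ on proj₁
      ; _+ᴹ_ = λ { (x , Px) (y , Py) → x +ᴹ y , +-closed x y Px Py }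
      ; _*ₗ_ = λ { a (x , Px) → a *ₗ x , *-closed a x Px }
      ; _*ᵣ_ = λ { (x , Px) a → a *ₗ x , *-closed a x Px }
      ; 0ᴹ = 0ᴹ , 0-closed
      ; -ᴹ_ = λ { (x , Px) → -ᴹ x , neg-closed x Px }
      }
    mono : IsModuleMonomorphism raw rawM proj₁
    mono = record
      { isModuleHomomorphism = record
        { isBimoduleHomomorphism = record
          { +ᴹ-isGroupHomomorphism = record
            { isMonoidHomomorphism = record
              { isMagmaHomomorphism = record
                { isRelHomomorphism = record { cong = λ e → e }
                ; homo = λ _ _ → ≈ᴹ-refl }
              ; ε-homo = ≈ᴹ-refl }
            ; ⁻¹-homo = λ _ → ≈ᴹ-refl }
          ; *ₗ-homo = λ _ _ → ≈ᴹ-refl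
          ; *ᵣ-homo = λ _ _ → ≈ᴹ-refl } }
      ; injective = λ e → e
      }

module RationalFunctions {c ℓ₁ ℓ₂} (K : DiscreteField c ℓ₁ ℓ₂) where

  private module K = DiscreteField K
  private module KR = CommutativeRing K.commutativeRing
  open Polynomial K.commutativeRing public
  open Fractions polyRing (polyCancel K) (1ₚ≉0ₚ K) public

  RatFun : Set (c ⊔ ℓ₁)
  RatFun = Fraction

  private module L = CommutativeRing fractionRing
  open L using () renaming (_+_ to infixl 6 _⊕_; _*_ to infixl 7 _⊗_; -_ to infix 8 ⊖_)
  open SemiringExp L.semiring public using () renaming (_^_ to infixr 8 _^ᶠ_)

  const : K.Carrier → RatFun
  const a = embed (a ∷ [])

  z : RatFun
  z = embed X

  z-_ : K.Carrier → RatFun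
  z- a = embed (K.- a ∷ K.1# ∷ [])

  1/[z-_] : K.Carrier → RatFun
  1/[z- a ] = frac 1ₚ (K.- a ∷ K.1# ∷ []) λ e → K.1≉0 (coeff-≈ e 1)

  1/z : RatFun
  1/z = frac 1ₚ X λ e → K.1≉0 (coeff-≈ e 1)

  -- The projective line: affine points [ a ] and the point ∙ at infinity.

  ℙ¹ : Set c
  ℙ¹ = Pointed K.Carrier

  -- Membership in the local ring at a point: g can be written as A / B
  -- with B(a) ≠ 0, respectively with deg A ≤ deg B.

  RegularAt : ℙ¹ → Pred RatFun (c ⊔ ℓ₁)
  RegularAt [ a ] g = ∃[ h ] g ≈ᶠ h × ¬ eval (den h) a K.≈ K.0#
  RegularAt ∙     g = ∃[ h ] ∃[ n ] g ≈ᶠ h × HasDegree (den h) n × Degree≤ (num h) n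

  uniformizer : ℙ¹ → RatFun
  uniformizer [ a ] = z- a
  uniformizer ∙     = 1/z

  PoleOrder≤ : ℕ → ℙ¹ → Pred RatFun (c ⊔ ℓ₁)
  PoleOrder≤ m x g = RegularAt x (uniformizer x ^ᶠ m ⊗ g)

  -- dz / dt for the uniformizer t at the point: t = z - a gives 1, and
  -- t = 1/z gives dz = - z² dt.

  dz/dt : ℙ¹ → RatFun
  dz/dt [ a ] = L.1#
  dz/dt ∙     = ⊖ (z ⊗ z)

  -- A rational k-form g (dz)ᵏ is represented by its coefficient g.
  -- Written in terms of the uniformizer t at x it is
  -- g (dz/dt)ᵏ (dt)ᵏ, so its order at x is that of g (dz/dt)ᵏ.

  localCoefficient : ℕ → ℙ¹ → RatFun → RatFun
  localCoefficient k x g = g ⊗ dz/dt x ^ᶠ k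

  FormPoleOrder≤ : (k m : ℕ) → ℙ¹ → Pred RatFun (c ⊔ ℓ₁)
  FormPoleOrder≤ k m x g = PoleOrder≤ m x (localCoefficient k x g)

  FormRegularAt : (k : ℕ) → ℙ¹ → Pred RatFun (c ⊔ ℓ₁)
  FormRegularAt k x g = RegularAt x (localCoefficient k x g)

  const-cong : ∀ {a b} → a K.≈ b → const a ≈ᶠ const b
  const-cong e = embed-cong (∷-cong e ≈ₚ-refl)

  const-+ : ∀ a b → const (a K.+ b) ≈ᶠ const a ⊕ const b
  const-+ a b = embed-+ (a ∷ []) (b ∷ [])

  const-* : ∀ a b → const (a K.* b) ≈ᶠ const a ⊗ const b
  const-* a b = L.trans (embed-cong (∷-cong (KR.sym (KR.+-identityʳ _)) ≈ₚ-refl))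
                        (embed-* (a ∷ []) (b ∷ []))

  const-0 : const K.0# ≈ᶠ L.0#
  const-0 = embed-cong (0∷-zero ≈ₚ-refl)

  forms : Module K.commutativeRing (c ⊔ ℓ₁) ℓ₁
  forms = record
    { _*ₗ_ = scale ; _*ᵣ_ = flip scale
    ; isModule = IsModuleFromLeft.isModule {commutativeRing = K.commutativeRing}
        (record { isLeftModule = isLeft })
    }
    where
    scale : K.Carrier → RatFun → RatFun
    scale a g = const a ⊗ g
    isLeft : IsLeftModule K.ring _≈ᶠ_ _⊕_ L.0# ⊖_ scale
    isLeft = record
      { isLeftSemimodule = record
        { +ᴹ-isCommutativeMonoid = L.+-isCommutativeMonoid
        ; isPreleftSemimodule = record
          { *ₗ-cong = λ e f → L.*-cong (const-cong e) f
          ; *ₗ-zeroˡ = λ g → L.trans (L.*-congʳ {g} const-0) (L.zeroˡ g)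
          ; *ₗ-distribʳ = λ g a b →
              L.trans (L.*-congʳ {g} (const-+ a b)) (L.distribʳ g (const a) (const b))
          ; *ₗ-identityˡ = L.*-identityˡ
          ; *ₗ-assoc = λ a b g →
              L.trans (L.*-congʳ {g} (const-* a b)) (L.*-assoc (const a) (const b) g)
          ; *ₗ-zeroʳ = λ a → L.zeroʳ (const a)
          ; *ₗ-distribˡ = λ a g h → L.distribˡ (const a) g h
          }
        }
      ; -ᴹ‿cong = L.-‿cong
      ; -ᴹ‿inverse = L.-‿inverse
      }

  regular-cong : ∀ x {g h} → g ≈ᶠ h → RegularAt x g → RegularAt x h
  regular-cong [ a ] e (u , f , r)     = u , L.trans (L.sym e) f , r
  regular-cong ∙     e (u , n , f , r) = u , n , L.trans (L.sym e) f , r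

  regular-const : ∀ x a → RegularAt x (const a)
  regular-const [ b ] a = const a , L.refl , λ e → K.1≉0 (KR.trans (KR.sym (eval-1 b)) e)
  regular-const ∙     a = const a , 0 , L.refl
    , (K.1≉0 , λ { (ℕ.suc i) _ → KR.refl }) , λ { (ℕ.suc i) _ → KR.refl }

  private
    *-degree : ∀ p q {m n} → HasDegree p m → HasDegree q n → HasDegree (p *ₚ q) (m ℕ.+ n)
    *-degree p q {m} {n} (p≉0 , d) (q≉0 , e) with top-coeff-* p q m n d e
    ... | hi , top = (λ z → K.x*y≉0 p≉0 q≉0 (KR.trans (KR.sym top) z)) , hi

    *-eval≉0 : ∀ p q a → ¬ eval p a K.≈ K.0# → ¬ eval q a K.≈ K.0# →
               ¬ eval (p *ₚ q) a K.≈ K.0#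
    *-eval≉0 p q a p≉0 q≉0 e =
      K.x*y≉0 p≉0 q≉0 (KR.trans (KR.sym (eval-* p q a)) e)

  regular-* : ∀ x {g h} → RegularAt x g → RegularAt x h → RegularAt x (g ⊗ h)
  regular-* [ a ] (u , e , r) (v , f , s) =
    u ⊗ v , L.*-cong e f , *-eval≉0 (den u) (den v) a r s
  regular-* ∙ (u , m , e , r , d) (v , n , f , s , d′) =
    u ⊗ v , m ℕ.+ n , L.*-cong e f , *-degree (den u) (den v) r s
    , proj₁ (top-coeff-* (num u) (num v) m n d d′)

  regular-+ : ∀ x {g h} → RegularAt x g → RegularAt x h → RegularAt x (g ⊕ h)
  regular-+ [ a ] (u , e , r) (v , f , s) =
    u ⊕ v , L.+-cong e f , *-eval≉0 (den u) (den v) a r s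
  regular-+ ∙ (u , m , e , r , d) (v , n , f , s , d′) =
    u ⊕ v , m ℕ.+ n , L.+-cong e f , *-degree (den u) (den v) r s
    , degree≤-+ (num u *ₚ den v) (num v *ₚ den u)
        (proj₁ (top-coeff-* (num u) (den v) m n d (proj₂ s)))
        (≡.subst (Degree≤ (num v *ₚ den u)) (ℕₚ.+-comm n m)
          (proj₁ (top-coeff-* (num v) (den u) n m d′ (proj₂ r))))

  multiplier-isSubmodule : ∀ x w (T : RatFun → RatFun) → (∀ g → T g ≈ᶠ g ⊗ w) →
    IsSubmodule forms (λ g → RegularAt x (T g))
  multiplier-isSubmodule x w T T≈ = record
    { 0-closed   = regular-cong x (begin
        const K.0#  ≈⟨ const-0 ⟩
        L.0#        ≈⟨ L.zeroˡ w ⟨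
        L.0# ⊗ w    ≈⟨ T≈ L.0# ⟨
        T L.0#      ∎) (regular-const x K.0#)
    ; +-closed   = λ g h r s → regular-cong x (begin
        T g ⊕ T h          ≈⟨ L.+-cong (T≈ g) (T≈ h) ⟩
        g ⊗ w ⊕ h ⊗ w      ≈⟨ L.distribʳ w g h ⟨
        (g ⊕ h) ⊗ w        ≈⟨ T≈ (g ⊕ h) ⟨
        T (g ⊕ h)          ∎) (regular-+ x r s)
    ; *-closed   = scale-closed
    ; neg-closed = λ g r → regular-cong x (begin
        T (const (K.- K.1#) ⊗ g)      ≈⟨ T≈ (const (K.- K.1#) ⊗ g) ⟩
        ⊖ L.1# ⊗ g ⊗ w                ≈⟨ L.*-congʳ {w} (RingProperties.-1*x≈-x L.ring g) ⟩
        ⊖ g ⊗ w                       ≈⟨ T≈ (⊖ g) ⟨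
        T (⊖ g)                       ∎) (scale-closed (K.- K.1#) g r)
    }
    where
    open SetoidReasoning L.setoid
    scale-closed : ∀ a g → RegularAt x (T g) → RegularAt x (T (const a ⊗ g))
    scale-closed a g r = regular-cong x (begin
      const a ⊗ T g        ≈⟨ L.*-congˡ {const a} (T≈ g) ⟩
      const a ⊗ (g ⊗ w)    ≈⟨ L.*-assoc (const a) g w ⟨
      const a ⊗ g ⊗ w      ≈⟨ T≈ (const a ⊗ g) ⟨
      T (const a ⊗ g)      ∎) (regular-* x (regular-const x a) r)

  FormRegularAt-isSubmodule : ∀ k x → IsSubmodule forms (FormRegularAt k x)
  FormRegularAt-isSubmodule k x =
    multiplier-isSubmodule x (dz/dt x ^ᶠ k) (localCoefficient k x) (λ _ → L.refl)

  FormPoleOrder≤-isSubmodule : ∀ k m x → IsSubmodule forms (FormPoleOrder≤ k m x)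
  FormPoleOrder≤-isSubmodule k m x =
    multiplier-isSubmodule x (t ⊗ j) (λ g → t ⊗ (g ⊗ j)) λ g → begin
      t ⊗ (g ⊗ j)  ≈⟨ L.*-assoc t g j ⟨
      t ⊗ g ⊗ j    ≈⟨ L.*-congʳ {j} (L.*-comm t g) ⟩
      g ⊗ t ⊗ j    ≈⟨ L.*-assoc g t j ⟩
      g ⊗ (t ⊗ j)  ∎
    where
    open SetoidReasoning L.setoid
    t = uniformizer x ^ᶠ m
    j = dz/dt x ^ᶠ k

module _ {c ℓ₁ ℓ₂ c′ ℓ₁′ ℓ₂′}
  (F : DiscreteField c ℓ₁ ℓ₂) (K : DiscreteField c′ ℓ₁′ ℓ₂′)
  (ι : DiscreteField.Carrier F → DiscreteField.Carrier K) where

  private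
    module F = DiscreteField F
    module K = DiscreteField K
    module F[X] = Polynomial F.commutativeRing
    module K[X] = Polynomial K.commutativeRing

  record IsAlgebraicClosure : Set (c ⊔ ℓ₁ ⊔ c′ ⊔ ℓ₁′) where
    field
      isRingHomomorphism  : IsRingHomomorphism F.rawRing K.rawRing ι
      algebraic           : ∀ x → ∃[ p ]
        ¬ p F[X].≈ₚ F[X].0ₚ × K[X].eval (map ι p) x K.≈ K.0#
      algebraicallyClosed : ∀ p n → K[X].HasDegree p (ℕ.suc n) →
        ∃[ x ] K[X].eval p x K.≈ K.0#

  open RationalFunctions K
  private module L = CommutativeRing fractionRing

  ℙ¹ᶠ : Set c
  ℙ¹ᶠ = Pointed F.Carrier

  infix 4 _≈ᴾ_
  _≈ᴾ_ : ℙ¹ᶠ → ℙ¹ᶠ → Set (c ⊔ ℓ₁)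
  _≈ᴾ_ = _≈∙_ F._≈_

  ι∙ : ℙ¹ᶠ → ℙ¹
  ι∙ = Maybe.map ι

  -- H⁰(ℙ¹, Ωᵏ(mD)) with D the sum of the points of ℙ¹(F); ℙ¹ is taken
  -- over K, so regularity elsewhere is at all other geometric points.

  InH⁰ : (k m : ℕ) → Pred RatFun (c ⊔ c′ ⊔ ℓ₁′)
  InH⁰ k m g =
    (∀ y → FormPoleOrder≤ k m (ι∙ y) g) ×
    (∀ x → (∀ y → ¬ _≈∙_ K._≈_ (ι∙ y) x) → FormRegularAt k x g)

  InH⁰-isSubmodule : ∀ k m → IsSubmodule forms (InH⁰ k m)
  InH⁰-isSubmodule k m = record
    { 0-closed   = (λ y → Pole.0-closed (ι∙ y)) , λ x _ → Reg.0-closed x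
    ; +-closed   = λ g h p q →
        (λ y → Pole.+-closed (ι∙ y) g h (proj₁ p y) (proj₁ q y)) ,
        (λ x n → Reg.+-closed x g h (proj₂ p x n) (proj₂ q x n))
    ; *-closed   = λ a g p →
        (λ y → Pole.*-closed (ι∙ y) a g (proj₁ p y)) ,
        (λ x n → Reg.*-closed x a g (proj₂ p x n))
    ; neg-closed = λ g p →
        (λ y → Pole.neg-closed (ι∙ y) g (proj₁ p y)) ,
        (λ x n → Reg.neg-closed x g (proj₂ p x n))
    }
    where
    module Pole x = IsSubmodule (FormPoleOrder≤-isSubmodule k m x)
    module Reg x  = IsSubmodule (FormRegularAt-isSubmodule k x)

  H⁰ : (k m : ℕ) → Module K.commutativeRing (c ⊔ c′ ⊔ ℓ₁′) ℓ₁′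
  H⁰ k m = submodule forms (InH⁰-isSubmodule k m)

  1/[z-_]∙ : ℙ¹ᶠ → RatFun
  1/[z- [ a ] ]∙ = 1/[z- ι a ]
  1/[z- ∙     ]∙ = L.0#

  -- The coefficient of dz in s(z; α, β).

  s : ℙ¹ᶠ → ℙ¹ᶠ → RatFun
  s α β = 1/[z- β ]∙ L.- 1/[z- α ]∙

  product : ∀ {r} → Vector RatFun r → RatFun
  product = RawMonoidDefinitions.sum (Monoid.rawMonoid L.*-monoid)

  record KuriharaDatum (k : ℕ) : Set (c ⊔ ℓ₁) where
    field
      r        : ℕ
      2≤r      : 2 ℕ.≤ r
      exponent : Vector ℕ r
      1≤exp    : ∀ i → 1 ℕ.≤ exponent i
      total    : RawMonoidDefinitions.sum ℕ.+-0-rawMonoid exponent ≡ k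
      α β      : Vector ℙ¹ᶠ r
      α≉β      : ∀ i → ¬ α i ≈ᴾ β i
      disjoint : ¬ (∃[ x ] ∀ i → x ≈ᴾ α i ⊎ x ≈ᴾ β i)

    form : RatFun
    form = product λ i → s (α i) (β i) ^ᶠ exponent i

  IsKurihara : (k : ℕ) → Pred RatFun (c ⊔ ℓ₁ ⊔ ℓ₁′)
  IsKurihara k g = ∃[ d ] g ≈ᶠ KuriharaDatum.form {k} d

{-# OPTIONS --safe #-}

-- List the points of ℙ¹(𝔽_q), ∞ last, each repeated k - 1 times, as
-- a₀, a₁, …, and put ℓ_a = z - a, ℓ_∞ = 1.  Among 2k consecutive entries
-- a_i, …, a_{i+2k-1} those at distance k are different points, and no
-- point lies on all k pairs {a_{i+j}, a_{i+j+k}}, so the product of the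
-- s(z; a_{i+j}, a_{i+j+k}) is a Kurihara differential; up to a non-zero
-- constant it is 1 / ∏_{i≤j<i+2k} ℓ_{a_j}.  There are N such windows.
-- Multiplication by D = ∏_j ℓ_{a_j}, the full product, identifies
-- H⁰(ℙ¹, Ωᵏ((k-1)D)) with the polynomials of degree < N, and sends the
-- i-th window to a multiple of ∏_{j<i} ℓ_{a_j} ∏_{j≥i+2k} ℓ_{a_j}.  These
-- form a Newton basis: evaluating successively at a₀, a₁, … isolates one
-- coefficient at a time, as a_i ≠ a_{j+2k} for i ≤ j.

module Submission where

open import Defs
open import Algebra.Apartness.Bundles using (HeytingField)
open import Algebra.Bundles using (CommutativeRing; Monoid)
import Algebra.Definitions.RawMonoid as RawMonoidDefinitions
open import Algebra.Morphism.Structures using (IsRingHomomorphism)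
import Algebra.Properties.CommutativeSemiring.Exp as CommutativeSemiringExp
import Algebra.Properties.Ring as RingProperties
import Algebra.Properties.Semiring.Exp as SemiringExp
import Algebra.Solver.Ring.NaturalCoefficients.Default as SemiringSolver
open import Data.Fin.Base using (Fin; zero; suc; toℕ; fromℕ<)
import Data.Fin.Properties as Finₚ
open import Data.List.Base using ([]; _∷_)
open import Data.Nat.Base as ℕ using (ℕ; zero; suc; z≤n; s≤s; _/_; nonTrivial⇒n>1)
open import Data.Nat.Divisibility using (_∣_; ∣-refl; n∣m*n)
open import Data.Nat.DivMod
  using (m<n*o⇒m/o<n; m<n⇒m/n≡0; +-distrib-/-∣ˡ; +-distrib-/-∣ʳ; m*n/n≡m; /-monoˡ-≤; n/n≡1)
open import Data.Nat.Primality using (prime⇒nonZero; prime⇒nonTrivial)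
import Data.Nat.Properties as ℕₚ
open import Data.Nat.Solver using (module +-*-Solver)
open +-*-Solver using (solve; _:+_; _:*_; _:=_; con)
open import Data.Product using (Σ; ∃-syntax; _×_; _,_; proj₁; proj₂)
open import Data.Sum.Base using (_⊎_; inj₁; inj₂; [_,_]′)
open import Data.Vec.Functional using (Vector)
open import Function.Base using (_∘_)
open import Function.Bundles using (Inverse; _⇔_; mk⇔)
open import Level using (Level; _⊔_)
open import Relation.Binary.Construct.Add.Point.Equality
  using (_≈∙_; ∙≈∙; [_]; ≈∙-dec; ≈∙-sym; ≈∙-trans)
open import Relation.Binary.PropositionalEquality.Core as ≡ using (_≡_)
import Relation.Binary.PropositionalEquality.Properties as ≡ₚ
import Relation.Binary.Reasoning.Setoid as SetoidReasoning
open import Relation.Nullary.Construct.Add.Point using (∙; [_])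
open import Relation.Nullary.Decidable.Core using (Dec; yes; no; _⊎-dec_)
open import Relation.Nullary.Negation.Core using (¬_; contradiction)

-- The list has (q + 1)(k - 1) entries, hence (q + 1)(k - 1) - 2k + 1 = N windows. The same number
-- comes from the other side: (dz)ᵏ has a pole of order 2k at ∞ where only order k - 1 is allowed,
-- so a numerator over D, whose degree is q(k - 1), has degree at most q(k - 1) - k - 1 = N - 1. One
-- Newton expansion therefore gives the dimension and the spanning together.
--
-- A point fills a block of k - 1 consecutive entries, so distance k - 1 already separates points;
-- pairing at distance k uses each of the 2k entries of a window exactly once. ∞ stands last so that
-- the nodes that enter the Newton products are affine, where ℓ is a genuine linear factor.
--
-- A rational function is given by a fraction that need not be in lowest terms. Statements about g
-- are therefore proved through cleared equations `embed b ⊗ g ≈ᶠ embed a`, and D g is shown to be a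
-- polynomial by removing the roots of a denominator one at a time; algebraic closedness supplies
-- the roots.

-- Discrete fields and products over intervals of indices.

module FieldProperties {c ℓ₁ ℓ₂} (K : DiscreteField c ℓ₁ ℓ₂) where

  open DiscreteField K
  open CommutativeRing commutativeRing
    using (_-_; +-congˡ; *-congʳ; +-identityʳ)
  open RingProperties ring using (-0#≈0#; x∙y⁻¹≈ε⇒x≈y)
  open SetoidReasoning setoid

  inverse : ∀ {x} → ¬ x ≈ 0# → ∃[ y ] x * y ≈ 1#
  inverse {x} x≉0 with HeytingField.#⇒invertible heytingField (≉⇒# x≉0)
  ... | y , _ , e = y , (begin
    x * y         ≈⟨ *-congʳ (trans (+-congˡ -0#≈0#) (+-identityʳ x)) ⟨
    (x - 0#) * y  ≈⟨ e ⟩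
    1#            ∎)

  x*y≈0⇒y≈0 : ∀ {x y} → ¬ x ≈ 0# → x * y ≈ 0# → y ≈ 0#
  x*y≈0⇒y≈0 {x} {y} x≉0 xy≈0 with y ≟ 0#
  ... | yes y≈0 = y≈0
  ... | no  y≉0 = contradiction xy≈0 (x*y≉0 x≉0 y≉0)

  x≉y⇒x-y≉0 : ∀ {x y} → ¬ x ≈ y → ¬ x - y ≈ 0#
  x≉y⇒x-y≉0 {x} {y} x≉y e = x≉y (x∙y⁻¹≈ε⇒x≈y x y e)

module IntervalProducts {c ℓ} (R : CommutativeRing c ℓ) where

  open CommutativeRing R
  open SemiringExp semiring using (_^_)
  open SetoidReasoning setoid

  prod : (ℕ → Carrier) → ℕ → ℕ → Carrier
  prod f i zero    = 1#
  prod f i (suc n) = f i * prod f (suc i) n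

  prod-+ : ∀ f i m n → prod f i (m ℕ.+ n) ≈ prod f i m * prod f (i ℕ.+ m) n
  prod-+ f i zero n rewrite ℕₚ.+-identityʳ i = sym (*-identityˡ _)
  prod-+ f i (suc m) n rewrite ℕₚ.+-suc i m =
    trans (*-congˡ (prod-+ f (suc i) m n)) (sym (*-assoc _ _ _))

  prod-shift : ∀ f d i n → prod (λ j → f (j ℕ.+ d)) i n ≡ prod f (i ℕ.+ d) n
  prod-shift f d i zero    = ≡.refl
  prod-shift f d i (suc n) = ≡.cong (f (i ℕ.+ d) *_) (prod-shift f d (suc i) n)

  prod-∘suc : ∀ f i n → prod (f ∘ suc) i n ≡ prod f (suc i) n
  prod-∘suc f i zero    = ≡.refl
  prod-∘suc f i (suc n) = ≡.cong (f (suc i) *_) (prod-∘suc f (suc i) n)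

  prod-const : ∀ f i n {x} → (∀ j → j ℕ.< n → f (i ℕ.+ j) ≈ x) → prod f i n ≈ x ^ n
  prod-const f i zero    e = refl
  prod-const f i (suc n) e = *-cong
    (trans (reflexive (≡.cong f (≡.sym (ℕₚ.+-identityʳ i)))) (e 0 (s≤s z≤n)))
    (prod-const f (suc i) n λ j j<n →
      trans (reflexive (≡.cong f (≡.sym (ℕₚ.+-suc i j)))) (e (suc j) (s≤s j<n)))

-- Polynomials over a field: degrees and division by linear factors.

module PolynomialProperties {c ℓ₁ ℓ₂} (K : DiscreteField c ℓ₁ ℓ₂) where

  open DiscreteField K
  open CommutativeRing commutativeRing
    using (_-_; +-congˡ; +-congʳ; *-cong; *-congˡ; *-congʳ; +-identityʳ; *-identityʳ
          ; *-comm; *-assoc; zeroʳ; zeroˡ; -‿cong; -‿inverseʳ; +-comm)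
  open RingProperties ring using (-0#≈0#; -‿involutive)
  open FieldProperties K
  open Polynomial commutativeRing
  open RawMonoidDefinitions (CommutativeRing.+-rawMonoid polyRing)
    using () renaming (sum to sumₚ)
  open IntervalProducts polyRing public
  open SemiringExp (CommutativeRing.semiring polyRing) public using (_^_)
  private
    module P = CommutativeRing polyRing
    module PP = RingProperties P.ring

  linear : Carrier → Poly
  linear a = - a ∷ 1# ∷ []

  eval-linear : ∀ a x → eval (linear a) x ≈ x - a
  eval-linear a x = begin
    - a + x * (1# + x * 0#)  ≈⟨ +-congˡ (*-congˡ (eval-1 x)) ⟩
    - a + x * 1#             ≈⟨ +-congˡ (*-identityʳ x) ⟩
    - a + x                  ≈⟨ +-comm _ _ ⟩
    x - a                    ∎
    where open SetoidReasoning setoid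

  eval-linear-self : ∀ a → eval (linear a) a ≈ 0#
  eval-linear-self a = trans (eval-linear a a) (-‿inverseʳ a)

  eval-congʳ : ∀ p {x y} → x ≈ y → eval p x ≈ eval p y
  eval-congʳ []      e = refl
  eval-congʳ (a ∷ p) e = +-congˡ (*-cong e (eval-congʳ p e))

  linear-degree : ∀ a → HasDegree (linear a) 1
  linear-degree a = 1≉0 , λ { (suc (suc i)) _ → refl ; 1 (s≤s ()) }

  1ₚ-degree : HasDegree 1ₚ 0
  1ₚ-degree = 1≉0 , λ { (suc i) _ → refl }

  *ₚ-degree : ∀ p q {m n} → HasDegree p m → HasDegree q n → HasDegree (p *ₚ q) (m ℕ.+ n)
  *ₚ-degree p q {m} {n} (p≉0 , d) (q≉0 , e) with top-coeff-* p q m n d e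
  ... | hi , top = (λ z → x*y≉0 p≉0 q≉0 (trans (sym top) z)) , hi

  degree≤-cong : ∀ {p q n} → p ≈ₚ q → Degree≤ p n → Degree≤ q n
  degree≤-cong e d i n<i = trans (sym (coeff-≈ e i)) (d i n<i)

  hasDegree-cong : ∀ {p q n} → p ≈ₚ q → HasDegree p n → HasDegree q n
  hasDegree-cong e (p≉0 , d) = (λ z → p≉0 (trans (coeff-≈ e _) z)) , degree≤-cong e d

  degree≤-· : ∀ a p {n} → Degree≤ p n → Degree≤ (a · p) n
  degree≤-· a p d i n<i =
    trans (coeff-· a p i) (trans (*-congˡ (d i n<i)) (zeroʳ a))

  neg-degree : ∀ p {n} → HasDegree p n → HasDegree (-ₚ p) n
  neg-degree p {n} (p≉0 , d) =
    (λ e → p≉0 (trans (sym (-‿involutive _)) (trans (-‿cong (trans (sym (coeff-neg p n)) e)) -0#≈0#))) ,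
    λ i n<i → trans (coeff-neg p i) (trans (-‿cong (d i n<i)) -0#≈0#)

  degree≤-neg : ∀ p {n} → Degree≤ p n → Degree≤ (-ₚ p) n
  degree≤-neg p d i n<i = trans (coeff-neg p i)
    (trans (-‿cong (d i n<i)) -0#≈0#)

  zero⊎hasDegree : ∀ p → p ≈ₚ 0ₚ ⊎ (∃[ n ] HasDegree p n)
  zero⊎hasDegree [] = inj₁ ≈ₚ-refl
  zero⊎hasDegree (a ∷ p) with zero⊎hasDegree p | a ≟ 0#
  ... | inj₂ (n , p≉0 , d) | _       = inj₂ (suc n , p≉0 , λ { (suc i) (s≤s n<i) → d i n<i })
  ... | inj₁ p≈0           | yes a≈0 = inj₁ (≈ₚ-trans (∷-cong a≈0 p≈0) (0∷-zero ≈ₚ-refl))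
  ... | inj₁ p≈0           | no a≉0  = inj₂ (0 , a≉0 , λ { (suc i) _ → coeff-≈ p≈0 i })

  hasDegree⇒≉0 : ∀ {p n} → HasDegree p n → ¬ p ≈ₚ 0ₚ
  hasDegree⇒≉0 (p≉0 , _) p≈0 = p≉0 (coeff-≈ p≈0 _)

  eval≉0⇒≉0 : ∀ {p x} → ¬ eval p x ≈ 0# → ¬ p ≈ₚ 0ₚ
  eval≉0⇒≉0 p≉0 p≈0 = p≉0 (eval-zero p≈0 _)

  degree-unique : ∀ {p m n} → HasDegree p m → HasDegree p n → m ≡ n
  degree-unique (p≉0 , d) (p≉0′ , d′) = ℕₚ.≤-antisym
    (ℕₚ.≮⇒≥ λ n<m → p≉0 (d′ _ n<m)) (ℕₚ.≮⇒≥ λ m<n → p≉0′ (d _ m<n))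

  prod-degree : ∀ f i n → (∀ j → j ℕ.< n → HasDegree (f (i ℕ.+ j)) 1) →
    HasDegree (prod f i n) n
  prod-degree f i zero    d = 1ₚ-degree
  prod-degree f i (suc n) d = *ₚ-degree (f i) (prod f (suc i) n) {1} {n}
    (≡.subst (λ m → HasDegree (f m) 1) (ℕₚ.+-identityʳ i) (d 0 (s≤s z≤n)))
    (prod-degree f (suc i) n λ j j<n →
      ≡.subst (λ m → HasDegree (f m) 1) (ℕₚ.+-suc i j) (d (suc j) (s≤s j<n)))

  ^-degree : ∀ p n {d} → HasDegree p d → HasDegree (p ^ n) (n ℕ.* d)
  ^-degree p zero        d = 1ₚ-degree
  ^-degree p (suc n) {m} d = *ₚ-degree p (p ^ n) {m} {n ℕ.* m} d (^-degree p n d)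

  prod-degree≤ : ∀ f i n → (∀ j → Degree≤ (f j) 1) → Degree≤ (prod f i n) n
  prod-degree≤ f i zero    d = proj₂ 1ₚ-degree
  prod-degree≤ f i (suc n) d =
    proj₁ (top-coeff-* (f i) _ 1 n (d i) (prod-degree≤ f (suc i) n d))

  prod-eval≉0 : ∀ f i n x → (∀ j → i ℕ.≤ j → ¬ eval (f j) x ≈ 0#) →
    ¬ eval (prod f i n) x ≈ 0#
  prod-eval≉0 f i zero    x f≉0 e = 1≉0 (trans (sym (eval-1 x)) e)
  prod-eval≉0 f i (suc n) x f≉0 e = x*y≉0 (f≉0 i ℕₚ.≤-refl)
    (prod-eval≉0 f (suc i) n x λ j i<j → f≉0 j (ℕₚ.<⇒≤ i<j))
    (trans (sym (eval-* (f i) _ x)) e)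

  -- Horner's scheme: the values at `b` of the successive tails of a polynomial are the coefficients
  -- of its quotient by `linear b`.
  quotient : Poly → Carrier → Poly
  quotient []      b = []
  quotient (a ∷ p) b = eval p b ∷ quotient p b

  division : ∀ p b → p ≈ₚ (linear b *ₚ quotient p b) +ₚ (eval p b ∷ [])
  division []      b = ≈ₚ-sym (+ₚ-cong (*ₚ-zeroʳ (linear b)) (0∷-zero ≈ₚ-refl))
  division (a ∷ p) b = ≈ₚ-sym (mk≈ λ n → trans (coeff-+ (linear b *ₚ (e ∷ d)) (a + b * e ∷ []) n)
    (trans (+-congʳ (coeff-≈ (≈ₚ-trans (*ₚ-comm (linear b) (e ∷ d))
      (P.+-congˡ {e · linear b} (∷-cong refl (*ₚ-comm d (linear b))))) n)) (go n)))
    where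
    open SetoidReasoning setoid
    module S = SemiringSolver (CommutativeRing.commutativeSemiring commutativeRing)
    e = eval p b
    d = quotient p b
    go : ∀ n → coeff ((e · linear b) +ₚ (0# ∷ linear b *ₚ d)) n + coeff (a + b * e ∷ []) n
             ≈ coeff (a ∷ p) n
    go zero = begin
      e * - b + 0# + (a + b * e)  ≈⟨ S.solve 4 (λ a b c e →
        e S.:* c S.:+ S.con 0 S.:+ (a S.:+ b S.:* e) S.:= a S.:+ (b S.:+ c) S.:* e)
        refl a b (- b) e ⟩
      a + (b - b) * e             ≈⟨ +-congˡ (*-congʳ (-‿inverseʳ b)) ⟩
      a + 0# * e                  ≈⟨ +-congˡ (zeroˡ e) ⟩
      a + 0#                      ≈⟨ +-identityʳ a ⟩
      a                           ∎
    go (suc n) = begin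
      coeff ((e * 1# ∷ []) +ₚ (linear b *ₚ d)) n + 0#  ≈⟨ +-identityʳ _ ⟩
      coeff ((e * 1# ∷ []) +ₚ (linear b *ₚ d)) n
        ≈⟨ coeff-≈ (≈ₚ-trans (P.+-congʳ {linear b *ₚ d} (∷-cong (*-identityʳ e) (≈ₚ-refl {[]})))
            (+ₚ-comm (e ∷ []) (linear b *ₚ d))) n ⟩
      coeff ((linear b *ₚ d) +ₚ (e ∷ [])) n  ≈⟨ coeff-≈ (division p b) n ⟨
      coeff p n ∎

  root⇒factor : ∀ p b → eval p b ≈ 0# → p ≈ₚ linear b *ₚ quotient p b
  root⇒factor p b e = ≈ₚ-trans (division p b)
    (≈ₚ-trans (P.+-congˡ {linear b *ₚ quotient p b} (≈ₚ-trans (∷-cong e ≈ₚ-refl) (0∷-zero ≈ₚ-refl)))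
      (+ₚ-identityʳ _))

  -- Speaks of one coefficient because a bound of the form `suc n` is not inherited by tails once n
  -- is 0, so `quotient-degree≤` is no induction hypothesis for itself.
  quotient-vanishes : ∀ p b i → (∀ j → i ℕ.< j → coeff p j ≈ 0#) → coeff (quotient p b) i ≈ 0#
  quotient-vanishes []      b i       z = refl
  quotient-vanishes (a ∷ p) b zero    z = eval-zero {p} (mk≈ λ n → z (suc n) (s≤s z≤n)) b
  quotient-vanishes (a ∷ p) b (suc i) z =
    quotient-vanishes p b i λ j i<j → z (suc j) (s≤s i<j)

  quotient-degree≤ : ∀ p b n → Degree≤ p (suc n) → Degree≤ (quotient p b) n
  quotient-degree≤ p b n d i n<i =
    quotient-vanishes p b i λ j i<j → d j (ℕₚ.≤-trans (s≤s n<i) i<j)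

  factor-degree : ∀ p x q {n} → HasDegree p (suc n) → p ≈ₚ linear x *ₚ q → HasDegree q n
  factor-degree p x q {n} d e with zero⊎hasDegree q
  ... | inj₁ q≈0 = contradiction
    (≈ₚ-trans e (≈ₚ-trans (*ₚ-congʳ (linear x) q≈0) (*ₚ-zeroʳ (linear x))))
    (hasDegree⇒≉0 {p} d)
  ... | inj₂ (m , d′) = ≡.subst (HasDegree q) (ℕₚ.suc-injective (degree-unique {p}
    (hasDegree-cong {linear x *ₚ q} {p} (≈ₚ-sym e)
      (*ₚ-degree (linear x) q {1} {m} (linear-degree x) d′)) d)) d′

  degree-zero-divides : ∀ p → HasDegree p 0 → ∀ q → ∃[ r ] p *ₚ r ≈ₚ q
  degree-zero-divides p d q = u · q , (begin
    p *ₚ (u · q)                   ≈⟨ P.*-congʳ {u · q} p≈p₀ ⟩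
    (coeff p 0 · 1ₚ) *ₚ (u · q)    ≈⟨ ·-*-assoc (coeff p 0) 1ₚ (u · q) ⟩
    coeff p 0 · (1ₚ *ₚ (u · q))    ≈⟨ ·-cong refl (*ₚ-identityˡ (u · q)) ⟩
    coeff p 0 · (u · q)            ≈⟨ ·-assoc (coeff p 0) u q ⟨
    (coeff p 0 * u) · q            ≈⟨ ·-cong (proj₂ inv) (≈ₚ-refl {q}) ⟩
    1# · q                         ≈⟨ ·-identityˡ q ⟩
    q                              ∎)
    where
    open SetoidReasoning polySetoid
    inv = inverse (proj₁ d)
    u = proj₁ inv
    p≈p₀ : p ≈ₚ coeff p 0 · 1ₚ
    p≈p₀ = mk≈ λ
      { zero    → sym (*-identityʳ _)
      ; (suc i) → proj₂ d (suc i) (s≤s z≤n) }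

  -- Linear combinations of polynomials and Newton bases.

  combination : ∀ {n} → Vector Carrier n → Vector Poly n → Poly
  combination a p = sumₚ λ i → a i · p i

  combination-congˡ : ∀ {n a b} (p : Vector Poly n) → (∀ i → a i ≈ b i) →
    combination a p ≈ₚ combination b p
  combination-congˡ {zero}  p e = ≈ₚ-refl
  combination-congˡ {suc n} p e = +ₚ-cong (·-cong (e zero) (≈ₚ-refl {p zero}))
    (combination-congˡ (p ∘ suc) (e ∘ suc))

  combination-*ˡ : ∀ {n} f (a : Vector Carrier n) p →
    combination a (λ i → f *ₚ p i) ≈ₚ f *ₚ combination a p
  combination-*ˡ {zero}  f a p = ≈ₚ-sym (*ₚ-zeroʳ f)
  combination-*ˡ {suc n} f a p = ≈ₚ-trans
    (+ₚ-cong (≈ₚ-trans (·-cong refl (*ₚ-comm f (p zero)))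
        (≈ₚ-trans (≈ₚ-sym (·-*-assoc (a zero) (p zero) f)) (*ₚ-comm (a zero · p zero) f)))
      (combination-*ˡ f (a ∘ suc) (p ∘ suc)))
    (≈ₚ-sym (P.distribˡ f (a zero · p zero) _))

  -- A Newton basis whose x-th member is ∏_{j<x} (z - b j) ∏_{j≥x} c j.
  -- It vanishes at b 0 for x > 0 only, so evaluating there isolates
  -- the first coefficient and z - b 0 divides what remains.

  module Newton (b : ℕ → Carrier) (c : ℕ → Poly)
    (c-degree≤ : ∀ j → Degree≤ (c j) 1)
    (c≉0 : ∀ i j → i ℕ.≤ j → ¬ eval (c j) (b i) ≈ 0#) where

    newton : ∀ i n → Vector Poly (suc n)
    newton i n       zero    = prod c i n
    newton i (suc n) (suc x) = linear (b i) *ₚ newton (suc i) n x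

    private
      head≉0 : ∀ i n → ¬ eval (prod c i n) (b i) ≈ 0#
      head≉0 i n = prod-eval≉0 c i n (b i) (c≉0 i)

    newton-spans : ∀ i n p → Degree≤ p n → ∃[ a ] p ≈ₚ combination a (newton i n)
    newton-spans i zero p d = (λ _ → coeff p 0) , mk≈ λ
      { zero    → sym (*-identityʳ _)
      ; (suc j) → d (suc j) (s≤s z≤n) }
    newton-spans i (suc n) p d = a , (begin
      p
        ≈⟨ split ⟩
      h +ₚ (p +ₚ -ₚ h)
        ≈⟨ P.+-congˡ {h} (root⇒factor p′ (b i) p′-root) ⟩
      h +ₚ (linear (b i) *ₚ quotient p′ (b i))
        ≈⟨ P.+-congˡ {h} (P.*-congˡ {linear (b i)} (proj₂ ih)) ⟩
      h +ₚ (linear (b i) *ₚ combination (proj₁ ih) (newton (suc i) n))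
        ≈⟨ P.+-congˡ {h} (combination-*ˡ (linear (b i)) (proj₁ ih) (newton (suc i) n)) ⟨
      combination a (newton i (suc n)) ∎)
      where
      inv = inverse (head≉0 i (suc n))
      -- The multiple of the head that agrees with `p` at `b i`, where all later members vanish.
      a₀ = eval p (b i) * proj₁ inv
      h = a₀ · prod c i (suc n)
      p′ = p +ₚ -ₚ h
      eval-h : eval h (b i) ≈ eval p (b i)
      eval-h = begin
        eval h (b i)                                   ≈⟨ eval-· a₀ (prod c i (suc n)) (b i) ⟩
        eval p (b i) * proj₁ inv * eval (prod c i (suc n)) (b i)
                                                       ≈⟨ *-assoc _ _ _ ⟩
        eval p (b i) * (proj₁ inv * eval (prod c i (suc n)) (b i))
                                                       ≈⟨ *-congˡ (trans (*-comm _ _) (proj₂ inv)) ⟩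
        eval p (b i) * 1#                              ≈⟨ *-identityʳ _ ⟩
        eval p (b i)                                   ∎
        where open SetoidReasoning setoid
      p′-root : eval p′ (b i) ≈ 0#
      p′-root = begin
        eval p′ (b i)                     ≈⟨ eval-+ p (-ₚ h) (b i) ⟩
        eval p (b i) + eval (-ₚ h) (b i)  ≈⟨ +-congʳ eval-h ⟨
        eval h (b i) + eval (-ₚ h) (b i)  ≈⟨ eval-+ h (-ₚ h) (b i) ⟨
        eval (h +ₚ -ₚ h) (b i)            ≈⟨ eval-zero (-ₚ-inverseʳ h) (b i) ⟩
        0#                                ∎
        where open SetoidReasoning setoid
      open SetoidReasoning polySetoid
      split : p ≈ₚ h +ₚ p′
      split = begin
        p                   ≈⟨ P.+-identityʳ p ⟨
        p +ₚ 0ₚ             ≈⟨ P.+-congˡ {p} (P.-‿inverseˡ h) ⟨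
        p +ₚ (-ₚ h +ₚ h)    ≈⟨ P.+-assoc p (-ₚ h) h ⟨
        p′ +ₚ h             ≈⟨ P.+-comm p′ h ⟩
        h +ₚ p′             ∎
      ih = newton-spans (suc i) n (quotient p′ (b i))
        (quotient-degree≤ p′ (b i) n (degree≤-+ p (-ₚ h) d
          (degree≤-neg h (degree≤-· a₀ (prod c i (suc n)) (prod-degree≤ c i (suc n) c-degree≤)))))
      a : Vector Carrier (suc (suc n))
      a zero    = a₀
      a (suc x) = proj₁ ih x

    newton-independent : ∀ i n a → combination a (newton i n) ≈ₚ 0ₚ → ∀ x → a x ≈ 0#
    newton-independent i zero a e zero = trans (sym (*-identityʳ _)) (coeff-≈ e 0)
    newton-independent i (suc n) a e = λ
      { zero    → a₀≈0
      ; (suc x) → newton-independent (suc i) n (a ∘ suc) tail≈0 x }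
      where
      h = a zero · prod c i (suc n)
      t = combination (a ∘ suc) (newton (suc i) n)
      e′ : h +ₚ (linear (b i) *ₚ t) ≈ₚ 0ₚ
      e′ = ≈ₚ-trans (P.+-congˡ {h} (≈ₚ-sym
        (combination-*ˡ (linear (b i)) (a ∘ suc) (newton (suc i) n)))) e
      a₀≈0 : a zero ≈ 0#
      a₀≈0 = x*y≈0⇒y≈0 (head≉0 i (suc n)) (begin
        eval (prod c i (suc n)) (b i) * a zero   ≈⟨ *-comm _ _ ⟩
        a zero * eval (prod c i (suc n)) (b i)   ≈⟨ eval-· (a zero) (prod c i (suc n)) (b i) ⟨
        eval h (b i)                             ≈⟨ +-identityʳ _ ⟨
        eval h (b i) + 0#
          ≈⟨ +-congˡ (trans (*-congʳ (eval-linear-self (b i))) (zeroˡ _)) ⟨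
        eval h (b i) + eval (linear (b i)) (b i) * eval t (b i)
          ≈⟨ +-congˡ (eval-* (linear (b i)) t (b i)) ⟨
        eval h (b i) + eval (linear (b i) *ₚ t) (b i)
          ≈⟨ eval-+ h (linear (b i) *ₚ t) (b i) ⟨
        eval (h +ₚ (linear (b i) *ₚ t)) (b i)
          ≈⟨ eval-zero e′ (b i) ⟩
        0# ∎)
        where open SetoidReasoning setoid
      tail≈0 : t ≈ₚ 0ₚ
      -- With the head gone, what remains is a multiple of `linear (b i)`, which cancels.
      tail≈0 = noZeroDivisors K (linear (b i)) t (hasDegree⇒≉0 (linear-degree (b i)))
        (≈ₚ-trans (≈ₚ-sym (P.+-congʳ {linear (b i) *ₚ t}
          (≈ₚ-trans (·-cong a₀≈0 (≈ₚ-refl {prod c i (suc n)})) (·-zeroˡ (prod c i (suc n)))))) e′)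

-- Stated over an arbitrary ring because products of fractions compute,
-- which would block the inference of implicit arguments below.

module RingIdentities {c ℓ} (R : CommutativeRing c ℓ) where

  open CommutativeRing R
  open RingProperties ring using (-‿distribʳ-*)
  open CommutativeSemiringExp commutativeSemiring public using (^-congˡ)
  open CommutativeSemiringExp commutativeSemiring using (_^_; ^-homo-*; ^-distrib-*)
  open SetoidReasoning setoid
  private module S = SemiringSolver commutativeSemiring

  x*yz≈y*xz : ∀ x y z → x * (y * z) ≈ y * (x * z)
  x*yz≈y*xz = S.solve 3 (λ x y z → x S.:* (y S.:* z) S.:= y S.:* (x S.:* z)) refl

  yx*1≈x*1y : ∀ x y → y * x * 1# ≈ x * (1# * y)
  yx*1≈x*1y = S.solve 2 (λ x y → y S.:* x S.:* S.con 1 S.:= x S.:* (S.con 1 S.:* y)) refl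

  xy*1z≈x*yz : ∀ x y z → x * y * (1# * z) ≈ x * (y * z)
  xy*1z≈x*yz = S.solve 3 (λ x y z →
    x S.:* y S.:* (S.con 1 S.:* z) S.:= x S.:* (y S.:* z)) refl

  x*yz≈xz*y : ∀ x y z → x * (y * z) ≈ x * z * y
  x*yz≈xz*y = S.solve 3 (λ x y z → x S.:* (y S.:* z) S.:= x S.:* z S.:* y) refl

  xy*zw≈xz*yw : ∀ x y z w → x * y * (z * w) ≈ x * z * (y * w)
  xy*zw≈xz*yw = S.solve 4 (λ x y z w →
    x S.:* y S.:* (z S.:* w) S.:= x S.:* z S.:* (y S.:* w)) refl

  x*t[sw]≈xs*tw : ∀ x t s w → x * (t * (s * w)) ≈ x * s * (t * w)
  x*t[sw]≈xs*tw = S.solve 4 (λ x t s w →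
    x S.:* (t S.:* (s S.:* w)) S.:= x S.:* s S.:* (t S.:* w)) refl

  y*x1[s11]≈xy*s : ∀ x y s → y * (x * 1# * (s * (1# * 1#))) ≈ x * y * s
  y*x1[s11]≈xy*s = S.solve 3 (λ x y s →
    y S.:* (x S.:* S.con 1 S.:* (s S.:* (S.con 1 S.:* S.con 1))) S.:= x S.:* y S.:* s) refl

  xy*[v-u]≈x[yv]-y[xu] : ∀ x y u v → x * y * (v - u) ≈ x * (y * v) - y * (x * u)
  xy*[v-u]≈x[yv]-y[xu] x y u v = begin
    x * y * (v - u)                  ≈⟨ distribˡ _ _ _ ⟩
    x * y * v + x * y * - u          ≈⟨ +-congˡ (-‿distribʳ-* (x * y) u) ⟨
    x * y * v + - (x * y * u)        ≈⟨ +-cong (*-assoc x y v)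
                                          (-‿cong (trans (*-assoc x y u) (x*yz≈y*xz x y u))) ⟩
    x * (y * v) - y * (x * u)        ∎

  u1*[-yy*1]≈-[yu*y] : ∀ u y → u * 1# * (- (y * y) * 1#) ≈ - (y * u * y)
  u1*[-yy*1]≈-[yu*y] u y = begin
    u * 1# * (- (y * y) * 1#)  ≈⟨ *-cong (*-identityʳ u) (*-identityʳ _) ⟩
    u * - (y * y)              ≈⟨ -‿distribʳ-* u (y * y) ⟨
    - (u * (y * y))            ≈⟨ -‿cong (S.solve 2 (λ u y →
                                    u S.:* (y S.:* y) S.:= y S.:* u S.:* y) refl u y) ⟩
    - (y * u * y)              ∎

  weighted-* : ∀ t w g h m n j k →
    t ^ m * (g * w ^ j) * (t ^ n * (h * w ^ k)) ≈ t ^ (m ℕ.+ n) * (g * h * w ^ (j ℕ.+ k))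
  weighted-* t w g h m n j k = begin
    t ^ m * (g * w ^ j) * (t ^ n * (h * w ^ k))
      ≈⟨ S.solve 6 (λ t t′ g h w w′ →
           t S.:* (g S.:* w) S.:* (t′ S.:* (h S.:* w′)) S.:=
           t S.:* t′ S.:* (g S.:* h S.:* (w S.:* w′))) refl _ _ g h _ _ ⟩
    t ^ m * t ^ n * (g * h * (w ^ j * w ^ k))
      ≈⟨ *-cong (^-homo-* t m n) (*-congˡ (^-homo-* w j k)) ⟨
    t ^ (m ℕ.+ n) * (g * h * w ^ (j ℕ.+ k)) ∎

  x[yz]≈[xy]z : ∀ x y z → x * (y * z) ≈ x * y * z
  x[yz]≈[xy]z x y z = sym (*-assoc x y z)

  xy*[s1*r]≈xs*yr : ∀ x y s r → x * y * (s * 1# * r) ≈ x * s * (y * r)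
  xy*[s1*r]≈xs*yr = S.solve 4 (λ x y s r →
    x S.:* y S.:* (s S.:* S.con 1 S.:* r) S.:= x S.:* s S.:* (y S.:* r)) refl

  1^n≈1 : ∀ n → 1# ^ n ≈ 1#
  1^n≈1 zero    = refl
  1^n≈1 (suc n) = trans (*-identityˡ _) (1^n≈1 n)

  -- Used with `u` the uniformizer 1/z at ∞: the power of `u` in the pole condition is traded for a
  -- power of `z`, which is a polynomial.
  clear-power : ∀ z u → z * u ≈ 1# → ∀ n b d g w →
    b * (d * g * w) ≈ z ^ n * d * (b * (u ^ n * (g * w)))
  clear-power z u zu≈1 n b d g w = begin
    b * (d * g * w)                               ≈⟨ *-identityˡ _ ⟨
    1# * (b * (d * g * w))                        ≈⟨ *-congʳ (1^n≈1 n) ⟨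
    1# ^ n * (b * (d * g * w))                    ≈⟨ *-congʳ (^-congˡ n zu≈1) ⟨
    (z * u) ^ n * (b * (d * g * w))               ≈⟨ *-congʳ (^-distrib-* z u n) ⟩
    z ^ n * u ^ n * (b * (d * g * w))             ≈⟨ S.solve 6 (λ z u b d g w →
      z S.:* u S.:* (b S.:* (d S.:* g S.:* w)) S.:=
      z S.:* d S.:* (b S.:* (u S.:* (g S.:* w)))) refl (z ^ n) (u ^ n) b d g w ⟩
    z ^ n * d * (b * (u ^ n * (g * w)))           ∎

-- Rational functions with cleared denominators, and regularity.

module RationalFunctionProperties {c ℓ₁ ℓ₂} (K : DiscreteField c ℓ₁ ℓ₂) where

  private module K where
    open DiscreteField K public
    open CommutativeRing commutativeRing public
      using (_-_; -‿cong; +-congʳ; *-congʳ; zeroˡ; -‿inverseʳ; +-comm)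
  open FieldProperties K
  open RingProperties K.ring using (-0#≈0#; -‿involutive)
  open PolynomialProperties K
  open RationalFunctions K
  private
    module P = CommutativeRing polyRing
    module PI = RingIdentities polyRing
    module L = CommutativeRing fractionRing
    module LI = RingIdentities fractionRing
  open L using () renaming (_+_ to infixl 6 _⊕_; _*_ to infixl 7 _⊗_; -_ to infix 8 ⊖_)

  embed-injective : ∀ {p q} → embed p ≈ᶠ embed q → p ≈ₚ q
  embed-injective {p} {q} (mk≈ᶠ e) =
    ≈ₚ-trans (≈ₚ-sym (P.*-identityʳ p)) (≈ₚ-trans e (P.*-identityʳ q))

  embed-den : ∀ g → embed (den g) ⊗ g ≈ᶠ embed (num g)
  embed-den g = mk≈ᶠ (PI.yx*1≈x*1y (num g) (den g))

  embed-cancel : ∀ {p} g h → ¬ p ≈ₚ 0ₚ → embed p ⊗ g ≈ᶠ embed p ⊗ h → g ≈ᶠ h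
  embed-cancel {p} g h p≉0 (mk≈ᶠ e) = mk≈ᶠ (polyCancel K p _ _ p≉0 (begin
    p *ₚ (num g *ₚ den h)             ≈⟨ PI.xy*1z≈x*yz p (num g) (den h) ⟨
    (p *ₚ num g) *ₚ (1ₚ *ₚ den h)     ≈⟨ e ⟩
    (p *ₚ num h) *ₚ (1ₚ *ₚ den g)     ≈⟨ PI.xy*1z≈x*yz p (num h) (den g) ⟩
    p *ₚ (num h *ₚ den g)             ∎))
    where
    open SetoidReasoning polySetoid

  -- Turns a polynomial identity into a chosen representative of `g`. Regularity asks only that some
  -- representative has a suitable denominator, so it can be proved in cleared form.
  cleared⇒≈ : ∀ g {a b} (b≉0 : ¬ b ≈ₚ 0ₚ) → embed b ⊗ g ≈ᶠ embed a → g ≈ᶠ frac a b b≉0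
  cleared⇒≈ g {a} {b} b≉0 e =
    embed-cancel g (frac a b b≉0) b≉0 (L.trans e (L.sym (embed-den (frac a b b≉0))))

  ≈⇒cleared : ∀ {g h} → g ≈ᶠ h → embed (den h) ⊗ g ≈ᶠ embed (num h)
  ≈⇒cleared {g} {h} e = L.trans (L.*-congˡ {embed (den h)} e) (embed-den h)

  cleared-cross : ∀ g {a b a′ b′} → embed b ⊗ g ≈ᶠ embed a → embed b′ ⊗ g ≈ᶠ embed a′ →
    b′ *ₚ a ≈ₚ b *ₚ a′
  cleared-cross g {a} {b} {a′} {b′} e e′ = embed-injective (begin
    embed (b′ *ₚ a)              ≈⟨ embed-* b′ a ⟩
    embed b′ ⊗ embed a           ≈⟨ L.*-congˡ {embed b′} e ⟨
    embed b′ ⊗ (embed b ⊗ g)     ≈⟨ LI.x*yz≈y*xz (embed b′) (embed b) g ⟩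
    embed b ⊗ (embed b′ ⊗ g)     ≈⟨ L.*-congˡ {embed b} e′ ⟩
    embed b ⊗ embed a′           ≈⟨ embed-* b a′ ⟨
    embed (b *ₚ a′)              ∎)
    where open SetoidReasoning L.setoid

  regular-affine : ∀ {x} g {a b} → ¬ eval b x K.≈ K.0# → embed b ⊗ g ≈ᶠ embed a →
    RegularAt [ x ] g
  regular-affine g {a} {b} b≉0 e =
    frac a b (eval≉0⇒≉0 {b} b≉0) , cleared⇒≈ g (eval≉0⇒≉0 {b} b≉0) e , b≉0

  regular-∞ : ∀ g {a b n} → HasDegree b n → Degree≤ a n → embed b ⊗ g ≈ᶠ embed a →
    RegularAt ∙ g
  regular-∞ g {a} {b} {n} d d′ e =
    frac a b (hasDegree⇒≉0 {b} d) , n , cleared⇒≈ g (hasDegree⇒≉0 {b} d) e , d , d′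

  regular-polynomial : ∀ x p → RegularAt [ x ] (embed p)
  regular-polynomial x p = embed p , L.refl ,
    λ e → K.1≉0 (K.trans (K.sym (eval-1 x)) e)

  clear-linear : ∀ g x {a b a₁ b₁} → a ≈ₚ linear x *ₚ a₁ → b ≈ₚ linear x *ₚ b₁ →
    embed b ⊗ g ≈ᶠ embed a → embed b₁ ⊗ g ≈ᶠ embed a₁
  clear-linear g x {a} {b} {a₁} {b₁} a≈ b≈ e =
    embed-cancel {linear x} (embed b₁ ⊗ g) (embed a₁)
      (hasDegree⇒≉0 {linear x} (linear-degree x)) (begin
        embed (linear x) ⊗ (embed b₁ ⊗ g)   ≈⟨ L.*-assoc (embed (linear x)) (embed b₁) g ⟨
        embed (linear x) ⊗ embed b₁ ⊗ g     ≈⟨ L.*-congʳ {g} (embed-* (linear x) b₁) ⟨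
        embed (linear x *ₚ b₁) ⊗ g          ≈⟨ L.*-congʳ {g} (embed-cong b≈) ⟨
        embed b ⊗ g                         ≈⟨ e ⟩
        embed a                             ≈⟨ embed-cong a≈ ⟩
        embed (linear x *ₚ a₁)              ≈⟨ embed-* (linear x) a₁ ⟩
        embed (linear x) ⊗ embed a₁         ∎)
    where open SetoidReasoning L.setoid

  -- Cross-multiply with a representative whose denominator does not vanish at `x` and evaluate
  -- there: the side containing `b` is zero.
  regular⇒zero-cancels : ∀ g x {a b} → RegularAt [ x ] g → embed b ⊗ g ≈ᶠ embed a →
    eval b x K.≈ K.0# → eval a x K.≈ K.0#
  regular⇒zero-cancels g x {a} {b} (h , g≈h , hx≉0) e bx≈0 = x*y≈0⇒y≈0 hx≉0 (begin
    eval (den h) x K.* eval a x   ≈⟨ eval-* (den h) a x ⟨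
    eval (den h *ₚ a) x           ≈⟨ eval-cong
      (cleared-cross g {a} {b} {num h} {den h} e (≈⇒cleared {g} {h} g≈h)) x ⟩
    eval (b *ₚ num h) x           ≈⟨ eval-* b (num h) x ⟩
    eval b x K.* eval (num h) x   ≈⟨ K.*-congʳ bx≈0 ⟩
    K.0# K.* eval (num h) x       ≈⟨ K.zeroˡ _ ⟩
    K.0#                          ∎)
    where open SetoidReasoning K.setoid

  -- Each zero of the denominator is a zero of the numerator too, by
  -- regularity there, so linear factors can be cancelled one by one.

  module _ (root : ∀ p n → HasDegree p (suc n) → ∃[ x ] eval p x K.≈ K.0#)
    (g : RatFun) (regular : ∀ x → RegularAt [ x ] g) where

    cleared⇒polynomial : ∀ n a b → HasDegree b n → embed b ⊗ g ≈ᶠ embed a → ∃[ p ] g ≈ᶠ embed p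
    cleared⇒polynomial zero a b d e = p , embed-cancel {b} g (embed p) (hasDegree⇒≉0 {b} d)
      (begin
        embed b ⊗ g         ≈⟨ e ⟩
        embed a             ≈⟨ embed-cong (proj₂ (degree-zero-divides b d a)) ⟨
        embed (b *ₚ p)      ≈⟨ embed-* b p ⟩
        embed b ⊗ embed p   ∎)
      where
      open SetoidReasoning L.setoid
      p = proj₁ (degree-zero-divides b d a)
    cleared⇒polynomial (suc n) a b d e =
      cleared⇒polynomial n (quotient a x) (quotient b x)
        (factor-degree b x (quotient b x) d (root⇒factor b x bx≈0))
        (clear-linear g x {a} {b} {quotient a x} {quotient b x}
          (root⇒factor a x (regular⇒zero-cancels g x {a} {b} (regular x) e bx≈0))
          (root⇒factor b x bx≈0) e)
      where
      x = proj₁ (root b n d)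
      bx≈0 = proj₂ (root b n d)

    regular⇒polynomial : ∃[ p ] g ≈ᶠ embed p
    regular⇒polynomial = [ (λ den≈0 → contradiction den≈0 (den≉0 g))
      , (λ (n , d) → cleared⇒polynomial n (num g) (den g) d (embed-den g)) ]′
      (zero⊎hasDegree (den g))

  -- Pole orders of products of forms.

  uniformizer-regular : ∀ x → RegularAt x (uniformizer x)
  uniformizer-regular [ a ] = regular-polynomial a (linear a)
  uniformizer-regular ∙ = regular-∞ 1/z {1ₚ} {X} {1}
    (K.1≉0 , λ { (suc (suc i)) _ → K.refl ; 1 (s≤s ()) })
    (λ { (suc i) _ → K.refl }) (embed-den 1/z)

  pole-1 : ∀ x → FormPoleOrder≤ 0 0 x L.1#
  pole-1 x = regular-cong x {const K.1#} {L.1# ⊗ (L.1# ⊗ L.1#)}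
    (L.sym (L.trans (L.*-identityˡ (L.1# ⊗ L.1#)) (L.*-identityˡ L.1#)))
    (regular-const x K.1#)

  pole-* : ∀ x {j k m n} g h → FormPoleOrder≤ j m x g → FormPoleOrder≤ k n x h →
    FormPoleOrder≤ (j ℕ.+ k) (m ℕ.+ n) x (g ⊗ h)
  pole-* x {j} {k} {m} {n} g h p q = regular-cong x
    {uniformizer x ^ᶠ m ⊗ (g ⊗ dz/dt x ^ᶠ j) ⊗ (uniformizer x ^ᶠ n ⊗ (h ⊗ dz/dt x ^ᶠ k))}
    {uniformizer x ^ᶠ (m ℕ.+ n) ⊗ (g ⊗ h ⊗ dz/dt x ^ᶠ (j ℕ.+ k))}
    (LI.weighted-* (uniformizer x) (dz/dt x) g h m n j k)
    (regular-* x {uniformizer x ^ᶠ m ⊗ (g ⊗ dz/dt x ^ᶠ j)}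
      {uniformizer x ^ᶠ n ⊗ (h ⊗ dz/dt x ^ᶠ k)} p q)

  pole-suc : ∀ x {k} m g → FormPoleOrder≤ k m x g → FormPoleOrder≤ k (suc m) x g
  pole-suc x {k} m g p = regular-cong x
    {t ⊗ (t ^ᶠ m ⊗ (g ⊗ w))} {t ⊗ t ^ᶠ m ⊗ (g ⊗ w)}
    (LI.x[yz]≈[xy]z t (t ^ᶠ m) (g ⊗ w))
    (regular-* x {t} {t ^ᶠ m ⊗ (g ⊗ w)} (uniformizer-regular x) p)
    where
    t = uniformizer x
    w = dz/dt x ^ᶠ k

  pole-mono : ∀ x {k m n} g → m ℕ.≤′ n → FormPoleOrder≤ k m x g → FormPoleOrder≤ k n x g
  pole-mono x g ℕ.≤′-refl p = p
  pole-mono x {k} {m} {suc n} g (ℕ.≤′-step m≤n) p =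
    pole-suc x {k} n g (pole-mono x {k} {m} {n} g m≤n p)

  pole-^ : ∀ x m e g → FormPoleOrder≤ 1 m x g → FormPoleOrder≤ e (e ℕ.* m) x (g ^ᶠ e)
  pole-^ x m zero    g p = pole-1 x
  pole-^ x m (suc e) g p = pole-* x {1} {e} {m} {e ℕ.* m} g (g ^ᶠ e) p (pole-^ x m e g p)

  simple-pole-^ : ∀ x e g → FormPoleOrder≤ 1 1 x g → FormPoleOrder≤ e e x (g ^ᶠ e)
  simple-pole-^ x e g p = ≡.subst (λ m → FormPoleOrder≤ e m x (g ^ᶠ e))
    (ℕₚ.*-identityʳ e) (pole-^ x 1 e g p)

  no-pole-^ : ∀ x e g → FormPoleOrder≤ 1 0 x g → FormPoleOrder≤ e 0 x (g ^ᶠ e)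
  no-pole-^ x e g p = ≡.subst (λ m → FormPoleOrder≤ e m x (g ^ᶠ e))
    (ℕₚ.*-zeroʳ e) (pole-^ x 0 e g p)

  open RawMonoidDefinitions ℕ.+-0-rawMonoid using () renaming (sum to sumℕ)
  open RawMonoidDefinitions (Monoid.rawMonoid L.*-monoid) using () renaming (sum to productᶠ)

  simple-poles-product : ∀ x {r} (g : Vector RatFun r) (e : Vector ℕ r) →
    (∀ i → FormPoleOrder≤ 1 1 x (g i)) →
    FormPoleOrder≤ (sumℕ e) (sumℕ e) x (productᶠ λ i → g i ^ᶠ e i)
  simple-poles-product x {zero}  g e p = pole-1 x
  simple-poles-product x {suc r} g e p = pole-* x {e zero} {sumℕ (e ∘ suc)} {e zero} {sumℕ (e ∘ suc)}
    (g zero ^ᶠ e zero) (productᶠ λ i → g (suc i) ^ᶠ e (suc i))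
    (simple-pole-^ x (e zero) (g zero) (p zero))
    (simple-poles-product x (g ∘ suc) (e ∘ suc) (p ∘ suc))

  no-poles-product : ∀ x {r} (g : Vector RatFun r) (e : Vector ℕ r) →
    (∀ i → FormPoleOrder≤ 1 0 x (g i)) →
    FormPoleOrder≤ (sumℕ e) 0 x (productᶠ λ i → g i ^ᶠ e i)
  no-poles-product x {zero}  g e p = pole-1 x
  no-poles-product x {suc r} g e p = pole-* x {e zero} {sumℕ (e ∘ suc)} {0} {0}
    (g zero ^ᶠ e zero) (productᶠ λ i → g (suc i) ^ᶠ e (suc i))
    (no-pole-^ x (e zero) (g zero) (p zero))
    (no-poles-product x (g ∘ suc) (e ∘ suc) (p ∘ suc))

  -- A single factor without a pole contributes 0 instead of its positive exponent, so the order
  -- falls strictly below the weight. This is how an empty common intersection yields order k - 1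
  -- instead of k.
  some-simple-poles-product : ∀ x {r} (g : Vector RatFun r) (e : Vector ℕ r) →
    (∀ i → FormPoleOrder≤ 1 1 x (g i)) →
    ∀ i → 1 ℕ.≤ e i → FormPoleOrder≤ 1 0 x (g i) →
    ∃[ m ] m ℕ.< sumℕ e × FormPoleOrder≤ (sumℕ e) m x (productᶠ λ i → g i ^ᶠ e i)
  some-simple-poles-product x g e p zero 1≤e₀ p₀ =
    sumℕ (e ∘ suc) , ℕₚ.+-monoˡ-≤ (sumℕ (e ∘ suc)) 1≤e₀ ,
    pole-* x {e zero} {sumℕ (e ∘ suc)} {0} {sumℕ (e ∘ suc)}
      (g zero ^ᶠ e zero) (productᶠ λ i → g (suc i) ^ᶠ e (suc i))
      (no-pole-^ x (e zero) (g zero) p₀)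
      (simple-poles-product x (g ∘ suc) (e ∘ suc) (p ∘ suc))
  some-simple-poles-product x g e p (suc i) 1≤eᵢ pᵢ =
    e zero ℕ.+ proj₁ ih ,
    ≡.subst (ℕ._≤ sumℕ e) (ℕₚ.+-suc (e zero) (proj₁ ih))
      (ℕₚ.+-monoʳ-≤ (e zero) (proj₁ (proj₂ ih))) ,
    pole-* x {e zero} {sumℕ (e ∘ suc)} {e zero} {proj₁ ih} (g zero ^ᶠ e zero)
      (productᶠ λ i → g (suc i) ^ᶠ e (suc i))
      (simple-pole-^ x (e zero) (g zero) (p zero)) (proj₂ (proj₂ ih))
    where
    ih = some-simple-poles-product x (g ∘ suc) (e ∘ suc) (p ∘ suc) i 1≤eᵢ pᵢ

  -- Local behaviour of s(z; α, β) at the points of the line.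

  _≈ᴷ_ : ℙ¹ → ℙ¹ → Set (c ⊔ ℓ₁)
  _≈ᴷ_ = _≈∙_ K._≈_

  ℓ : ℙ¹ → Poly
  ℓ [ a ] = linear a
  ℓ ∙     = 1ₚ

  -- Not the inverse of `ℓ` at ∞: it follows the convention 1/(z - ∞) = 0, while `ℓ ∙` is 1.
  1/ℓ : ℙ¹ → RatFun
  1/ℓ [ a ] = 1/[z- a ]
  1/ℓ ∙     = L.0#

  σ : ℙ¹ → ℙ¹ → RatFun
  σ α β = 1/ℓ β L.- 1/ℓ α

  -- The constant ℓ α ℓ β σ α β.

  gap : ℙ¹ → ℙ¹ → K.Carrier
  gap [ a ] [ b ] = b K.- a
  gap [ a ] ∙     = K.- K.1#
  gap ∙     [ b ] = K.1#
  gap ∙     ∙     = K.0#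

  gap≉0 : ∀ α β → ¬ α ≈ᴷ β → ¬ gap α β K.≈ K.0#
  gap≉0 [ a ] [ b ] α≉β = x≉y⇒x-y≉0 λ e → α≉β [ K.sym e ]
  gap≉0 [ a ] ∙     α≉β e = K.1≉0 (K.trans (K.sym (-‿involutive K.1#))
    (K.trans (K.-‿cong e) -0#≈0#))
  gap≉0 ∙     [ b ] α≉β = K.1≉0
  gap≉0 ∙     ∙     α≉β = contradiction ∙≈∙ α≉β

  ℓ-degree≤ : ∀ α → Degree≤ (ℓ α) 1
  ℓ-degree≤ [ a ] = proj₂ (linear-degree a)
  ℓ-degree≤ ∙     (suc i) _ = K.refl

  eval-ℓ≉0 : ∀ α x → ¬ α ≈ᴷ [ x ] → ¬ eval (ℓ α) x K.≈ K.0#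
  eval-ℓ≉0 [ a ] x α≉x e = x≉y⇒x-y≉0 (λ x≈a → α≉x [ K.sym x≈a ])
    (K.trans (K.sym (eval-linear a x)) e)
  eval-ℓ≉0 ∙     x α≉x e = K.1≉0 (K.trans (K.sym (eval-1 x)) e)

  ℓ-cong : ∀ {α β} → α ≈ᴷ β → ℓ α ≈ₚ ℓ β
  ℓ-cong ∙≈∙     = ≈ₚ-refl
  ℓ-cong [ a≈b ] = ∷-cong (K.-‿cong a≈b) ≈ₚ-refl

  private
    affine : ℙ¹ → Poly
    affine [ a ] = 1ₚ
    affine ∙     = 0ₚ

    ℓ*1/ℓ : ∀ α → embed (ℓ α) ⊗ 1/ℓ α ≈ᶠ embed (affine α)
    ℓ*1/ℓ [ a ] = embed-den 1/[z- a ]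
    ℓ*1/ℓ ∙     = L.zeroʳ L.1#

    gap-identity : ∀ α β → (ℓ α *ₚ affine β) +ₚ -ₚ (ℓ β *ₚ affine α) ≈ₚ gap α β ∷ []
    gap-identity [ a ] [ b ] = ≈ₚ-trans
      (+ₚ-cong (P.*-identityʳ (linear a)) (-ₚ-cong (P.*-identityʳ (linear b))))
      (mk≈ λ
        { zero          → K.trans (K.+-comm _ _) (K.+-congʳ (-‿involutive b))
        ; (suc zero)    → K.-‿inverseʳ K.1#
        ; (suc (suc n)) → K.refl })
    gap-identity [ a ] ∙ = ≈ₚ-trans
      (+ₚ-cong (*ₚ-zeroʳ (linear a)) (-ₚ-cong (P.*-identityʳ 1ₚ))) ≈ₚ-refl
    gap-identity ∙ [ b ] = ≈ₚ-trans
      (+ₚ-cong (P.*-identityʳ 1ₚ) (-ₚ-cong (*ₚ-zeroʳ (linear b)))) ≈ₚ-refl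
    gap-identity ∙ ∙ = ≈ₚ-trans
      (+ₚ-cong (*ₚ-zeroʳ 1ₚ) (-ₚ-cong (*ₚ-zeroʳ 1ₚ))) (≈ₚ-sym (0∷-zero ≈ₚ-refl))

  -- In the difference of the two partial fractions the terms in z cancel. With a constant
  -- numerator, all local information about `σ α β` sits in `ℓ α *ₚ ℓ β`, also when an endpoint is
  -- ∞.
  ℓℓσ≈gap : ∀ α β → embed (ℓ α *ₚ ℓ β) ⊗ σ α β ≈ᶠ const (gap α β)
  ℓℓσ≈gap α β = begin
    embed (ℓ α *ₚ ℓ β) ⊗ σ α β
      ≈⟨ L.*-congʳ {σ α β} (embed-* (ℓ α) (ℓ β)) ⟩
    embed (ℓ α) ⊗ embed (ℓ β) ⊗ σ α β
      ≈⟨ LI.xy*[v-u]≈x[yv]-y[xu] (embed (ℓ α)) (embed (ℓ β)) (1/ℓ α) (1/ℓ β) ⟩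
    embed (ℓ α) ⊗ (embed (ℓ β) ⊗ 1/ℓ β) ⊕ ⊖ (embed (ℓ β) ⊗ (embed (ℓ α) ⊗ 1/ℓ α))
      ≈⟨ L.+-cong (product≈ α β) (L.-‿cong (product≈ β α)) ⟩
    embed (ℓ α *ₚ affine β) ⊕ ⊖ embed (ℓ β *ₚ affine α)
      ≈⟨ embed-+ (ℓ α *ₚ affine β) (-ₚ (ℓ β *ₚ affine α)) ⟨
    embed ((ℓ α *ₚ affine β) +ₚ -ₚ (ℓ β *ₚ affine α))
      ≈⟨ embed-cong (gap-identity α β) ⟩
    const (gap α β) ∎
    where
    open SetoidReasoning L.setoid
    product≈ : ∀ α β → embed (ℓ α) ⊗ (embed (ℓ β) ⊗ 1/ℓ β) ≈ᶠ embed (ℓ α *ₚ affine β)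
    product≈ α β = L.trans (L.*-congˡ {embed (ℓ α)} (ℓ*1/ℓ β))
      (L.sym (embed-* (ℓ α) (affine β)))

  private
    σ-cleared : ∀ x m b α β → uniformizer x ^ᶠ m ⊗ dz/dt x ^ᶠ 1 ≈ᶠ embed b →
      embed (ℓ α *ₚ ℓ β) ⊗ (uniformizer x ^ᶠ m ⊗ (σ α β ⊗ dz/dt x ^ᶠ 1))
        ≈ᶠ embed ((gap α β ∷ []) *ₚ b)
    σ-cleared x m b α β e = begin
      embed (ℓ α *ₚ ℓ β) ⊗ (t ⊗ (σ α β ⊗ w))
        ≈⟨ LI.x*t[sw]≈xs*tw (embed (ℓ α *ₚ ℓ β)) t (σ α β) w ⟩
      embed (ℓ α *ₚ ℓ β) ⊗ σ α β ⊗ (t ⊗ w)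
        ≈⟨ L.*-cong (ℓℓσ≈gap α β) e ⟩
      const (gap α β) ⊗ embed b
        ≈⟨ embed-* (gap α β ∷ []) b ⟨
      embed ((gap α β ∷ []) *ₚ b) ∎
      where
      open SetoidReasoning L.setoid
      t = uniformizer x ^ᶠ m
      w = dz/dt x ^ᶠ 1

    1ᶠ = L.1#

    affine-weight : 1ᶠ ⊗ (1ᶠ ⊗ 1ᶠ) ≈ᶠ 1ᶠ
    affine-weight = L.trans (L.*-identityˡ (1ᶠ ⊗ 1ᶠ)) (L.*-identityˡ 1ᶠ)

    ∞-weight-0 : 1ᶠ ⊗ (⊖ (z ⊗ z) ⊗ 1ᶠ) ≈ᶠ embed (-ₚ (X *ₚ X))
    ∞-weight-0 = L.trans (L.*-identityˡ (⊖ (z ⊗ z) ⊗ 1ᶠ))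
      (L.trans (L.*-identityʳ (⊖ (z ⊗ z))) (L.-‿cong (L.sym (embed-* X X))))

    ∞-weight-1 : 1/z ⊗ 1ᶠ ⊗ (⊖ (z ⊗ z) ⊗ 1ᶠ) ≈ᶠ embed (-ₚ X)
    ∞-weight-1 = L.trans (LI.u1*[-yy*1]≈-[yu*y] 1/z z)
      (L.-‿cong (L.trans (L.*-congʳ {z} (embed-den 1/z)) (L.*-identityˡ z)))

  private
    σ-degree-≤ : ∀ b α β {n} → Degree≤ b n → Degree≤ ((gap α β ∷ []) *ₚ b) n
    σ-degree-≤ b α β d = proj₁ (top-coeff-* (gap α β ∷ []) b 0 _ (λ { (suc i) _ → K.refl }) d)

    X-degree≤ : Degree≤ X 1
    X-degree≤ (suc (suc i)) _ = K.refl
    X-degree≤ 1 (s≤s ())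

    -- The uniformizer z - x absorbs the factor `ℓ α` of the denominator, and the other factor `ℓ β`
    -- is non-zero at `x`.
    σ-affine-zero : ∀ x α β → ℓ α ≈ₚ linear x → ¬ β ≈ᴷ [ x ] →
      FormPoleOrder≤ 1 1 [ x ] (σ α β)
    σ-affine-zero x α β ℓα≈ β≉x = regular-affine ((z- x) ⊗ 1ᶠ ⊗ (σ α β ⊗ (1ᶠ ⊗ 1ᶠ)))
      {gap α β ∷ []} {ℓ β} (eval-ℓ≉0 β x β≉x) (begin
        embed (ℓ β) ⊗ ((z- x) ⊗ 1ᶠ ⊗ (σ α β ⊗ (1ᶠ ⊗ 1ᶠ)))
          ≈⟨ LI.y*x1[s11]≈xy*s (z- x) (embed (ℓ β)) (σ α β) ⟩
        (z- x) ⊗ embed (ℓ β) ⊗ σ α β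
          ≈⟨ L.*-congʳ {σ α β} (L.*-congʳ {embed (ℓ β)} (embed-cong ℓα≈)) ⟨
        embed (ℓ α) ⊗ embed (ℓ β) ⊗ σ α β
          ≈⟨ L.*-congʳ {σ α β} (embed-* (ℓ α) (ℓ β)) ⟨
        embed (ℓ α *ₚ ℓ β) ⊗ σ α β
          ≈⟨ ℓℓσ≈gap α β ⟩
        const (gap α β) ∎)
      where open SetoidReasoning L.setoid

    σ-affine-pole : ∀ x α β → ¬ α ≈ᴷ [ x ] → ℓ β ≈ₚ linear x →
      FormPoleOrder≤ 1 1 [ x ] (σ α β)
    σ-affine-pole x α β α≉x ℓβ≈ = regular-affine ((z- x) ⊗ 1ᶠ ⊗ (σ α β ⊗ (1ᶠ ⊗ 1ᶠ)))
      {gap α β ∷ []} {ℓ α} (eval-ℓ≉0 α x α≉x) (begin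
        embed (ℓ α) ⊗ ((z- x) ⊗ 1ᶠ ⊗ (σ α β ⊗ (1ᶠ ⊗ 1ᶠ)))
          ≈⟨ LI.y*x1[s11]≈xy*s (z- x) (embed (ℓ α)) (σ α β) ⟩
        (z- x) ⊗ embed (ℓ α) ⊗ σ α β
          ≈⟨ L.*-congʳ {σ α β} (L.*-comm (z- x) (embed (ℓ α))) ⟩
        embed (ℓ α) ⊗ (z- x) ⊗ σ α β
          ≈⟨ L.*-congʳ {σ α β} (L.*-congˡ {embed (ℓ α)} (embed-cong ℓβ≈)) ⟨
        embed (ℓ α) ⊗ embed (ℓ β) ⊗ σ α β
          ≈⟨ L.*-congʳ {σ α β} (embed-* (ℓ α) (ℓ β)) ⟨
        embed (ℓ α *ₚ ℓ β) ⊗ σ α β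
          ≈⟨ ℓℓσ≈gap α β ⟩
        const (gap α β) ∎)
      where open SetoidReasoning L.setoid

  no-pole-σ : ∀ x α β → ¬ α ≈ᴷ x → ¬ β ≈ᴷ x → FormPoleOrder≤ 1 0 x (σ α β)
  no-pole-σ [ x ] α β α≉x β≉x = regular-affine (1ᶠ ⊗ (σ α β ⊗ (1ᶠ ⊗ 1ᶠ)))
    {(gap α β ∷ []) *ₚ 1ₚ} {ℓ α *ₚ ℓ β}
    (λ e → K.x*y≉0 (eval-ℓ≉0 α x α≉x) (eval-ℓ≉0 β x β≉x)
      (K.trans (K.sym (eval-* (ℓ α) (ℓ β) x)) e))
    (σ-cleared [ x ] 0 1ₚ α β affine-weight)
  no-pole-σ ∙ ∙ β α≉∞ β≉∞ = contradiction ∙≈∙ α≉∞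
  no-pole-σ ∙ [ a ] ∙ α≉∞ β≉∞ = contradiction ∙≈∙ β≉∞
  -- Two affine endpoints give a denominator of degree 2, which compensates the double pole of dz at
  -- ∞.
  no-pole-σ ∙ [ a ] [ b ] α≉∞ β≉∞ = regular-∞ (1ᶠ ⊗ (σ [ a ] [ b ] ⊗ (⊖ (z ⊗ z) ⊗ 1ᶠ)))
    {(gap [ a ] [ b ] ∷ []) *ₚ -ₚ (X *ₚ X)} {linear a *ₚ linear b} {2}
    (*ₚ-degree (linear a) (linear b) {1} {1} (linear-degree a) (linear-degree b))
    (σ-degree-≤ (-ₚ (X *ₚ X)) [ a ] [ b ]
      (degree≤-neg (X *ₚ X) (proj₁ (top-coeff-* X X 1 1 X-degree≤ X-degree≤))))
    (σ-cleared ∙ 0 (-ₚ (X *ₚ X)) [ a ] [ b ] ∞-weight-0)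

  simple-pole-σ : ∀ x α β → ¬ α ≈ᴷ β → FormPoleOrder≤ 1 1 x (σ α β)
  simple-pole-σ [ x ] α β α≉β = cases (≈∙-dec K._≈_ K._≟_ α [ x ]) (≈∙-dec K._≈_ K._≟_ β [ x ])
    where
    cases : Dec (α ≈ᴷ [ x ]) → Dec (β ≈ᴷ [ x ]) → FormPoleOrder≤ 1 1 [ x ] (σ α β)
    cases (yes α≈x) (yes β≈x) =
      contradiction (≈∙-trans K._≈_ K.trans α≈x (≈∙-sym K._≈_ K.sym β≈x)) α≉β
    cases (yes α≈x) (no β≉x) = σ-affine-zero x α β (ℓ-cong α≈x) β≉x
    cases (no α≉x) (yes β≈x) = σ-affine-pole x α β α≉x (ℓ-cong β≈x)
    cases (no α≉x) (no β≉x) = pole-suc [ x ] {1} 0 (σ α β) (no-pole-σ [ x ] α β α≉x β≉x)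
  simple-pole-σ ∙ ∙ ∙ α≉β = contradiction ∙≈∙ α≉β
  -- With only one affine endpoint the denominator has degree 1, and one of the two poles of dz at ∞
  -- is left for the uniformizer to absorb.
  simple-pole-σ ∙ [ a ] ∙ α≉β =
    regular-∞ (1/z ⊗ 1ᶠ ⊗ (σ [ a ] ∙ ⊗ (⊖ (z ⊗ z) ⊗ 1ᶠ)))
      {(gap [ a ] ∙ ∷ []) *ₚ -ₚ X} {linear a *ₚ 1ₚ} {1}
      (*ₚ-degree (linear a) 1ₚ {1} {0} (linear-degree a) 1ₚ-degree)
      (σ-degree-≤ (-ₚ X) [ a ] ∙ (degree≤-neg X X-degree≤))
      (σ-cleared ∙ 1 (-ₚ X) [ a ] ∙ ∞-weight-1)
  simple-pole-σ ∙ ∙ [ b ] α≉β =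
    regular-∞ (1/z ⊗ 1ᶠ ⊗ (σ ∙ [ b ] ⊗ (⊖ (z ⊗ z) ⊗ 1ᶠ)))
      {(gap ∙ [ b ] ∷ []) *ₚ -ₚ X} {1ₚ *ₚ linear b} {1}
      (*ₚ-degree 1ₚ (linear b) {0} {1} 1ₚ-degree (linear-degree b))
      (σ-degree-≤ (-ₚ X) ∙ [ b ] (degree≤-neg X X-degree≤))
      (σ-cleared ∙ 1 (-ₚ X) ∙ [ b ] ∞-weight-1)
  simple-pole-σ ∙ [ a ] [ b ] α≉β =
    pole-suc ∙ {1} 0 (σ [ a ] [ b ]) (no-pole-σ ∙ [ a ] [ b ] (λ ()) (λ ()))

  -- Passing from forms to polynomials by a common denominator.

  embed-^ : ∀ p n → embed (p ^ n) ≈ᶠ embed p ^ᶠ n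
  embed-^ p zero    = L.refl
  embed-^ p (suc n) = L.trans (embed-* p (p ^ n)) (L.*-congˡ {embed p} (embed-^ p n))

  const-⊗-embed : ∀ a p → const a ⊗ embed p ≈ᶠ embed (a · p)
  const-⊗-embed a p = L.trans (L.sym (embed-* (a ∷ []) p))
    (embed-cong (≈ₚ-trans (P.+-congˡ {a · p} (0∷-zero ≈ₚ-refl)) (+ₚ-identityʳ (a · p))))

  regular-point-cong : ∀ {x y} g → x K.≈ y → RegularAt [ x ] g → RegularAt [ y ] g
  regular-point-cong g x≈y (h , g≈h , r) =
    h , g≈h , λ e → r (K.trans (eval-congʳ (den h) x≈y) e)

  -- Multiplication by `embed d` is linear, so relations between forms become relations between
  -- polynomials. The `k i` make room for the constants by which windows and Newton polynomials
  -- differ.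
  cleared-combination : ∀ d {n} (w : Vector RatFun n) (k : Vector K.Carrier n) p →
    (∀ i → embed d ⊗ w i ≈ᶠ embed (k i · p i)) →
    ∀ a → embed d ⊗ linearCombination forms a w ≈ᶠ embed (combination (λ i → a i K.* k i) p)
  cleared-combination d {zero}  w k p e a = L.zeroʳ (embed d)
  cleared-combination d {suc n} w k p e a = begin
    embed d ⊗ (const a₀ ⊗ w zero ⊕ rest)
      ≈⟨ L.distribˡ (embed d) (const a₀ ⊗ w zero) rest ⟩
    embed d ⊗ (const a₀ ⊗ w zero) ⊕ embed d ⊗ rest
      ≈⟨ L.+-cong head≈ (cleared-combination d (w ∘ suc) (k ∘ suc) (p ∘ suc) (e ∘ suc) (a ∘ suc)) ⟩
    embed ((a₀ K.* k zero) · p zero) ⊕ embed rest′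
      ≈⟨ embed-+ ((a₀ K.* k zero) · p zero) rest′ ⟨
    embed (((a₀ K.* k zero) · p zero) +ₚ rest′) ∎
    where
    open SetoidReasoning L.setoid
    a₀ = a zero
    rest = linearCombination forms (a ∘ suc) (w ∘ suc)
    rest′ = combination (λ i → a (suc i) K.* k (suc i)) (p ∘ suc)
    head≈ : embed d ⊗ (const a₀ ⊗ w zero) ≈ᶠ embed ((a₀ K.* k zero) · p zero)
    head≈ = begin
      embed d ⊗ (const a₀ ⊗ w zero)        ≈⟨ LI.x*yz≈y*xz (embed d) (const a₀) (w zero) ⟩
      const a₀ ⊗ (embed d ⊗ w zero)        ≈⟨ L.*-congˡ {const a₀} (e zero) ⟩
      const a₀ ⊗ embed (k zero · p zero)   ≈⟨ const-⊗-embed a₀ (k zero · p zero) ⟩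
      embed (a₀ · (k zero · p zero))       ≈⟨ embed-cong (·-assoc a₀ (k zero) (p zero)) ⟨
      embed ((a₀ K.* k zero) · p zero)     ∎

-- Kurihara differentials lie in H⁰.

module KuriharaProperties {c ℓ₁ ℓ₂ c′ ℓ₁′ ℓ₂′}
  (F : DiscreteField c ℓ₁ ℓ₂) (K : DiscreteField c′ ℓ₁′ ℓ₂′)
  (ι : DiscreteField.Carrier F → DiscreteField.Carrier K)
  (isRingHomomorphism : IsRingHomomorphism (DiscreteField.rawRing F) (DiscreteField.rawRing K) ι)
  where

  private
    module F where
      open DiscreteField F public
      open CommutativeRing commutativeRing public using (_-_)
    module K where
      open DiscreteField K public
      open CommutativeRing commutativeRing public
        using (*-cong; *-congˡ; *-assoc; *-comm; *-identityʳ; zeroˡ; +-cong; -‿cong; -‿inverseʳ; *-congʳ)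
  open IsRingHomomorphism isRingHomomorphism
    using (+-homo; *-homo; 1#-homo; -‿homo; ⟦⟧-cong)
  open FieldProperties K
  open PolynomialProperties K
  open RationalFunctions K
  open RationalFunctionProperties K
  private
    module P = CommutativeRing polyRing
    module L = CommutativeRing fractionRing
    module LI = RingIdentities fractionRing
    module PI = RingIdentities polyRing
  open L using () renaming (_+_ to infixl 6 _⊕_; _*_ to infixl 7 _⊗_; -_ to infix 8 ⊖_)

  infix 4 _≈F_
  _≈F_ : ℙ¹ᶠ F K ι → ℙ¹ᶠ F K ι → Set (c ⊔ ℓ₁)
  _≈F_ = _≈ᴾ_ F K ι

  point : ℙ¹ᶠ F K ι → ℙ¹
  point = ι∙ F K ι

  ι-injective : ∀ {a b} → ι a K.≈ ι b → a F.≈ b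
  ι-injective {a} {b} e with a F.≟ b
  ... | yes a≈b = a≈b
  ... | no a≉b = contradiction (begin
    K.1#                                      ≈⟨ 1#-homo ⟨
    ι F.1#                                    ≈⟨ ⟦⟧-cong (proj₂ inv) ⟨
    ι ((a F.- b) F.* proj₁ inv)               ≈⟨ *-homo _ _ ⟩
    ι (a F.- b) K.* ι (proj₁ inv)             ≈⟨ K.*-congʳ (+-homo _ _) ⟩
    (ι a K.+ ι (F.- b)) K.* ι (proj₁ inv)     ≈⟨ K.*-congʳ (K.+-cong e (-‿homo b)) ⟩
    (ι b K.+ K.- ι b) K.* ι (proj₁ inv)       ≈⟨ K.*-congʳ (K.-‿inverseʳ _) ⟩
    K.0# K.* ι (proj₁ inv)                    ≈⟨ K.zeroˡ _ ⟩
    K.0#                                      ∎) K.1≉0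
    where
    open SetoidReasoning K.setoid
    inv = FieldProperties.inverse F (FieldProperties.x≉y⇒x-y≉0 F a≉b)

  point-injective : ∀ {α β} → point α ≈ᴷ point β → α ≈F β
  point-injective {∙}     {∙}     _     = ∙≈∙
  point-injective {[ a ]} {[ b ]} [ e ] = [ ι-injective e ]

  s≡σ : ∀ α β → s F K ι α β ≡ σ (point α) (point β)
  s≡σ [ a ] [ b ] = ≡.refl
  s≡σ [ a ] ∙     = ≡.refl
  s≡σ ∙     [ b ] = ≡.refl
  s≡σ ∙     ∙     = ≡.refl

  ≈F-sym : ∀ {α β} → α ≈F β → β ≈F α
  ≈F-sym = ≈∙-sym F._≈_ F.sym

  ≈F-trans : ∀ {α β γ} → α ≈F β → β ≈F γ → α ≈F γ
  ≈F-trans = ≈∙-trans F._≈_ F.trans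

  _≟F_ : ∀ α β → Dec (α ≈F β)
  _≟F_ = ≈∙-dec F._≈_ F._≟_

  InH⁰-cong : ∀ k m g h → g ≈ᶠ h → InH⁰ F K ι k m g → InH⁰ F K ι k m h
  InH⁰-cong k m g h e (p , r) =
    (λ y → regular-cong (point y)
      {uniformizer (point y) ^ᶠ m ⊗ (g ⊗ dz/dt (point y) ^ᶠ k)}
      {uniformizer (point y) ^ᶠ m ⊗ (h ⊗ dz/dt (point y) ^ᶠ k)}
      (L.*-congˡ {uniformizer (point y) ^ᶠ m} (L.*-congʳ {dz/dt (point y) ^ᶠ k} e)) (p y)) ,
    (λ x n → regular-cong x {g ⊗ dz/dt x ^ᶠ k} {h ⊗ dz/dt x ^ᶠ k}
      (L.*-congʳ {dz/dt x ^ᶠ k} e) (r x n))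

  module _ {k} (d : KuriharaDatum F K ι k) where

    open KuriharaDatum d

    private
      g : Vector RatFun r
      g i = s F K ι (α i) (β i)

    -- `disjoint` merely denies a common point; since there are finitely many decidable conditions,
    -- a failing index can be found.
    datum-avoids : ∀ y → ∃[ i ] ¬ (y ≈F α i ⊎ y ≈F β i)
    datum-avoids y = Finₚ.¬∀⟶∃¬ r (λ i → y ≈F α i ⊎ y ≈F β i)
      (λ i → (y ≟F α i) ⊎-dec (y ≟F β i)) λ all → disjoint (y , all)

    private
      no-pole : ∀ x i → ¬ point (α i) ≈ᴷ x → ¬ point (β i) ≈ᴷ x → FormPoleOrder≤ 1 0 x (g i)
      no-pole x i α≉x β≉x = ≡.subst (FormPoleOrder≤ 1 0 x) (≡.sym (s≡σ (α i) (β i)))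
        (no-pole-σ x (point (α i)) (point (β i)) α≉x β≉x)

      simple-pole : ∀ x i → FormPoleOrder≤ 1 1 x (g i)
      simple-pole x i = ≡.subst (FormPoleOrder≤ 1 1 x) (≡.sym (s≡σ (α i) (β i)))
        (simple-pole-σ x (point (α i)) (point (β i)) λ e → α≉β i (point-injective e))

    kurihara-pole : ∀ y → FormPoleOrder≤ k (k ℕ.∸ 1) (point y) form
    kurihara-pole y = pole-mono (point y) {k} {proj₁ few} {k ℕ.∸ 1} form
      (ℕₚ.≤⇒≤′ (ℕₚ.<⇒≤pred (proj₁ (proj₂ few)))) (proj₂ (proj₂ few))
      where
      i = proj₁ (datum-avoids y)
      avoids = proj₂ (datum-avoids y)
      few : ∃[ m ] m ℕ.< k × FormPoleOrder≤ k m (point y) form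
      few = ≡.subst (λ k → ∃[ m ] m ℕ.< k × FormPoleOrder≤ k m (point y) form) total
        (some-simple-poles-product (point y) g exponent (simple-pole (point y)) i (1≤exp i)
          (no-pole (point y) i
            (λ e → avoids (inj₁ (≈F-sym (point-injective e))))
            (λ e → avoids (inj₂ (≈F-sym (point-injective e))))))

    kurihara-regular : ∀ x → (∀ y → ¬ point y ≈ᴷ x) → FormRegularAt k x form
    kurihara-regular x x∉F = regular-cong x {L.1# ⊗ (form ⊗ w)} {form ⊗ w}
      (L.*-identityˡ (form ⊗ w))
      (≡.subst (λ k → FormPoleOrder≤ k 0 x form) total
        (no-poles-product x g exponent λ i → no-pole x i (x∉F (α i)) (x∉F (β i))))
      where w = dz/dt x ^ᶠ k

    kurihara∈H⁰ : InH⁰ F K ι k (k ℕ.∸ 1) form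
    kurihara∈H⁰ = kurihara-pole , kurihara-regular

  span⊆H⁰ : ∀ k g → Span forms (IsKurihara F K ι k) g → InH⁰ F K ι k (k ℕ.∸ 1) g
  span⊆H⁰ k g (n , a , v , kurihara , e) = InH⁰-cong k (k ℕ.∸ 1) (linearCombination forms a v) g
    (L.sym e) (combination∈H⁰ n a v kurihara)
    where
    open IsSubmodule (InH⁰-isSubmodule F K ι k (k ℕ.∸ 1))
    combination∈H⁰ : ∀ n a (v : Vector RatFun n) → (∀ i → IsKurihara F K ι k (v i)) →
      InH⁰ F K ι k (k ℕ.∸ 1) (linearCombination forms a v)
    combination∈H⁰ zero    a v p = 0-closed
    combination∈H⁰ (suc n) a v p = +-closed (const (a zero) ⊗ v zero)
      (linearCombination forms (a ∘ suc) (v ∘ suc))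
      (*-closed (a zero) (v zero) (InH⁰-cong k (k ℕ.∸ 1)
        (KuriharaDatum.form (proj₁ (p zero))) (v zero)
        (L.sym (proj₂ (p zero))) (kurihara∈H⁰ (proj₁ (p zero)))))
      (combination∈H⁰ n (a ∘ suc) (v ∘ suc) (p ∘ suc))

  -- The list of points and its windows.

  module Sequence {q} (card : HasCardinality F.setoid q) (m : ℕ) where

    open Inverse card using (to; from; strictlyInverseˡ; strictlyInverseʳ; from-cong)

    -- `κ` is k - 1, the multiplicity of each point in the list. Taking m = k - 2 as the parameter
    -- makes it visibly non-zero, as division by it requires.
    κ k : ℕ
    κ = suc m
    k = suc κ

    -- The points of ℙ¹(F): the affine ones are numbered 0, …, q - 1 and
    -- every further index gives ∞.

    pt : ℕ → ℙ¹ᶠ F K ι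
    pt t with t ℕₚ.<? q
    ... | yes t<q = [ to (fromℕ< t<q) ]
    ... | no  _   = ∙

    -- The quotient by `κ` is the number of the block. The sequence stays at ∞ for ever, but the
    -- windows used reach only its first (q + 1) κ entries.
    seq : ℕ → ℙ¹ᶠ F K ι
    seq p = pt (p / κ)

    pt-affine : ∀ {t a} → pt t ≡ [ a ] → t ℕ.< q
    pt-affine {t} e with t ℕₚ.<? q
    ... | yes t<q = t<q
    pt-affine () | no _

    pt-toℕ : ∀ i → pt (toℕ i) ≡ [ to i ]
    pt-toℕ i with toℕ i ℕₚ.<? q
    ... | yes i<q = ≡.cong (λ j → [ to j ]) (Finₚ.fromℕ<-toℕ i i<q)
    ... | no  i≮q = contradiction (Finₚ.toℕ<n i) i≮q

    pt-fromℕ< : ∀ {t} (t<q : t ℕ.< q) → pt t ≡ [ to (fromℕ< t<q) ]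
    pt-fromℕ< t<q = ≡.trans (≡.cong pt (≡.sym (Finₚ.toℕ-fromℕ< t<q))) (pt-toℕ (fromℕ< t<q))

    pt-∞ : ∀ {t} → q ℕ.≤ t → pt t ≡ ∙
    pt-∞ {t} q≤t with t ℕₚ.<? q
    ... | yes t<q = contradiction q≤t (ℕₚ.<⇒≱ t<q)
    ... | no  _   = ≡.refl

    to-injective : ∀ {i j} → to i F.≈ to j → i ≡ j
    to-injective {i} {j} e = ≡.trans (≡.sym (strictlyInverseʳ i))
      (≡.trans (from-cong e) (strictlyInverseʳ j))

    pt-distinct : ∀ {t u} → t ℕ.< q → t ℕ.< u → ¬ pt t ≈F pt u
    pt-distinct {t} {u} t<q t<u e = cases (u ℕₚ.<? q)
      where
      e′ : [ to (fromℕ< t<q) ] ≈F pt u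
      e′ = ≡.subst (_≈F pt u) (pt-fromℕ< t<q) e
      cases : Dec (u ℕ.< q) → _
      cases (yes u<q) with ≡.subst ([ to (fromℕ< t<q) ] ≈F_) (pt-fromℕ< u<q) e′
      ... | [ e″ ] = ℕₚ.<⇒≢ t<u (Finₚ.fromℕ<-injective t u t<q u<q (to-injective e″))
      cases (no u≮q) with ≡.subst ([ to (fromℕ< t<q) ] ≈F_) (pt-∞ (ℕₚ.≮⇒≥ u≮q)) e′
      ... | ()

    +κ-/κ : ∀ {p p′} → p ℕ.+ κ ℕ.≤ p′ → p / κ ℕ.< p′ / κ
    +κ-/κ {p} {p′} p+κ≤p′ = begin
      suc (p / κ)      ≡⟨ ℕₚ.+-comm (p / κ) 1 ⟨
      p / κ ℕ.+ 1      ≡⟨ ≡.cong (p / κ ℕ.+_) (n/n≡1 κ) ⟨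
      p / κ ℕ.+ κ / κ  ≡⟨ +-distrib-/-∣ʳ p {κ} (∣-refl {κ}) ⟨
      (p ℕ.+ κ) / κ    ≤⟨ /-monoˡ-≤ κ p+κ≤p′ ⟩
      p′ / κ           ∎
      where open ℕₚ.≤-Reasoning

    -- At distance `κ` or more the entries lie in different blocks; the bound on the earlier one
    -- prevents both from being ∞.
    seq-distinct : ∀ {p p′} → p ℕ.< q ℕ.* κ → p ℕ.+ κ ℕ.≤ p′ → ¬ seq p ≈F seq p′
    seq-distinct p<qκ p+κ≤p′ = pt-distinct (m<n*o⇒m/o<n p<qκ) (+κ-/κ p+κ≤p′)

    t*κ+j/κ≡t : ∀ t j → j ℕ.< κ → (t ℕ.* κ ℕ.+ j) / κ ≡ t
    t*κ+j/κ≡t t j j<κ = begin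
      (t ℕ.* κ ℕ.+ j) / κ       ≡⟨ +-distrib-/-∣ˡ {t ℕ.* κ} j (n∣m*n t {κ}) ⟩
      t ℕ.* κ / κ ℕ.+ j / κ     ≡⟨ ≡.cong₂ ℕ._+_ (m*n/n≡m t κ) (m<n⇒m/n≡0 j<κ) ⟩
      t ℕ.+ 0                   ≡⟨ ℕₚ.+-identityʳ t ⟩
      t                         ∎
      where open ≡ₚ.≡-Reasoning

    block-const : ∀ t j → j ℕ.< κ → seq (t ℕ.* κ ℕ.+ j) ≡ pt t
    block-const t j j<κ = ≡.cong pt (t*κ+j/κ≡t t j j<κ)

    -- `M` = q κ - k - 1 is the last start of a window: as 2k = k + 1 + κ, the 2k entries from there
    -- end with the last of the first `κ` copies of ∞.
    module _ {M} (suc[M+k]≡qκ : suc (M ℕ.+ k) ≡ q ℕ.* κ) {i} (i≤M : i ℕ.≤ M) where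

      private
        -- The first members of all pairs, and the second member of the first pair, are thus affine
        -- and may serve as the earlier entry in `seq-distinct`.
        below : ∀ {p} → p ℕ.≤ k ℕ.+ i → p ℕ.< q ℕ.* κ
        below {p} p≤k+i = begin-strict
          p              ≤⟨ p≤k+i ⟩
          k ℕ.+ i        ≤⟨ ℕₚ.+-monoʳ-≤ k i≤M ⟩
          k ℕ.+ M        ≡⟨ ℕₚ.+-comm k M ⟩
          M ℕ.+ k        <⟨ ℕₚ.≤-refl ⟩
          suc (M ℕ.+ k)  ≡⟨ suc[M+k]≡qκ ⟩
          q ℕ.* κ        ∎
          where open ℕₚ.≤-Reasoning

        κ+i+κ≤ : i ℕ.+ κ ℕ.≤ κ ℕ.+ (k ℕ.+ i)
        κ+i+κ≤ = begin
          i ℕ.+ κ           ≡⟨ ℕₚ.+-comm i κ ⟩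
          κ ℕ.+ i           ≤⟨ ℕₚ.+-monoʳ-≤ κ (ℕₚ.m≤n+m i k) ⟩
          κ ℕ.+ (k ℕ.+ i)   ∎
          where open ℕₚ.≤-Reasoning

        -- A point on every pair would have to sit at each of the
        -- positions k + i, …, κ + k + i, which is more than κ of them.

        no-common-point : ∀ x → ¬ (∀ j → j ℕ.< k → x ≈F seq (j ℕ.+ i) ⊎ x ≈F seq (j ℕ.+ (k ℕ.+ i)))
        no-common-point x common = clash (below ℕₚ.≤-refl)
          (ℕₚ.≤-reflexive (ℕₚ.+-comm (k ℕ.+ i) κ))
          (second 0 (s≤s z≤n)) (second κ ℕₚ.≤-refl)
          where
          clash : ∀ {p p′} → p ℕ.< q ℕ.* κ → p ℕ.+ κ ℕ.≤ p′ → x ≈F seq p → ¬ x ≈F seq p′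
          clash p<qκ p+κ≤p′ e e′ = seq-distinct p<qκ p+κ≤p′ (≈F-trans (≈F-sym e) e′)
          second : ∀ j → j ℕ.< k → x ≈F seq (j ℕ.+ (k ℕ.+ i))
          second zero 0<k with common 0 0<k
          ... | inj₂ e = e
          -- A point at position i misses the last pair, both of whose members are at distance at
          -- least `κ` from i.
          ... | inj₁ e with common κ ℕₚ.≤-refl
          ...   | inj₁ e′ = contradiction e′
            (clash (below (ℕₚ.m≤n+m i k)) (ℕₚ.≤-reflexive (ℕₚ.+-comm i κ)) e)
          ...   | inj₂ e′ = contradiction e′ (clash (below (ℕₚ.m≤n+m i k)) κ+i+κ≤ e)
          second (suc j) 1+j<k with common (suc j) 1+j<k
          ... | inj₂ e = e
          -- The second member of the preceding pair comes exactly `κ` places after this first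
          -- member, so the two differ.
          ... | inj₁ e = contradiction (second j (ℕₚ.<⇒≤ 1+j<k))
            (clash (below (ℕₚ.+-monoˡ-≤ i (ℕₚ.<⇒≤ 1+j<k))) (ℕₚ.≤-reflexive gap≡) e)
            where
            gap≡ : suc j ℕ.+ i ℕ.+ κ ≡ j ℕ.+ (k ℕ.+ i)
            gap≡ = begin
              suc j ℕ.+ i ℕ.+ κ      ≡⟨ ℕₚ.+-assoc (suc j) i κ ⟩
              suc j ℕ.+ (i ℕ.+ κ)    ≡⟨ ≡.cong (suc j ℕ.+_) (ℕₚ.+-comm i κ) ⟩
              suc j ℕ.+ (κ ℕ.+ i)    ≡⟨ ℕₚ.+-suc j (κ ℕ.+ i) ⟨
              j ℕ.+ (k ℕ.+ i)        ∎
              where open ≡ₚ.≡-Reasoning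

      pairs-distinct : ∀ j → j ℕ.< k → ¬ seq (j ℕ.+ i) ≈F seq (j ℕ.+ (k ℕ.+ i))
      pairs-distinct j (s≤s j≤κ) = seq-distinct
        (below (ℕₚ.+-monoˡ-≤ i (ℕₚ.m≤n⇒m≤1+n j≤κ))) (begin
          j ℕ.+ i ℕ.+ κ     ≡⟨ ℕₚ.+-assoc j i κ ⟩
          j ℕ.+ (i ℕ.+ κ)   ≡⟨ ≡.cong (j ℕ.+_) (ℕₚ.+-comm i κ) ⟩
          j ℕ.+ (κ ℕ.+ i)   ≤⟨ ℕₚ.+-monoʳ-≤ j (ℕₚ.n≤1+n _) ⟩
          j ℕ.+ (k ℕ.+ i)   ∎)
        where open ℕₚ.≤-Reasoning

      window : KuriharaDatum F K ι k
      window = record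
        { r        = k
        ; 2≤r      = s≤s (s≤s z≤n)
        ; exponent = λ _ → 1
        ; 1≤exp    = λ _ → s≤s z≤n
        ; total    = sum-ones k
        ; α        = λ j → seq (toℕ j ℕ.+ i)
        ; β        = λ j → seq (toℕ j ℕ.+ (k ℕ.+ i))
        ; α≉β      = λ j → pairs-distinct (toℕ j) (Finₚ.toℕ<n j)
        ; disjoint = λ (x , common) → no-common-point x λ j j<k →
            ≡.subst (λ l → x ≈F seq (l ℕ.+ i) ⊎ x ≈F seq (l ℕ.+ (k ℕ.+ i)))
              (Finₚ.toℕ-fromℕ< j<k) (common (fromℕ< j<k))
        }
        where
        sum-ones : ∀ n → RawMonoidDefinitions.sum ℕ.+-0-rawMonoid {n} (λ _ → 1) ≡ n
        sum-ones zero    = ≡.refl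
        sum-ones (suc n) = ≡.cong suc (sum-ones n)

    -- Linear factors of the list and the Newton basis they define.

    f : ℕ → Poly
    f p = ℓ (point (seq p))

    -- The value at ∞ is a placeholder: whatever it is, the later entries are ∞ as well, and their
    -- factor 1 vanishes nowhere.
    coordinate : ℙ¹ᶠ F K ι → K.Carrier
    coordinate [ a ] = ι a
    coordinate ∙     = K.0#

    b : ℕ → K.Carrier
    b p = coordinate (seq p)

    seq-affine : ∀ {p} → p ℕ.< q ℕ.* κ → ∃[ a ] seq p ≡ [ a ]
    seq-affine p<qκ = _ , pt-fromℕ< (m<n*o⇒m/o<n p<qκ)

    f-affine : ∀ {p} → p ℕ.< q ℕ.* κ → f p ≡ linear (b p)
    f-affine {p} p<qκ with seq p | seq-affine p<qκ
    ... | _ | _ , ≡.refl = ≡.refl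

    f-∞ : ∀ {p} → q ℕ.* κ ℕ.≤ p → f p ≡ 1ₚ
    f-∞ {p} qκ≤p = ≡.cong (λ α → ℓ (point α)) (pt-∞
      (≡.subst (ℕ._≤ p / κ) (m*n/n≡m q κ) (/-monoˡ-≤ κ qκ≤p)))

    -- An affine entry at `p′` forces the earlier entry at `p` to be affine too, so `b p` is then a
    -- true coordinate and distinctness of the two points applies.
    coordinate-avoids : ∀ {p p′} → p ℕ.+ κ ℕ.≤ p′ → ¬ point (seq p′) ≈ᴷ [ b p ]
    coordinate-avoids {p} {p′} p+κ≤p′ e with seq p′ in eq
    coordinate-avoids {p} {p′} p+κ≤p′ [ e ] | [ a′ ] =
      pt-distinct p/κ<q (+κ-/κ p+κ≤p′) (≡.subst₂ _≈F_ (≡.sym seq-p≡) (≡.sym eq)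
        [ ι-injective (K.sym (≡.subst (λ x → ι a′ K.≈ coordinate x) seq-p≡ e)) ])
      where
      p/κ<q : p / κ ℕ.< q
      p/κ<q = ℕₚ.<-trans (+κ-/κ p+κ≤p′) (pt-affine {p′ / κ} eq)
      seq-p≡ = pt-fromℕ< p/κ<q

    open Newton b (λ j → f (j ℕ.+ (k ℕ.+ k))) (λ j → ℓ-degree≤ (point (seq (j ℕ.+ (k ℕ.+ k)))))
      (λ i j i≤j → eval-ℓ≉0 (point (seq (j ℕ.+ (k ℕ.+ k)))) (b i) (coordinate-avoids
        (ℕₚ.+-mono-≤ i≤j (ℕₚ.≤-trans (ℕₚ.n≤1+n κ) (ℕₚ.m≤m+n k k)))))
      public

    -- The window fills the hole between the two runs of factors in a Newton polynomial. The bound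
    -- keeps the nodes affine, where `linear (b i)` is the factor `f i`.
    newton-window : ∀ i n x → i ℕ.+ n ℕ.≤ q ℕ.* κ →
      newton i n x *ₚ prod f (toℕ x ℕ.+ i) (k ℕ.+ k) ≈ₚ prod f i (n ℕ.+ (k ℕ.+ k))
    newton-window i n zero _ = begin
      prod (λ j → f (j ℕ.+ (k ℕ.+ k))) i n *ₚ prod f i (k ℕ.+ k)
        ≡⟨ ≡.cong (_*ₚ prod f i (k ℕ.+ k)) (prod-shift f (k ℕ.+ k) i n) ⟩
      prod f (i ℕ.+ (k ℕ.+ k)) n *ₚ prod f i (k ℕ.+ k)
        ≈⟨ *ₚ-comm (prod f (i ℕ.+ (k ℕ.+ k)) n) (prod f i (k ℕ.+ k)) ⟩
      prod f i (k ℕ.+ k) *ₚ prod f (i ℕ.+ (k ℕ.+ k)) n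
        ≈⟨ prod-+ f i (k ℕ.+ k) n ⟨
      prod f i (k ℕ.+ k ℕ.+ n)
        ≡⟨ ≡.cong (prod f i) (ℕₚ.+-comm (k ℕ.+ k) n) ⟩
      prod f i (n ℕ.+ (k ℕ.+ k)) ∎
      where open SetoidReasoning polySetoid
    newton-window i (suc n) (suc x) i+1+n≤qκ = begin
      (linear (b i) *ₚ newton (suc i) n x) *ₚ prod f (suc (toℕ x ℕ.+ i)) (k ℕ.+ k)
        ≈⟨ *ₚ-assoc (linear (b i)) (newton (suc i) n x) (prod f (suc (toℕ x ℕ.+ i)) (k ℕ.+ k)) ⟩
      linear (b i) *ₚ (newton (suc i) n x *ₚ prod f (suc (toℕ x ℕ.+ i)) (k ℕ.+ k))
        ≡⟨ ≡.cong₂ (λ g p → g *ₚ (newton (suc i) n x *ₚ prod f p (k ℕ.+ k)))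
             (≡.sym (f-affine (ℕₚ.<-≤-trans (ℕₚ.m<m+n i (s≤s z≤n)) i+1+n≤qκ)))
             (≡.sym (ℕₚ.+-suc (toℕ x) i)) ⟩
      f i *ₚ (newton (suc i) n x *ₚ prod f (toℕ x ℕ.+ suc i) (k ℕ.+ k))
        ≈⟨ *ₚ-congʳ (f i) (newton-window (suc i) n x
             (≡.subst (ℕ._≤ q ℕ.* κ) (ℕₚ.+-suc i n) i+1+n≤qκ)) ⟩
      prod f i (suc n ℕ.+ (k ℕ.+ k)) ∎
      where open SetoidReasoning polySetoid

    -- The product of the identities `ℓℓσ≈gap` over the pairs. The constant is hidden because only
    -- its being non-zero matters.
    chain-cleared : ∀ r (α β : ℕ → ℙ¹ᶠ F K ι) → (∀ j → j ℕ.< r → ¬ α j ≈F β j) →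
      ∃[ a ] ¬ a K.≈ K.0# ×
        embed (prod (ℓ ∘ point ∘ α) 0 r *ₚ prod (ℓ ∘ point ∘ β) 0 r)
          ⊗ product F K ι {r} (λ j → s F K ι (α (toℕ j)) (β (toℕ j)) ^ᶠ 1) ≈ᶠ const a
    chain-cleared zero α β α≉β = K.1# , K.1≉0 ,
      L.trans (L.*-identityʳ (embed (1ₚ *ₚ 1ₚ))) (embed-cong (P.*-identityʳ 1ₚ))
    chain-cleared (suc r) α β α≉β =
      gap (point (α 0)) (point (β 0)) K.* proj₁ ih ,
      K.x*y≉0 (gap≉0 (point (α 0)) (point (β 0)) λ e → α≉β 0 (s≤s z≤n) (point-injective e))
        (proj₁ (proj₂ ih)) ,
      (begin
        embed ((A *ₚ prod fα 1 r) *ₚ (B *ₚ prod fβ 1 r)) ⊗ (s₀ ⊗ L.1# ⊗ rest)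
          ≡⟨ ≡.cong₂ (λ p p′ → embed ((A *ₚ p) *ₚ (B *ₚ p′)) ⊗ (s₀ ⊗ L.1# ⊗ rest))
               (≡.sym (prod-∘suc fα 0 r)) (≡.sym (prod-∘suc fβ 0 r)) ⟩
        embed ((A *ₚ A′) *ₚ (B *ₚ B′)) ⊗ (s₀ ⊗ L.1# ⊗ rest)
          ≈⟨ L.*-congʳ {s₀ ⊗ L.1# ⊗ rest} (L.trans (embed-cong (PI.xy*zw≈xz*yw A A′ B B′))
               (embed-* (A *ₚ B) (A′ *ₚ B′))) ⟩
        embed (A *ₚ B) ⊗ embed (A′ *ₚ B′) ⊗ (s₀ ⊗ L.1# ⊗ rest)
          ≈⟨ LI.xy*[s1*r]≈xs*yr (embed (A *ₚ B)) (embed (A′ *ₚ B′)) s₀ rest ⟩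
        embed (A *ₚ B) ⊗ s₀ ⊗ (embed (A′ *ₚ B′) ⊗ rest)
          ≈⟨ L.*-cong head≈ (proj₂ (proj₂ ih)) ⟩
        const (gap (point (α 0)) (point (β 0))) ⊗ const (proj₁ ih)
          ≈⟨ const-* _ _ ⟨
        const (gap (point (α 0)) (point (β 0)) K.* proj₁ ih) ∎)
      where
      open SetoidReasoning L.setoid
      fα = ℓ ∘ point ∘ α
      fβ = ℓ ∘ point ∘ β
      A = fα 0
      B = fβ 0
      A′ = prod (fα ∘ suc) 0 r
      B′ = prod (fβ ∘ suc) 0 r
      s₀ = s F K ι (α 0) (β 0)
      rest = product F K ι {r} (λ j → s F K ι (α (suc (toℕ j))) (β (suc (toℕ j))) ^ᶠ 1)
      ih = chain-cleared r (α ∘ suc) (β ∘ suc) λ j j<r → α≉β (suc j) (s≤s j<r)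
      head≈ : embed (A *ₚ B) ⊗ s₀ ≈ᶠ const (gap (point (α 0)) (point (β 0)))
      head≈ = ≡.subst (λ g → embed (A *ₚ B) ⊗ g ≈ᶠ const (gap (point (α 0)) (point (β 0))))
        (≡.sym (s≡σ (α 0) (β 0))) (ℓℓσ≈gap (point (α 0)) (point (β 0)))

    -- The windows form a basis of H⁰.

    module Basis {M} (suc[M+k]≡qκ : suc (M ℕ.+ k) ≡ q ℕ.* κ)
      (root : ∀ p n → HasDegree p (suc n) → ∃[ x ] eval p x K.≈ K.0#) where

      D : Poly
      D = prod f 0 (M ℕ.+ (k ℕ.+ k))

      length≡ : M ℕ.+ (k ℕ.+ k) ≡ q ℕ.* κ ℕ.+ κ
      length≡ = begin
        M ℕ.+ (k ℕ.+ k)       ≡⟨ ℕₚ.+-assoc M k k ⟨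
        M ℕ.+ k ℕ.+ suc κ     ≡⟨ ℕₚ.+-suc (M ℕ.+ k) κ ⟩
        suc (M ℕ.+ k) ℕ.+ κ   ≡⟨ ≡.cong (ℕ._+ κ) suc[M+k]≡qκ ⟩
        q ℕ.* κ ℕ.+ κ         ∎
        where open ≡ₚ.≡-Reasoning

      M≤qκ : M ℕ.≤ q ℕ.* κ
      M≤qκ = ≡.subst (M ℕ.≤_) suc[M+k]≡qκ (ℕₚ.m≤n⇒m≤1+n (ℕₚ.m≤m+n M k))

      D≈affine : D ≈ₚ prod f 0 (q ℕ.* κ)
      D≈affine = begin
        prod f 0 (M ℕ.+ (k ℕ.+ k))                         ≡⟨ ≡.cong (prod f 0) length≡ ⟩
        prod f 0 (q ℕ.* κ ℕ.+ κ)                           ≈⟨ prod-+ f 0 (q ℕ.* κ) κ ⟩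
        prod f 0 (q ℕ.* κ) *ₚ prod f (q ℕ.* κ) κ           ≈⟨ *ₚ-congʳ (prod f 0 (q ℕ.* κ)) tail≈1 ⟩
        prod f 0 (q ℕ.* κ) *ₚ 1ₚ                           ≈⟨ P.*-identityʳ (prod f 0 (q ℕ.* κ)) ⟩
        prod f 0 (q ℕ.* κ)                                 ∎
        where
        open SetoidReasoning polySetoid
        tail≈1 : prod f (q ℕ.* κ) κ ≈ₚ 1ₚ
        tail≈1 = ≈ₚ-trans
          (prod-const f (q ℕ.* κ) κ λ j _ → P.reflexive (f-∞ (ℕₚ.m≤m+n (q ℕ.* κ) j)))
          (PI.1^n≈1 κ)

      D-degree : HasDegree D (q ℕ.* κ)
      D-degree = hasDegree-cong {prod f 0 (q ℕ.* κ)} {D} (≈ₚ-sym D≈affine)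
        (prod-degree f 0 (q ℕ.* κ) λ j j<qκ →
          ≡.subst (λ p → HasDegree p 1) (≡.sym (f-affine j<qκ)) (linear-degree (b j)))

      D≉0 : ¬ D ≈ₚ 0ₚ
      D≉0 = hasDegree⇒≉0 {D} D-degree

      -- The block of the i-th affine point supplies the power that absorbs a pole of order `κ`
      -- there.
      D-factor : ∀ i → ∃[ p ] D ≈ₚ p *ₚ linear (ι (to i)) ^ κ
      D-factor i = prod f 0 (t ℕ.* κ) *ₚ rest , (begin
        D
          ≈⟨ D≈affine ⟩
        prod f 0 (q ℕ.* κ)
          ≡⟨ ≡.cong (prod f 0) split ⟩
        prod f 0 (t ℕ.* κ ℕ.+ (κ ℕ.+ n))
          ≈⟨ prod-+ f 0 (t ℕ.* κ) (κ ℕ.+ n) ⟩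
        prod f 0 (t ℕ.* κ) *ₚ prod f (t ℕ.* κ) (κ ℕ.+ n)
          ≈⟨ *ₚ-congʳ (prod f 0 (t ℕ.* κ)) (prod-+ f (t ℕ.* κ) κ n) ⟩
        prod f 0 (t ℕ.* κ) *ₚ (prod f (t ℕ.* κ) κ *ₚ rest)
          ≈⟨ *ₚ-congʳ (prod f 0 (t ℕ.* κ)) (P.*-congʳ {rest} block) ⟩
        prod f 0 (t ℕ.* κ) *ₚ (linear (ι (to i)) ^ κ *ₚ rest)
          ≈⟨ PI.x*yz≈xz*y (prod f 0 (t ℕ.* κ)) (linear (ι (to i)) ^ κ) rest ⟩
        (prod f 0 (t ℕ.* κ) *ₚ rest) *ₚ linear (ι (to i)) ^ κ ∎)
        where
        open SetoidReasoning polySetoid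
        t = toℕ i
        n = q ℕ.* κ ℕ.∸ (t ℕ.* κ ℕ.+ κ)
        rest = prod f (t ℕ.* κ ℕ.+ κ) n
        tκ+κ≤qκ : t ℕ.* κ ℕ.+ κ ℕ.≤ q ℕ.* κ
        tκ+κ≤qκ = ≡.subst (ℕ._≤ q ℕ.* κ) (ℕₚ.+-comm κ (t ℕ.* κ)) (ℕₚ.*-monoˡ-≤ κ (Finₚ.toℕ<n i))
        split : q ℕ.* κ ≡ t ℕ.* κ ℕ.+ (κ ℕ.+ n)
        split = ≡.trans (≡.sym (ℕₚ.m+[n∸m]≡n tκ+κ≤qκ)) (ℕₚ.+-assoc (t ℕ.* κ) κ n)
        block : prod f (t ℕ.* κ) κ ≈ₚ linear (ι (to i)) ^ κ
        block = prod-const f (t ℕ.* κ) κ λ j j<κ → P.reflexive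
          (≡.cong (λ α → ℓ (point α)) (≡.trans (block-const t j j<κ) (pt-toℕ i)))

      form : Fin (suc M) → RatFun
      form x = KuriharaDatum.form (window suc[M+k]≡qκ (Finₚ.toℕ≤pred[n] x))

      window-cleared : ∀ x → ∃[ a ] ¬ a K.≈ K.0# ×
        embed (prod f (toℕ x) (k ℕ.+ k)) ⊗ form x ≈ᶠ const a
      window-cleared x = proj₁ cleared , proj₁ (proj₂ cleared) , (begin
        embed (prod f i (k ℕ.+ k)) ⊗ form x
          ≈⟨ L.*-congʳ {form x} (embed-cong halves) ⟩
        embed (prod (λ j → f (j ℕ.+ i)) 0 k *ₚ prod (λ j → f (j ℕ.+ (k ℕ.+ i))) 0 k) ⊗ form x
          ≈⟨ proj₂ (proj₂ cleared) ⟩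
        const (proj₁ cleared) ∎)
        where
        open SetoidReasoning L.setoid
        i = toℕ x
        cleared = chain-cleared k (λ j → seq (j ℕ.+ i)) (λ j → seq (j ℕ.+ (k ℕ.+ i)))
          (pairs-distinct suc[M+k]≡qκ (Finₚ.toℕ≤pred[n] x))
        -- The first k entries of the window are the points α, the last k the points β.
        halves : prod f i (k ℕ.+ k) ≈ₚ
          prod (λ j → f (j ℕ.+ i)) 0 k *ₚ prod (λ j → f (j ℕ.+ (k ℕ.+ i))) 0 k
        halves = ≈ₚ-trans (prod-+ f i k k) (P.reflexive (≡.cong₂ _*ₚ_
          (≡.sym (prod-shift f i 0 k))
          (≡.trans (≡.cong (λ p → prod f p k) (ℕₚ.+-comm i k))
            (≡.sym (prod-shift f (k ℕ.+ i) 0 k)))))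

      scale : Fin (suc M) → K.Carrier
      scale x = proj₁ (window-cleared x)

      D⊗form : ∀ x → embed D ⊗ form x ≈ᶠ embed (scale x · newton 0 M x)
      D⊗form x = begin
        embed D ⊗ form x
          ≈⟨ L.*-congʳ {form x} (embed-cong (newton-window 0 M x M≤qκ)) ⟨
        embed (newton 0 M x *ₚ prod f (toℕ x ℕ.+ 0) (k ℕ.+ k)) ⊗ form x
          ≡⟨ ≡.cong (λ i → embed (newton 0 M x *ₚ prod f i (k ℕ.+ k)) ⊗ form x)
               (ℕₚ.+-identityʳ (toℕ x)) ⟩
        embed (newton 0 M x *ₚ w) ⊗ form x
          ≈⟨ L.*-congʳ {form x} (embed-* (newton 0 M x) w) ⟩
        embed (newton 0 M x) ⊗ embed w ⊗ form x
          ≈⟨ L.*-assoc (embed (newton 0 M x)) (embed w) (form x) ⟩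
        embed (newton 0 M x) ⊗ (embed w ⊗ form x)
          ≈⟨ L.*-congˡ {embed (newton 0 M x)} (proj₂ (proj₂ (window-cleared x))) ⟩
        embed (newton 0 M x) ⊗ const (scale x)
          ≈⟨ L.*-comm (embed (newton 0 M x)) (const (scale x)) ⟩
        const (scale x) ⊗ embed (newton 0 M x)
          ≈⟨ const-⊗-embed (scale x) (newton 0 M x) ⟩
        embed (scale x · newton 0 M x) ∎
        where
        open SetoidReasoning L.setoid
        w = prod f (toℕ x) (k ℕ.+ k)

      module _ {g} (g∈H⁰ : InH⁰ F K ι k κ g) where

        private
          regular-at-F : ∀ i → RegularAt [ ι (to i) ] (embed D ⊗ g)
          regular-at-F i = regular-cong [ ι (to i) ]
            {embed p ⊗ ((z- ι (to i)) ^ᶠ κ ⊗ (g ⊗ L.1# ^ᶠ k))} {embed D ⊗ g}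
            (begin
              embed p ⊗ (t ^ᶠ κ ⊗ (g ⊗ L.1# ^ᶠ k))
                ≈⟨ L.*-congˡ {embed p} (L.*-cong (L.sym (embed-^ (linear (ι (to i))) κ))
                     (L.trans (L.*-congˡ {g} (LI.1^n≈1 k)) (L.*-identityʳ g))) ⟩
              embed p ⊗ (embed (linear (ι (to i)) ^ κ) ⊗ g)
                ≈⟨ LI.x[yz]≈[xy]z (embed p) (embed (linear (ι (to i)) ^ κ)) g ⟩
              embed p ⊗ embed (linear (ι (to i)) ^ κ) ⊗ g
                ≈⟨ L.*-congʳ {g} (embed-* p (linear (ι (to i)) ^ κ)) ⟨
              embed (p *ₚ linear (ι (to i)) ^ κ) ⊗ g
                ≈⟨ L.*-congʳ {g} (embed-cong (proj₂ (D-factor i))) ⟨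
              embed D ⊗ g ∎)
            (regular-* [ ι (to i) ] {embed p} {t ^ᶠ κ ⊗ (g ⊗ L.1# ^ᶠ k)}
              (regular-polynomial (ι (to i)) p) (proj₁ g∈H⁰ [ to i ]))
            where
            open SetoidReasoning L.setoid
            p = proj₁ (D-factor i)
            t = z- ι (to i)

          regular-off-F : ∀ x → ¬ (∃[ i ] ι (to i) K.≈ x) → RegularAt [ x ] (embed D ⊗ g)
          regular-off-F x x∉F = regular-* [ x ] {embed D} {g} (regular-polynomial x D)
            (regular-cong [ x ] {g ⊗ L.1# ^ᶠ k} {g}
              (L.trans (L.*-congˡ {g} (LI.1^n≈1 k)) (L.*-identityʳ g))
              (proj₂ g∈H⁰ [ x ] λ
                { ∙     ()
                ; [ a ] [ e ] → x∉F (from a , K.trans (⟦⟧-cong (strictlyInverseˡ a)) e) }))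

        D⊗-regular : ∀ x → RegularAt [ x ] (embed D ⊗ g)
        -- Finiteness of F makes it decidable whether a point of K comes from F.
        D⊗-regular x = cases (Finₚ.any? λ i → ι (to i) K.≟ x)
          where
          cases : Dec (∃[ i ] ι (to i) K.≈ x) → RegularAt [ x ] (embed D ⊗ g)
          cases (yes (i , e)) = regular-point-cong (embed D ⊗ g) e (regular-at-F i)
          cases (no x∉F)      = regular-off-F x x∉F

        numerator : Poly
        numerator = proj₁ (regular⇒polynomial root (embed D ⊗ g) D⊗-regular)

        D⊗g≈numerator : embed D ⊗ g ≈ᶠ embed numerator
        D⊗g≈numerator = proj₂ (regular⇒polynomial root (embed D ⊗ g) D⊗-regular)

        private
          -- The polynomial form of (dz/dt)ᵏ at ∞, of degree 2k.
          w : Poly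
          w = (-ₚ (X *ₚ X)) ^ k

          w≈ : (⊖ (z ⊗ z)) ^ᶠ k ≈ᶠ embed w
          w≈ = L.trans (LI.^-congˡ k {⊖ (z ⊗ z)} {embed (-ₚ (X *ₚ X))}
            (L.-‿cong (L.sym (embed-* X X)))) (L.sym (embed-^ (-ₚ (X *ₚ X)) k))

          at-∞ : RegularAt ∙ (1/z ^ᶠ κ ⊗ (g ⊗ (⊖ (z ⊗ z)) ^ᶠ k))
          at-∞ = proj₁ g∈H⁰ ∙

          h = proj₁ at-∞
          n = proj₁ (proj₂ at-∞)

          -- The expansion at ∞ with denominators cleared.

          comparison : den h *ₚ (numerator *ₚ w) ≈ₚ (X ^ κ *ₚ D) *ₚ num h
          comparison = embed-injective (begin
            embed (den h *ₚ (numerator *ₚ w))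
              ≈⟨ L.trans (embed-* (den h) (numerator *ₚ w))
                   (L.*-congˡ {embed (den h)} (embed-* numerator w)) ⟩
            embed (den h) ⊗ (embed numerator ⊗ embed w)
              ≈⟨ L.*-congˡ {embed (den h)} (L.*-cong D⊗g≈numerator w≈) ⟨
            embed (den h) ⊗ (embed D ⊗ g ⊗ (⊖ (z ⊗ z)) ^ᶠ k)
              ≈⟨ LI.clear-power z 1/z (embed-den 1/z) κ (embed (den h)) (embed D) g
                   ((⊖ (z ⊗ z)) ^ᶠ k) ⟩
            z ^ᶠ κ ⊗ embed D ⊗ (embed (den h) ⊗ (1/z ^ᶠ κ ⊗ (g ⊗ (⊖ (z ⊗ z)) ^ᶠ k)))
              ≈⟨ L.*-cong
                   (L.trans (embed-* (X ^ κ) D) (L.*-congʳ {embed D} (embed-^ X κ)))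
                   (L.sym (≈⇒cleared {1/z ^ᶠ κ ⊗ (g ⊗ (⊖ (z ⊗ z)) ^ᶠ k)} {h}
                     (proj₁ (proj₂ (proj₂ at-∞))))) ⟨
            embed (X ^ κ *ₚ D) ⊗ embed (num h)
              ≈⟨ embed-* (X ^ κ *ₚ D) (num h) ⟨
            embed ((X ^ κ *ₚ D) *ₚ num h) ∎)
            where open SetoidReasoning L.setoid

          X-degree : HasDegree X 1
          X-degree = K.1≉0 , λ { (suc (suc i)) _ → K.refl ; 1 (s≤s ()) }

          w-degree : HasDegree w (k ℕ.* 2)
          w-degree = ^-degree (-ₚ (X *ₚ X)) k {2}
            (neg-degree (X *ₚ X) {2} (*ₚ-degree X X {1} {1} X-degree X-degree))

          -- In `comparison` the left side has degree n + d + 2k and the right side at most κ + q κ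
          -- + n, while (q + 1) κ - 2k = M. This is where the pole condition at ∞ enters.
          degree-bound : ∀ {d} → HasDegree numerator d → d ℕ.≤ M
          degree-bound {d} deg = ℕₚ.≮⇒≥ λ M<d → proj₁ left (K.trans
            (coeff-≈ comparison (n ℕ.+ (d ℕ.+ k ℕ.* 2))) (right _ (exceeds M<d)))
            where
            left : HasDegree (den h *ₚ (numerator *ₚ w)) (n ℕ.+ (d ℕ.+ k ℕ.* 2))
            left = *ₚ-degree (den h) (numerator *ₚ w) {n} {d ℕ.+ k ℕ.* 2}
              (proj₁ (proj₂ (proj₂ (proj₂ at-∞))))
              (*ₚ-degree numerator w {d} {k ℕ.* 2} deg w-degree)
            right : Degree≤ ((X ^ κ *ₚ D) *ₚ num h) (κ ℕ.* 1 ℕ.+ q ℕ.* κ ℕ.+ n)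
            right = proj₁ (top-coeff-* (X ^ κ *ₚ D) (num h) (κ ℕ.* 1 ℕ.+ q ℕ.* κ) n
              (proj₂ (*ₚ-degree (X ^ κ) D {κ ℕ.* 1} {q ℕ.* κ} (^-degree X κ {1} X-degree) D-degree))
              (proj₂ (proj₂ (proj₂ (proj₂ at-∞)))))
            exceeds : M ℕ.< d → κ ℕ.* 1 ℕ.+ q ℕ.* κ ℕ.+ n ℕ.< n ℕ.+ (d ℕ.+ k ℕ.* 2)
            exceeds M<d = begin-strict
              κ ℕ.* 1 ℕ.+ q ℕ.* κ ℕ.+ n   ≡⟨ ≡.cong (λ i → i ℕ.+ q ℕ.* κ ℕ.+ n) (ℕₚ.*-identityʳ κ) ⟩
              κ ℕ.+ q ℕ.* κ ℕ.+ n         ≡⟨ ≡.cong (ℕ._+ n) (ℕₚ.+-comm κ (q ℕ.* κ)) ⟩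
              q ℕ.* κ ℕ.+ κ ℕ.+ n         ≡⟨ ≡.cong (ℕ._+ n) length≡ ⟨
              M ℕ.+ (k ℕ.+ k) ℕ.+ n       <⟨ ℕₚ.+-monoˡ-< n (ℕₚ.+-monoˡ-< (k ℕ.+ k) M<d) ⟩
              d ℕ.+ (k ℕ.+ k) ℕ.+ n       ≡⟨ ℕₚ.+-comm _ n ⟩
              n ℕ.+ (d ℕ.+ (k ℕ.+ k))     ≡⟨ ≡.cong (λ i → n ℕ.+ (d ℕ.+ i)) k+k≡k*2 ⟩
              n ℕ.+ (d ℕ.+ k ℕ.* 2)       ∎
              where
              open ℕₚ.≤-Reasoning
              k+k≡k*2 : k ℕ.+ k ≡ k ℕ.* 2
              k+k≡k*2 = ≡.trans (≡.cong (k ℕ.+_) (≡.sym (ℕₚ.+-identityʳ k))) (ℕₚ.*-comm 2 k)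

        numerator-degree≤ : Degree≤ numerator M
        numerator-degree≤ = [ (λ ≈0 i _ → coeff-≈ ≈0 i)
          , (λ (d , deg) → degree≤-mono numerator (degree-bound deg) (proj₂ deg)) ]′
          (zero⊎hasDegree numerator)

        coefficients : Vector K.Carrier (suc M)
        coefficients x =
          proj₁ (newton-spans 0 M numerator numerator-degree≤) x
            K.* proj₁ (inverse (proj₁ (proj₂ (window-cleared x))))

        form-spans : g ≈ᶠ linearCombination forms coefficients form
        form-spans = embed-cancel {D} g (linearCombination forms coefficients form) D≉0 (begin
          embed D ⊗ g
            ≈⟨ D⊗g≈numerator ⟩
          embed numerator
            ≈⟨ embed-cong (proj₂ (newton-spans 0 M numerator numerator-degree≤)) ⟩
          embed (combination a (newton 0 M))
            ≈⟨ embed-cong (combination-congˡ (newton 0 M) rescale) ⟨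
          embed (combination (λ x → coefficients x K.* scale x) (newton 0 M))
            ≈⟨ cleared-combination D form scale (newton 0 M) D⊗form coefficients ⟨
          embed D ⊗ linearCombination forms coefficients form ∎)
          where
          open SetoidReasoning L.setoid
          a = proj₁ (newton-spans 0 M numerator numerator-degree≤)
          rescale : ∀ x → coefficients x K.* scale x K.≈ a x
          rescale x = K.trans (K.*-assoc _ _ _) (K.trans
            (K.*-congˡ (K.trans (K.*-comm _ _)
              (proj₂ (inverse (proj₁ (proj₂ (window-cleared x))))))) (K.*-identityʳ _))

      form-independent : ∀ a → linearCombination forms a form ≈ᶠ L.0# → ∀ x → a x K.≈ K.0#
      form-independent a e x = x*y≈0⇒y≈0 (proj₁ (proj₂ (window-cleared x)))
        (K.trans (K.*-comm _ _)
          (newton-independent 0 M (λ x → a x K.* scale x) (embed-injective (begin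
            embed (combination (λ x → a x K.* scale x) (newton 0 M))
              ≈⟨ cleared-combination D form scale (newton 0 M) D⊗form a ⟨
            embed D ⊗ linearCombination forms a form
              ≈⟨ L.*-congˡ {embed D} e ⟩
            embed D ⊗ L.0#
              ≈⟨ L.zeroʳ (embed D) ⟩
            L.0# ∎)) x))
        where open SetoidReasoning L.setoid

      form∈H⁰ : ∀ x → InH⁰ F K ι k κ (form x)
      form∈H⁰ x = kurihara∈H⁰ (window suc[M+k]≡qκ (Finₚ.toℕ≤pred[n] x))

      H⁰-dimension : HasDimension (H⁰ F K ι k κ) (suc M)
      H⁰-dimension = v , record
        { independent = λ a e → form-independent a
            (L.trans (L.reflexive (≡.sym (underlying a v))) e)
        ; spanning    = λ (g , g∈H⁰) → coefficients {g} g∈H⁰ ,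
            L.trans (form-spans {g} g∈H⁰) (L.reflexive (≡.sym (underlying (coefficients {g} g∈H⁰) v)))
        }
        where
        v : Vector (Σ RatFun (InH⁰ F K ι k κ)) (suc M)
        v x = form x , form∈H⁰ x
        -- A sum over `Fin (suc M)` is stuck on the variable `M`, so the first projection passes
        -- through it only by induction on the length.
        underlying : ∀ {n} a (v : Vector (Σ RatFun (InH⁰ F K ι k κ)) n) →
          proj₁ (linearCombination (H⁰ F K ι k κ) a v) ≡ linearCombination forms a (proj₁ ∘ v)
        underlying {zero}  a v = ≡.refl
        underlying {suc n} a v = ≡.cong (const (a zero) ⊗ proj₁ (v zero) ⊕_)
          (underlying (a ∘ suc) (v ∘ suc))

      -- Indices are passed propositionally: comparing H⁰ at arguments that
      -- are convertible but not identical unfolds the whole module.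

      H⁰-dimension-at : ∀ {j l N} → k ≡ j → κ ≡ l → suc M ≡ N → HasDimension (H⁰ F K ι j l) N
      H⁰-dimension-at ≡.refl ≡.refl ≡.refl = H⁰-dimension

      H⁰⊆span : ∀ g → InH⁰ F K ι k κ g → Span forms (IsKurihara F K ι k) g
      H⁰⊆span g g∈H⁰ = suc M , coefficients {g} g∈H⁰ , form ,
        (λ x → window suc[M+k]≡qκ (Finₚ.toℕ≤pred[n] x) , L.refl) , form-spans {g} g∈H⁰

-- The arithmetic of N and the conclusion.

-- For q at least 3 and k at least 2, k(q - 1) - q is at least q - 2, hence positive: the truncated
-- subtraction is exact and N has the form `suc M`.
3≤oddPrimePower : ∀ {q} → OddPrimePower q → 3 ℕ.≤ q
3≤oddPrimePower {q} (p , suc n , p-prime , _ , q≡pⁿ , 2∤q) =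
  ℕₚ.≤∧≢⇒< 2≤q λ 2≡q → 2∤q (≡.subst (2 ∣_) 2≡q ∣-refl)
  where
  instance _ = prime⇒nonZero p-prime
  2≤q : 2 ℕ.≤ q
  2≤q = begin
    2             ≤⟨ nonTrivial⇒n>1 p {{prime⇒nonTrivial p-prime}} ⟩
    p             ≤⟨ ℕₚ.m≤m*n p (p ℕ.^ n) {{ℕₚ.m^n≢0 p n}} ⟩
    p ℕ.* p ℕ.^ n ≡⟨ q≡pⁿ ⟨
    q             ∎
    where open ℕₚ.≤-Reasoning

module _ {c ℓ₁ ℓ₂ c′ ℓ₁′ ℓ₂′} (F : DiscreteField c ℓ₁ ℓ₂) (K : DiscreteField c′ ℓ₁′ ℓ₂′)
  (ι : DiscreteField.Carrier F → DiscreteField.Carrier K) (closure : IsAlgebraicClosure F K ι)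
  where

  open IsAlgebraicClosure closure
  open KuriharaProperties F K ι isRingHomomorphism

  dimension∧span : ∀ q → 3 ℕ.≤ q → HasCardinality (DiscreteField.setoid F) q →
    ∀ k → 2 ℕ.≤ k →
    HasDimension (H⁰ F K ι k (k ℕ.∸ 1)) (k ℕ.* (q ℕ.∸ 1) ℕ.∸ q)
    × (∀ ω → InH⁰ F K ι k (k ℕ.∸ 1) ω ⇔ Span (RationalFunctions.forms K) (IsKurihara F K ι k) ω)
  dimension∧span q@(suc (suc (suc n))) (s≤s (s≤s (s≤s _))) card k@(suc κ@(suc m)) (s≤s (s≤s _)) =
    H⁰-dimension-at {k} {k ℕ.∸ 1} {k ℕ.* (q ℕ.∸ 1) ℕ.∸ q} ≡.refl ≡.refl suc-M≡N ,
    λ ω → mk⇔ (H⁰⊆span ω) (span⊆H⁰ k ω)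
    where
    -- This is q κ - k - 1 for q = n + 3 and k = m + 2, written without subtraction.
    M : ℕ
    M = m ℕ.+ (m ℕ.+ n ℕ.* κ)
    suc[M+k]≡qκ : suc (M ℕ.+ k) ≡ q ℕ.* κ
    suc[M+k]≡qκ = solve 2 (λ m r → con 1 :+ ((m :+ (m :+ r)) :+ (con 2 :+ m)) :=
      (con 1 :+ m) :+ ((con 1 :+ m) :+ ((con 1 :+ m) :+ r))) ≡.refl m (n ℕ.* κ)
    suc-M≡N : suc M ≡ k ℕ.* (q ℕ.∸ 1) ℕ.∸ q
    suc-M≡N = ≡.trans (≡.sym (ℕₚ.m+n∸n≡m (suc M) q)) (≡.cong (ℕ._∸ q)
      (solve 2 (λ m n → con 1 :+ (m :+ (m :+ n :* (con 1 :+ m))) :+ (con 3 :+ n) :=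
        (con 2 :+ m) :* (con 2 :+ n)) ≡.refl m n))
    open Sequence.Basis card m suc[M+k]≡qκ algebraicallyClosed

open import Data.Nat using (_≤_; _*_; _∸_)

lemma5p1p4 : ∀ {c ℓ₁ ℓ₂ c′ ℓ₁′ ℓ₂′ : Level}
    (q : ℕ) → OddPrimePower q →
    (F : DiscreteField c ℓ₁ ℓ₂) → HasCardinality (DiscreteField.setoid F) q →
    (K : DiscreteField c′ ℓ₁′ ℓ₂′)
    (ι : DiscreteField.Carrier F → DiscreteField.Carrier K) → IsAlgebraicClosure F K ι →
    (k : ℕ) → 2 ≤ k →
    HasDimension (H⁰ F K ι k (k ∸ 1)) (k * (q ∸ 1) ∸ q)
    × (∀ ω → InH⁰ F K ι k (k ∸ 1) ω ⇔ Span (RationalFunctions.forms K) (IsKurihara F K ι k) ω)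
lemma5p1p4 q odd F card K ι closure = dimension∧span F K ι closure q (3≤oddPrimePower odd) card
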